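{- The family $\Gamma(\mathcal G_m)$ of all $\mathcal G_m$-networks is strongly universal.
   Context: $\mathcal G$-networks. Let $Q$ be a finite alphabet and $\mathcal G$ a set of maps $g:Q^{i(g)}\to Q^{o(g)}$. A $\mathcal G$-network is an automata network $F:Q^V\to Q^V$ together with gates $g_1,\dots,g_n\in\mathcal G$ such that, with $I=\{(j,k):1\le j\le n,1\le k\le i(g_j)\}$ and $O=\{(j,k):1\le j\le n,1\le k\le o(g_j)\}$, we have $|V|=|I|=|O|$ and bijections $\alpha:I\to V$, $\beta:V\to O$ such that there is no $(j,k)\in I$ with $\beta(\alpha(j,k))=(j,k')$ for some $k'$, and for each $v\in V$ with $\beta(v)=(j,k)$: $F(x)_v=g_j(x_{\alpha(j,1)},\dots,x_{\alpha(j,i(g_j))})_k$. $\Gamma(\mathcal G)$ is the family of all $\mathcal G$-networks with their bounded-degree representation (interaction graph plus local transition tables). $\mathcal G_m$ consists of the maps $\mathrm{AND},\mathrm{OR}:\{0,1\}^i\to\{0,1\}^o$ for all $i,o\in\{1,2\}$, where every output of $\mathrm{AND}$ equals the minimum of the inputs and every output of $\mathrm{OR}$ equals their maximum. Representations and simulation. An automata network is $F:Q^V\to Q^V$; a communication graph has $F(x)_v$ depending only on in-neighbours of $v$. For each finite alphabet fix an injective $m_Q:Q\to\{0,1\}^{k_Q}$ extended cellwise; a circuit encoding of $F:Q^n\to Q^n$ is a Boolean circuit $C$ with $m_Q\circ F=C\circ m_Q$. A standard representation of a family is a language with a logarithmic-space algorithm producing a circuit encoding of a member from each word, all members being represented.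 A block embedding of $Q_F^{V_F}$ into $Q_G^{V_G}$ is a partition $(D_i)_{i\in V_F}$ of $V_G$ with patterns $p_{i,q}\in Q_G^{D_i}$ injective in $q$, giving $\phi(x)|_{D_i}=p_{i,x_i}$; $G$ simulates $F$ via $\phi$ with time constant $T$ if $\phi\circ F=G^T\circ\phi$. A family $(\mathcal F,\mathcal F^*)$ simulates $(\mathcal H,\mathcal H^*)$ in time $T$ and space $S$ if a logarithmic-space Turing machine maps each word representing $H:Q_H^n\to Q_H^n$ to a word representing $F\in\mathcal F$ on $S(n)$ nodes, the number $T(n)$ and a block embedding via which $F$ simulates $H$ with time constant $T(n)$. $\mathcal B_{Q,\Delta}$ is the family of networks over $Q$ with a communication graph of maximum degree $\le\Delta$, represented by such a graph plus local transition tables. A family is strongly universal if for all finite $Q$ and all $\Delta\ge1$ it simulates $\mathcal B_{Q,\Delta}$ in constant time $T$ and linear space $S$. -}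

module Defs where

open import Data.Nat using (ℕ; zero; suc; _+_; _*_; _^_; _≤_)
open import Data.Nat.Logarithm using (⌊log₂_⌋)
open import Data.Nat.Binary.Base using (ℕᵇ; 2[1+_]; 1+[2_]) renaming (zero to zeroᵇ; fromℕ to toBin)
open import Data.Fin using (Fin; toℕ)
open import Data.Bool using (Bool; true; false; if_then_else_)
open import Data.Maybe using (Maybe; just; nothing)
open import Data.List using (List; []; _∷_; _++_; map; concat; length; _∷ʳ_; lookup)
open import Data.List.Relation.Unary.All using (All)
open import Data.List.Relation.Unary.Unique.Propositional using (Unique)
open import Data.List.Membership.Propositional using (_∈_)
open import Data.Vec.Functional using (toList)
open import Data.Product using (Σ; _×_; _,_; proj₁; proj₂; ∃)
open import Function.Definitions using (Bijective)
open import Relation.Binary.PropositionalEquality using (_≡_; _≢_)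

Network : ℕ → ℕ → Set
Network q n = (Fin n → Fin q) → (Fin n → Fin q)

iter : {A : Set} → ℕ → (A → A) → A → A
iter zero    f a = a
iter (suc t) f a = f (iter t f a)

-- Words over a fixed finite alphabet, and a generic prefix-free
-- encoding of finite trees of natural numbers.

data Sym : Set where
  s0 s1 dot open′ close′ : Sym

data Tree : Set where
  leaf : ℕ → Tree
  node : List Tree → Tree

-- bijective base-2 digits
bitsᵇ : ℕᵇ → List Sym
bitsᵇ zeroᵇ     = []
bitsᵇ 1+[2 x ]  = s0 ∷ bitsᵇ x
bitsᵇ 2[1+ x ]  = s1 ∷ bitsᵇ x

mutual
  enc : Tree → List Sym
  enc (leaf k)  = bitsᵇ (toBin k) ++ (dot ∷ [])
  enc (node ts) = open′ ∷ encs ts ++ (close′ ∷ [])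

  encs : List Tree → List Sym
  encs []       = []
  encs (t ∷ ts) = enc t ++ encs ts

leafF : {k : ℕ} → Fin k → Tree
leafF i = leaf (toℕ i)

-- Bounded-degree representation: communication graph (list of
-- in-neighbours of every node) plus local transition tables.

record NetRep (q n : ℕ) : Set where
  field
    nbrs  : Fin n → List (Fin n)
    table : Fin n → List (Fin q)
open NetRep public

encNetRep : {q n : ℕ} → NetRep q n → Tree
encNetRep {q} {n} R =
  node (leaf n ∷ node (toList (λ v →
          node (node (map leafF (nbrs R v)) ∷ node (map leafF (table R v)) ∷ []))) ∷ [])

lexIndex : (q : ℕ) → List (Fin q) → ℕ
lexIndex q []       = 0
lexIndex q (a ∷ as) = toℕ a * q ^ length as + lexIndex q as

lookupℕ : {A : Set} → List A → ℕ → Maybe A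
lookupℕ []       _       = nothing
lookupℕ (a ∷ as) zero    = just a
lookupℕ (a ∷ as) (suc k) = lookupℕ as k

Denotes : {q n : ℕ} → NetRep q n → Network q n → Set
Denotes {q} {n} R F =
  (∀ v → Unique (nbrs R v)) ×
  (∀ v → length (table R v) ≡ q ^ length (nbrs R v)) ×
  (∀ x v → lookupℕ (table R v) (lexIndex q (map x (nbrs R v))) ≡ just (F x v))

DegreeBound : {q n : ℕ} → ℕ → NetRep q n → Set
DegreeBound {q} {n} Δ R =
  (∀ v → length (nbrs R v) ≤ Δ) ×
  (∀ v (us : List (Fin n)) → Unique us → All (λ u → v ∈ nbrs R u) us → length us ≤ Δ)

RepB : (q Δ : ℕ) → List Sym → (n : ℕ) → Network q n → Set
RepB q Δ w n H = Σ (NetRep q n) λ R → DegreeBound Δ R × Denotes R H × enc (encNetRep R) ≡ w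

data GateKind : Set where
  AND OR : GateKind

min2 max2 : Fin 2 → Fin 2 → Fin 2
min2 Fin.zero    _ = Fin.zero
min2 (Fin.suc _) b = b
max2 Fin.zero    b = b
max2 (Fin.suc i) _ = Fin.suc i

-- value (identical on every output) of a gate with m+1 inputs
gateVal : GateKind → (m : ℕ) → (Fin (suc m) → Fin 2) → Fin 2
gateVal g zero    xs = xs Fin.zero
gateVal AND (suc m) xs = min2 (xs Fin.zero) (gateVal AND m (λ k → xs (Fin.suc k)))
gateVal OR  (suc m) xs = max2 (xs Fin.zero) (gateVal OR  m (λ k → xs (Fin.suc k)))

-- F is a G_m-network: gates g_1..g_g, each AND or OR with
-- i(g_j) = 1 + inAr j ∈ {1,2} inputs and o(g_j) = 1 + outAr j ∈ {1,2} outputs.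
record GmNetwork (n : ℕ) (F : Network 2 n) : Set where
  field
    gates : ℕ
    kind  : Fin gates → GateKind
    inAr  : Fin gates → Fin 2
    outAr : Fin gates → Fin 2
    α     : Σ (Fin gates) (λ j → Fin (suc (toℕ (inAr j))))  → Fin n
    β     : Fin n → Σ (Fin gates) (λ j → Fin (suc (toℕ (outAr j))))
    α-bij : Bijective _≡_ _≡_ α
    β-bij : Bijective _≡_ _≡_ β
    noSelfLoop : ∀ j k → proj₁ (β (α (j , k))) ≢ j
    local : ∀ x v → F x v ≡ gateVal (kind (proj₁ (β v))) (toℕ (inAr (proj₁ (β v))))
                                    (λ k → x (α (proj₁ (β v) , k)))

RepΓ : List Sym → (m : ℕ) → Network 2 m → Set
RepΓ w m F = RepB 2 2 w m F × GmNetwork m F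

-- Block embeddings of (Fin q)^(Fin n) into (Fin 2)^(Fin m).
-- D_i = { u | blk u ≡ i }, and p_{i,a} = pat a restricted to D_i.

record BlockEmb (q n m : ℕ) : Set where
  field
    blk : Fin m → Fin n
    pat : Fin q → Fin m → Fin 2
open BlockEmb public

IsBlockEmb : {q n m : ℕ} → BlockEmb q n m → Set
IsBlockEmb {q} {n} {m} E =
  (∀ i → ∃ λ u → blk E u ≡ i) ×
  (∀ i a b → (∀ u → blk E u ≡ i → pat E a u ≡ pat E b u) → a ≡ b)

embed : {q n m : ℕ} → BlockEmb q n m → (Fin n → Fin q) → (Fin m → Fin 2)
embed E x u = pat E (x (blk E u)) u

encEmb : {q n m : ℕ} → BlockEmb q n m → Tree
encEmb {q} {n} {m} E =
  node (node (toList (λ u → leafF (blk E u))) ∷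
        node (toList (λ a → node (toList (λ u → leafF (pat E a u))))) ∷ [])

Simulates : {q n m : ℕ} → Network 2 m → Network q n → BlockEmb q n m → ℕ → Set
Simulates G F E T = ∀ x u → embed E (F x) u ≡ iter T G (embed E x) u

-- Deterministic Turing machines with a two-way read-only input tape
-- (with end markers), one work tape over {blank,0,1}, and a write-only
-- output tape; logarithmic space is measured on the work tape.

data InRead : Set where
  lend rend : InRead
  sym : Sym → InRead

data Move : Set where
  mL mS mR : Move

record TM : Set where
  field
    states : ℕ
    start  : Fin states
    halts  : Fin states → Bool
    δ      : Fin states → InRead → Fin 3 →
             Fin states × Move × Fin 3 × Move × Maybe Sym

record Config (M : TM) : Set where
  constructor cfg
  field
    st   : Fin (TM.states M)
    ipos : ℕ
    tape : ℕ → Fin 3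
    wpos : ℕ
    out  : List Sym
open Config public

readIn : List Sym → ℕ → InRead
readIn w zero = lend
readIn w (suc i) with lookupℕ w i
... | just a  = sym a
... | nothing = rend

moveIn : ℕ → ℕ → Move → ℕ
moveIn len i       mL = Data.Nat.pred i
moveIn len i       mS = i
moveIn len i       mR = if Data.Nat._≤ᵇ_ (suc i) (suc len) then suc i else i

moveW : ℕ → Move → ℕ
moveW i mL = Data.Nat.pred i
moveW i mS = i
moveW i mR = suc i

write : (ℕ → Fin 3) → ℕ → Fin 3 → (ℕ → Fin 3)
write t i b j = if Data.Nat._≡ᵇ_ i j then b else t j

appendOut : List Sym → Maybe Sym → List Sym
appendOut o nothing  = o
appendOut o (just a) = o ∷ʳ a

step : (M : TM) → List Sym → Config M → Config M
step M w c with TM.halts M (st c)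
... | true  = c
... | false with TM.δ M (st c) (readIn w (ipos c)) (tape c (wpos c))
...   | (s′ , mi , b , mw , o) =
        cfg s′ (moveIn (length w) (ipos c) mi) (write (tape c) (wpos c) b)
            (moveW (wpos c) mw) (appendOut (out c) o)

initCfg : (M : TM) → Config M
initCfg M = cfg (TM.start M) 0 (λ _ → Fin.zero) 0 []

run : (M : TM) → List Sym → ℕ → Config M
run M w t = iter t (step M w) (initCfg M)

LogSpaceRun : TM → ℕ → List Sym → List Sym → Set
LogSpaceRun M c w o = ∃ λ t →
  TM.halts M (st (run M w t)) ≡ true × out (run M w t) ≡ o ×
  (∀ t′ → t′ ≤ t → wpos (run M w t′) ≤ c * suc ⌊log₂ length w ⌋)

SimulatesB : (q Δ : ℕ) → ℕ → (ℕ → ℕ) → Set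
SimulatesB q Δ T S = Σ TM λ M → Σ ℕ λ c →
  ∀ (w : List Sym) (n : ℕ) (H : Network q n) → RepB q Δ w n H →
    Σ (NetRep 2 (S n)) λ R → Σ (Network 2 (S n)) λ F → Σ (BlockEmb q n (S n)) λ E →
      RepΓ (enc (encNetRep R)) (S n) F × IsBlockEmb E × Simulates F H E T ×
      LogSpaceRun M c w (enc (node (encNetRep R ∷ leaf T ∷ encEmb E ∷ [])))

StronglyUniversalΓGm : Set
StronglyUniversalΓGm = ∀ (q Δ : ℕ) → 1 ≤ Δ →
  Σ ℕ λ T → Σ (ℕ → ℕ) λ S → Σ ℕ λ k →
    (∀ n → S n ≤ k * suc n) × SimulatesB q Δ T S

{-# OPTIONS --safe #-}
module Submission where

-- A block of the simulating network is a straight-line program on bit wires whose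
-- instructions are AND and OR gates with two inputs and two outputs, so that every
-- instruction occupies one layer and preserves the number of wires. A wire carrying 0 makes
-- copying (OR with 0) and erasing (AND with 0) possible, and monotone gates keep the
-- layers without a codeword at 0, so after one turn through all layers exactly the initial
-- pattern is restored. The states are one-hot encoded; each block copies its state to Δ
-- incoming and Δ outgoing ports, one layer swaps the two ports at the ends of every edge,
-- and then the table is evaluated term by term, the table entries entering only as the
-- presence or absence of gates.
--
-- The Turing machine keeps six interleaved binary numerals on its work tape. The only
-- global information it needs is the rank of an edge among the edges leaving the same
-- node, which it finds by scanning the input; node numbers are affine functions of numbers
-- in registers and are computed digit by digit with a finite carry.

-- In a network over AND and OR gates every node is an input of exactly one gate and an output of
-- exactly one gate, so a value can be neither duplicated nor dropped for free. Communication
-- between blocks therefore has to be a permutation of wires. This is why a node prepares Δ private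
-- copies of its state, why ports are swapped instead of read, and why the edges leaving a node must
-- be ranked: both ends of an edge have to agree on the outgoing port that belongs to it, and the
-- bound on the out-degree makes Δ such ports enough. For the same reason every scratch wire and
-- every port has to be brought back to 0 explicitly.
--
-- Transition tables differ from node to node, but the time constant must not. Hence one program,
-- depending on q and Δ only, serves all nodes: it runs through all tuples of states, all in-degrees
-- and all values, and the table of a node merely decides which of these gates exist. The number of
-- instructions is the time constant, and a block has one node for every instruction and wire.

open import Data.Bool using (Bool; true; false; if_then_else_; _∧_; not)
import Data.Bool as Bool
open import Data.Bool.Properties using (∧-conicalˡ)
open import Data.Empty using (⊥; ⊥-elim)
open import Data.Fin using (Fin; toℕ; zero; suc; _≟_; fromℕ; fromℕ<; inject₁; lower₁; combine; _↑ˡ_; _↑ʳ_)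
open import Data.Fin.Properties using (toℕ-injective; toℕ<n; toℕ≤pred[n]; toℕ-fromℕ; toℕ-fromℕ<; toℕ-inject₁; inject₁-lower₁; lower₁-inject₁′; +↔⊎; *↔×; toℕ-combine)
open import Data.List using (List; []; _∷_; _++_; _∷ʳ_; map; concat; concatMap; length; lookup; allFin; tabulate; filter; take; upTo; cartesianProduct; cartesianProductWith; initLast; _∷ʳ′_)
open import Data.List.Membership.Propositional using (_∈_; _∉_)
open import Data.List.Membership.Propositional.Properties using (∈-map⁺; ∈-map⁻; ∈-concatMap⁺; ∈-++⁺ˡ; ∈-++⁺ʳ; ∈-++⁻; ∈-allFin; ∈-filter⁺; ∈-filter⁻; ∈-lookup; ∈-cartesianProduct⁺; ∈-cartesianProductWith⁺; ∈-upTo⁺)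
open import Data.List.Properties using (++-assoc; ++-identityʳ; length-++; length-map; length-tabulate; map-++; map-tabulate; tabulate-cong; concat-++; concatMap-cong; concatMap-map)
open import Data.List.Relation.Unary.All using (All; []; _∷_)
import Data.List.Relation.Unary.All as All
import Data.List.Relation.Unary.All.Properties as All
open import Data.List.Relation.Unary.AllPairs using ([]; _∷_)
open import Data.List.Relation.Unary.Any using (here; there)
import Data.List.Relation.Unary.Any as Any
open import Data.List.Relation.Unary.Any.Properties using (lookup-index)
open import Data.List.Relation.Unary.Unique.Propositional using (Unique)
open import Data.List.Relation.Unary.Unique.Propositional.Properties using (filter⁺; allFin⁺; cartesianProduct⁺)
open import Data.Maybe using (Maybe; just; nothing; maybe)
import Data.Maybe as Maybe
import Data.Maybe.Properties as Maybe
open import Data.Nat using (ℕ; zero; suc; pred; _+_; _*_; _^_; _⊓_; ⌊_/2⌋; _≤_; _<_; z≤n; s≤s; _≡ᵇ_; _≤?_)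
import Data.Nat as ℕ
open import Data.Nat.Binary.Base using (2[1+_]; 1+[2_]) renaming (zero to zeroᵇ; fromℕ' to toBin′; suc to sucᵇ)
open import Data.Nat.Binary.Properties using (fromℕ≡fromℕ')
open import Data.Nat.DivMod using (_/_; _mod_; m≡m%n+[m/n]*n; [m+kn]%n≡m%n; m<n⇒m%n≡m; m<n⇒m/n≡0; m*n/n≡m; +-distrib-/-∣ʳ)
open import Data.Nat.Divisibility using (n∣m*n)
open import Data.Nat.Logarithm using (⌊log₂_⌋; ⌊log₂⌋-mono-≤; ⌊log₂[2^n]⌋≡n)
open import Data.Nat.Properties hiding (_≟_; _≤?_)
open import Data.Product using (Σ; _×_; _,_; proj₁; proj₂; ∃; map₁; uncurry)
open import Data.Product.Function.NonDependent.Propositional using (_×-↔_)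
import Data.Product.Properties as ×
open import Data.Sum using (_⊎_; inj₁; inj₂)
open import Data.Sum.Function.Propositional using (_⊎-↔_)
import Data.Sum.Properties as ⊎
open import Data.Unit using (⊤; tt)
open import Data.Vec using (Vec; []; _∷_; _[_]≔_)
import Data.Vec as Vec
open import Data.Vec.Properties using (lookup∘update; lookup∘update′; lookup∘tabulate; lookup-map; lookup-replicate; []≔-idempotent; []≔-lookup; map-[]≔)
open import Function using (_∘_; _↔_; Inverse)
open import Function.Properties.Inverse using (↔-trans; ↔-refl)
open import Relation.Binary.PropositionalEquality
open import Relation.Nullary using (Dec; yes; no; contradiction; does)
open import Relation.Nullary.Decidable using (dec-true; dec-false)
open import Defs renaming (sym to inSym)

-- Finite types

record Finite (A : Set) : Set where
  field
    elems    : List A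
    complete : ∀ a → a ∈ elems
open Finite

ΣF : {A : Set} {B : A → Set} → Finite A → (∀ a → Finite (B a)) → Finite (Σ A B)
ΣF FA FB .elems = concatMap (λ a → map (a ,_) (elems (FB a))) (elems FA)
ΣF FA FB .complete (a , b) =
  ∈-concatMap⁺ (λ a → map (a ,_) (elems (FB a)))
    (Any.map (λ { refl → ∈-map⁺ (a ,_) (complete (FB a) b) }) (complete FA a))

⊎F : {A B : Set} → Finite A → Finite B → Finite (A ⊎ B)
⊎F FA FB .elems = map inj₁ (elems FA) ++ map inj₂ (elems FB)
⊎F FA FB .complete (inj₁ a) = ∈-++⁺ˡ (∈-map⁺ inj₁ (complete FA a))
⊎F FA FB .complete (inj₂ b) = ∈-++⁺ʳ (map inj₁ (elems FA)) (∈-map⁺ inj₂ (complete FB b))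

instance
  Finite-⊤ : Finite ⊤
  Finite-⊤ .elems = tt ∷ []
  Finite-⊤ .complete tt = here refl

  Finite-Bool : Finite Bool
  Finite-Bool .elems = true ∷ false ∷ []
  Finite-Bool .complete true  = here refl
  Finite-Bool .complete false = there (here refl)

  Finite-Fin : ∀ {n} → Finite (Fin n)
  Finite-Fin .elems = allFin _
  Finite-Fin .complete = ∈-allFin

  Finite-× : {A B : Set} → {{Finite A}} → {{Finite B}} → Finite (A × B)
  Finite-× {{FA}} {{FB}} = ΣF FA (λ _ → FB)

-- Structured programs: one machine step, sequencing and iteration, where the
-- result of a program is a finite amount of information kept in the control.

Action : Set
Action = Move × Fin 3 × Move × Maybe Sym

data Prog : Set → Set₁ where
  act  : {A : Set} → (InRead → Fin 3 → A × Action) → Prog A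
  bind : {A B : Set} → Finite B → Prog B → (B → Prog A) → Prog A
  loop : {A B : Set} → Finite B → (B → Prog (B ⊎ A)) → B → Prog A

infixl 1 _>>=_ _>>_

_>>=_ : {A B : Set} {{_ : Finite B}} → Prog B → (B → Prog A) → Prog A
_>>=_ {{F}} = bind F

_>>_ : {A : Set} → Prog ⊤ → Prog A → Prog A
p >> p₂ = p >>= λ _ → p₂

-- Control points. Past the first half of a `bind`, and throughout the body of a `loop`, the label
-- carries the value on which the rest depends; this is where returned values are stored, and the
-- reason why `bind` and `loop` ask for a finite type.
Label : {A : Set} → Prog A → Set
Label (act f)          = ⊤
Label (bind {B = B} _ p f) = Label p ⊎ Σ B (λ b → Label (f b))
Label (loop {B = B} _ f b) = Σ B (λ b → Label (f b))

entry : {A : Set} (p : Prog A) → Label p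
entry (act f)      = tt
entry (bind _ p f) = inj₁ (entry p)
entry (loop _ f b) = b , entry (f b)

Label-finite : {A : Set} (p : Prog A) → Finite (Label p)
Label-finite (act f)      = Finite-⊤
Label-finite (bind F p f) = ⊎F (Label-finite p) (ΣF F (λ b → Label-finite (f b)))
Label-finite (loop F f b) = ΣF F (λ b → Label-finite (f b))

bindˡ : {A B : Set} {L : Set} (f : B → Prog A) → L ⊎ B → (L ⊎ Σ B (λ b → Label (f b))) ⊎ A
bindˡ f (inj₁ l) = inj₁ (inj₁ l)
bindˡ f (inj₂ b) = inj₁ (inj₂ (b , entry (f b)))

bindʳ : {A B : Set} {L : Set} (f : B → Prog A) (b : B) → Label (f b) ⊎ A → (L ⊎ Σ B (λ b → Label (f b))) ⊎ A
bindʳ f b (inj₁ l) = inj₁ (inj₂ (b , l))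
bindʳ f b (inj₂ a) = inj₂ a

again : {A B : Set} (f : B → Prog (B ⊎ A)) (b : B) → Label (f b) ⊎ (B ⊎ A) → Σ B (λ b → Label (f b)) ⊎ A
again f b (inj₁ l)         = inj₁ (b , l)
again f b (inj₂ (inj₁ b′)) = inj₁ (b′ , entry (f b′))
again f b (inj₂ (inj₂ a))  = inj₂ a

transition : {A : Set} (p : Prog A) → Label p → InRead → Fin 3 → (Label p ⊎ A) × Action
transition (act f)      tt             r c = map₁ inj₂ (f r c)
transition (bind _ p f) (inj₁ l)       r c = map₁ (bindˡ f) (transition p l r c)
transition (bind _ p f) (inj₂ (b , l)) r c = map₁ (bindʳ f b) (transition (f b) l r c)
transition (loop _ f _) (b , l)        r c = map₁ (again f b) (transition (f b) l r c)

-- Compilation of programs to Turing machines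

record Mem : Set where
  constructor mem
  field
    ip   : ℕ
    tp   : ℕ → Fin 3
    wp   : ℕ
    outs : List Sym
open Mem

module Machine (p : Prog ⊤) where

  F : Finite (Label p ⊎ ⊤)
  F = ⊎F (Label-finite p) Finite-⊤

  code : Label p ⊎ ⊤ → Fin (length (elems F))
  code s = Any.index (complete F s)

  decode : Fin (length (elems F)) → Label p ⊎ ⊤
  decode = lookup (elems F)

  decode-code : ∀ s → decode (code s) ≡ s
  decode-code s = sym (lookup-index (complete F s))

  isHalt : Label p ⊎ ⊤ → Bool
  isHalt (inj₁ _) = false
  isHalt (inj₂ _) = true

  trans-δ : Label p ⊎ ⊤ → InRead → Fin 3 → Fin (length (elems F)) × Action
  trans-δ (inj₁ l) r c = map₁ code (transition p l r c)
  trans-δ (inj₂ _) r c = code (inj₂ tt) , mS , c , mS , nothing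

  M : TM
  M .TM.states = length (elems F)
  M .TM.start  = code (inj₁ (entry p))
  M .TM.halts  = isHalt ∘ decode
  M .TM.δ s    = trans-δ (decode s)

  conf : Label p ⊎ ⊤ → Mem → Config M
  conf s (mem i t w o) = cfg (code s) i t w o

step-δ : (M : TM) (w : List Sym) (c : Config M) →
  TM.halts M (st c) ≡ false → ∀ {s mi b mw o} →
  TM.δ M (st c) (readIn w (ipos c)) (tape c (wpos c)) ≡ (s , mi , b , mw , o) →
  step M w c ≡ cfg s (moveIn (length w) (ipos c) mi) (write (tape c) (wpos c) b)
                 (moveW (wpos c) mw) (appendOut (out c) o)
step-δ M w c h e rewrite h | e = refl

iter-suc : {A : Set} (t : ℕ) (f : A → A) (a : A) → iter (suc t) f a ≡ iter t f (f a)
iter-suc zero    f a = refl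
iter-suc (suc t) f a = cong f (iter-suc t f a)

-- Runs with a bounded work head

module Semantics (w : List Sym) (S : ℕ) where

  apply : Action → Mem → Mem
  apply (mi , b , mw , o) (mem i t x u) =
    mem (moveIn (length w) i mi) (write t x b) (moveW x mw) (appendOut u o)

  obs : {B : Set} → (InRead → Fin 3 → B) → Mem → B
  obs f m = f (readIn w (ip m)) (tp m (wp m))

  -- The bound on the work head is stored for every configuration passed, the one after the return
  -- included, because `LogSpaceRun` bounds the head at all times up to halting.
  data Steps {A : Set} (p : Prog A) : Label p → Mem → A → Mem → Set where
    done : ∀ {l m a c} → wp m ≤ S → obs (transition p l) m ≡ (inj₂ a , c) →
           wp (apply c m) ≤ S → Steps p l m a (apply c m)
    more : ∀ {l l′ m a m′ c} → wp m ≤ S → obs (transition p l) m ≡ (inj₁ l′ , c) →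
           Steps p l′ (apply c m) a m′ → Steps p l m a m′

  run-bindʳ : {A B : Set} {F : Finite B} {p : Prog B} {f : B → Prog A} {b : B} {l : Label (f b)}
             {m m′ : Mem} {a : A} →
             Steps (f b) l m a m′ → Steps (bind F p f) (inj₂ (b , l)) m a m′
  run-bindʳ {f = f} {b} (done x e y)  = done x (cong (map₁ (bindʳ f b)) e) y
  run-bindʳ {f = f} {b} (more x e ss) = more x (cong (map₁ (bindʳ f b)) e) (run-bindʳ ss)

  run-bind : {A B : Set} {F : Finite B} {p : Prog B} {f : B → Prog A} {b : B} {l : Label p}
             {m m′ m″ : Mem} {a : A} →
             Steps p l m b m′ → Steps (f b) (entry (f b)) m′ a m″ →
             Steps (bind F p f) (inj₁ l) m a m″
  run-bind {f = f} (done x e y)  ts = more x (cong (map₁ (bindˡ f)) e) (run-bindʳ ts)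
  run-bind {f = f} (more x e ss) ts = more x (cong (map₁ (bindˡ f)) e) (run-bind ss ts)

  run-exit : {A B : Set} {F : Finite B} {f : B → Prog (B ⊎ A)} {b₀ b : B} {l : Label (f b)}
             {m m′ : Mem} {a : A} →
             Steps (f b) l m (inj₂ a) m′ → Steps (loop F f b₀) (b , l) m a m′
  run-exit {f = f} {b = b} (done x e y)  = done x (cong (map₁ (again f b)) e) y
  run-exit {f = f} {b = b} (more x e ss) = more x (cong (map₁ (again f b)) e) (run-exit ss)

  -- The starting value of a `loop` determines only its `entry`; labels and transitions do not
  -- depend on it.
  run-restart : {A B : Set} {F : Finite B} {f : B → Prog (B ⊎ A)} {b₀ b₁ : B} {l : Label (loop F f b₀)}
             {m m′ : Mem} {a : A} →
             Steps (loop F f b₀) l m a m′ → Steps (loop F f b₁) l m a m′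
  run-restart (done x e y)  = done x e y
  run-restart (more x e ss) = more x e (run-restart ss)

  run-again : {A B : Set} {F : Finite B} {f : B → Prog (B ⊎ A)} {b₀ b b′ : B} {l : Label (f b)}
             {m m′ m″ : Mem} {a : A} →
             Steps (f b) l m (inj₁ b′) m′ → Steps (loop F f b₀) (b′ , entry (f b′)) m′ a m″ →
             Steps (loop F f b₀) (b , l) m a m″
  run-again {f = f} {b = b} (done x e y)  ts = more x (cong (map₁ (again f b)) e) ts
  run-again {f = f} {b = b} (more x e ss) ts = more x (cong (map₁ (again f b)) e) (run-again ss ts)

  module _ (p : Prog ⊤) where
    open Machine p

    machine-step : ∀ {l m s c} → obs (transition p l) m ≡ (s , c) → step M w (conf (inj₁ l) m) ≡ conf s (apply c m)
    machine-step {l} {m} e = step-δ M w (conf (inj₁ l) m) (cong isHalt (decode-code (inj₁ l)))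
      (trans (cong (λ s → trans-δ s (readIn w (ip m)) (tp m (wp m))) (decode-code (inj₁ l))) (cong (map₁ code) e))

    machine-run : ∀ {l m m′} → Steps p l m tt m′ → ∃ λ t →
      iter t (step M w) (conf (inj₁ l) m) ≡ conf (inj₂ tt) m′ ×
      (∀ t′ → t′ ≤ t → wpos (iter t′ (step M w) (conf (inj₁ l) m)) ≤ S)
    machine-run (done x e y) =
      1 , machine-step e ,
      λ { zero _ → x ; (suc zero) _ → subst (λ z → wpos z ≤ S) (sym (machine-step e)) y ; (suc (suc _)) (s≤s ()) }
    machine-run {l} {m} (more x e ss) with machine-run ss
    ... | t , fin , bd =
      suc t , trans (iter-suc t (step M w) _) (trans (cong (iter t (step M w)) (machine-step e)) fin) , bounds
      where
      bounds : ∀ t′ → t′ ≤ suc t → wpos (iter t′ (step M w) (conf (inj₁ l) m)) ≤ S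
      bounds zero     _       = x
      bounds (suc t′) (s≤s k) =
        subst (λ z → wpos z ≤ S)
          (sym (trans (iter-suc t′ (step M w) _) (cong (iter t′ (step M w)) (machine-step e)))) (bd t′ k)

  -- Running a program with tapes considered up to pointwise equality.

  record _⊢_⇓_,_ {A : Set} (p : Prog A) (m : Mem) (a : A) (m′ : Mem) : Set where
    constructor steps
    field
      exec : ∀ t → t ≗ tp m → ∃ λ t′ → t′ ≗ tp m′ ×
             Steps p (entry p) (mem (ip m) t (wp m) (outs m)) a (mem (ip m′) t′ (wp m′) (outs m′))
  open _⊢_⇓_,_ public

  infix 2 _⊢_⇓_,_

  ⇓-act : {A : Set} {f : InRead → Fin 3 → A × Action} {m : Mem} {a : A} {c : Action} →
          wp m ≤ S → obs f m ≡ (a , c) → wp (apply c m) ≤ S → act f ⊢ m ⇓ a , apply c m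
  ⇓-act {f = f} {m} {a} {mi , b , mw , o} x e y .exec s s≗t =
    write s (wp m) b , (λ j → cong (if wp m ≡ᵇ j then b else_) (s≗t j)) ,
    done x (cong (map₁ inj₂) (trans (cong (f _) (s≗t (wp m))) e)) y

  ⇓-bind : {A B : Set} {F : Finite B} {p : Prog B} {f : B → Prog A} {m m′ m″ : Mem} {b : B} {a : A} →
           p ⊢ m ⇓ b , m′ → f b ⊢ m′ ⇓ a , m″ → bind F p f ⊢ m ⇓ a , m″
  ⇓-bind P Q .exec s e with P .exec s e
  ... | s′ , e′ , ss with Q .exec s′ e′
  ... | s″ , e″ , ts = s″ , e″ , run-bind ss ts

  ⇓-exit : {A B : Set} {F : Finite B} {f : B → Prog (B ⊎ A)} {m m′ : Mem} {b : B} {a : A} →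
           f b ⊢ m ⇓ inj₂ a , m′ → loop F f b ⊢ m ⇓ a , m′
  ⇓-exit P .exec s e with P .exec s e
  ... | s′ , e′ , ss = s′ , e′ , run-exit ss

  ⇓-again : {A B : Set} {F : Finite B} {f : B → Prog (B ⊎ A)} {m m′ m″ : Mem} {b b′ : B} {a : A} →
           f b ⊢ m ⇓ inj₁ b′ , m′ → loop F f b′ ⊢ m′ ⇓ a , m″ → loop F f b ⊢ m ⇓ a , m″
  ⇓-again P Q .exec s e with P .exec s e
  ... | s′ , e′ , ss with Q .exec s′ e′
  ... | s″ , e″ , ts = s″ , e″ , run-again ss (run-restart ts)

  -- Only the final tape has to be exchanged here; for the initial tape `exec` already admits
  -- everything pointwise equal.
  ⇓-conv : {A : Set} {p : Prog A} {m : Mem} {i x : ℕ} {u : List Sym} {t t′ : ℕ → Fin 3} {a : A} →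
           p ⊢ m ⇓ a , mem i t x u → t ≗ t′ → p ⊢ m ⇓ a , mem i t′ x u
  ⇓-conv P e₂ .exec s e with P .exec s e
  ... | s′ , e′ , ss = s′ , (λ j → trans (e′ j) (e₂ j)) , ss

-- Bijective binary numerals

digit : Bool → Fin 3
digit false = suc zero
digit true  = suc (suc zero)

symbol : Bool → Sym
symbol false = s0
symbol true  = s1

at : List Bool → ℕ → Fin 3
at []       _       = zero
at (b ∷ bs) zero    = digit b
at (b ∷ bs) (suc i) = at bs i

increment : List Bool → List Bool
increment []           = false ∷ []
increment (false ∷ bs) = true ∷ bs
increment (true ∷ bs)  = false ∷ increment bs

bits : ℕ → List Bool
bits zero    = []
bits (suc n) = increment (bits n)

weight : Bool → ℕ
weight false = 1
weight true  = 2

value : List Bool → ℕ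
value []       = 0
value (b ∷ bs) = weight b + 2 * value bs

value-increment : ∀ bs → value (increment bs) ≡ suc (value bs)
value-increment []           = refl
value-increment (false ∷ bs) = refl
value-increment (true ∷ bs)  = begin
  1 + 2 * value (increment bs)  ≡⟨ cong (λ z → 1 + 2 * z) (value-increment bs) ⟩
  1 + 2 * suc (value bs)        ≡⟨ cong suc (*-suc 2 (value bs)) ⟩
  3 + 2 * value bs              ∎
  where open ≡-Reasoning

value-bits : ∀ n → value (bits n) ≡ n
value-bits zero    = refl
value-bits (suc n) = trans (value-increment (bits n)) (cong suc (value-bits n))

bits-injective : ∀ {m n} → bits m ≡ bits n → m ≡ n
bits-injective {m} {n} e = trans (sym (value-bits m)) (trans (cong value e) (value-bits n))

odd : ℕ → Bool
odd zero          = false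
odd (suc zero)    = true
odd (suc (suc n)) = odd n

-- Division in bijective base 2: `suc s` equals `weight (odd s) + 2 * ⌊ s /2⌋`. The digits are 1 and
-- 2, so it is the predecessor whose parity and half give the last digit and the rest.
bits-suc : ∀ s → bits (suc s) ≡ odd s ∷ bits ⌊ s /2⌋
bits-suc zero          = refl
bits-suc (suc zero)    = refl
bits-suc (suc (suc s)) = trans (cong (increment ∘ increment) (bits-suc s)) (twice (odd s))
  where
  twice : ∀ b {bs} → increment (increment (b ∷ bs)) ≡ b ∷ increment bs
  twice false = refl
  twice true  = refl

odd-+2* : ∀ s m → odd (s + 2 * m) ≡ odd s
odd-+2* s zero    = cong odd (+-identityʳ s)
odd-+2* s (suc m) = trans (cong odd (trans (cong (s +_) (*-suc 2 m)) (trans (+-suc s _) (cong suc (+-suc s _))))) (odd-+2* s m)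

half-+2* : ∀ s m → ⌊ s + 2 * m /2⌋ ≡ ⌊ s /2⌋ + m
half-+2* s zero    = trans (cong ⌊_/2⌋ (+-identityʳ s)) (sym (+-identityʳ _))
half-+2* s (suc m) = begin
  ⌊ s + 2 * suc m /2⌋      ≡⟨ cong ⌊_/2⌋ (trans (cong (s +_) (*-suc 2 m)) (trans (+-suc s _) (cong suc (+-suc s _)))) ⟩
  suc ⌊ s + 2 * m /2⌋      ≡⟨ cong suc (half-+2* s m) ⟩
  suc (⌊ s /2⌋ + m)        ≡⟨ sym (+-suc _ m) ⟩
  ⌊ s /2⌋ + suc m          ∎
  where open ≡-Reasoning

-- Multiplies a numeral by k and adds c in one pass from the least significant digit; c is the carry.
affine : ℕ → ℕ → List Bool → List Bool
affine k c []       = bits c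
affine k c (b ∷ bs) = odd s ∷ affine k ⌊ s /2⌋ bs
  where s = pred (k * weight b + c)

-- A positive multiplier makes `suc k * weight b + c` positive, so `pred` loses nothing and
-- `bits-suc` applies. The digits still to come add `2 * v`, which keeps the parity of `s` and adds
-- exactly `v` to its half.
affine-correct : ∀ k c bs → affine (suc k) c bs ≡ bits (suc k * value bs + c)
affine-correct k c []       = cong (λ z → bits (z + c)) (sym (*-zeroʳ (suc k)))
affine-correct k c (b ∷ bs) = begin
  odd s ∷ affine (suc k) ⌊ s /2⌋ bs                 ≡⟨ cong (odd s ∷_) (affine-correct k ⌊ s /2⌋ bs) ⟩
  odd s ∷ bits (v + ⌊ s /2⌋)                        ≡⟨ cong₂ _∷_ (sym (odd-+2* s v)) (cong bits (trans (+-comm v _) (sym (half-+2* s v)))) ⟩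
  odd (s + 2 * v) ∷ bits ⌊ s + 2 * v /2⌋            ≡⟨ sym (bits-suc (s + 2 * v)) ⟩
  bits (suc s + 2 * v)                              ≡⟨ cong bits (cong (_+ 2 * v) (suc-s b)) ⟩
  bits (suc k * weight b + c + 2 * v)               ≡⟨ cong bits eq ⟩
  bits (suc k * value (b ∷ bs) + c)                 ∎
  where
  open ≡-Reasoning
  s = pred (suc k * weight b + c)
  v = suc k * value bs
  suc-s : ∀ b → suc (pred (suc k * weight b + c)) ≡ suc k * weight b + c
  suc-s false = refl
  suc-s true  = refl
  eq : suc k * weight b + c + 2 * v ≡ suc k * value (b ∷ bs) + c
  eq = begin
    suc k * weight b + c + 2 * v       ≡⟨ +-assoc (suc k * weight b) c _ ⟩
    suc k * weight b + (c + 2 * v)     ≡⟨ cong (suc k * weight b +_) (+-comm c _) ⟩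
    suc k * weight b + (2 * v + c)     ≡⟨ sym (+-assoc (suc k * weight b) _ c) ⟩
    suc k * weight b + 2 * v + c       ≡⟨ cong (λ z → suc k * weight b + z + c) (trans (sym (*-assoc 2 (suc k) _)) (trans (cong (_* value bs) (*-comm 2 (suc k))) (*-assoc (suc k) 2 (value bs)))) ⟩
    suc k * weight b + suc k * (2 * value bs) + c ≡⟨ cong (_+ c) (sym (*-distribˡ-+ (suc k) (weight b) _)) ⟩
    suc k * (weight b + 2 * value bs) + c ∎

bitsᵇ-suc : ∀ x bs → bitsᵇ x ≡ map symbol bs → bitsᵇ (sucᵇ x) ≡ map symbol (increment bs)
bitsᵇ-suc zeroᵇ    []           e = refl
bitsᵇ-suc 2[1+ x ] (true ∷ bs)  e = cong (s0 ∷_) (bitsᵇ-suc x bs (cong (λ { [] → [] ; (_ ∷ xs) → xs }) e))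
bitsᵇ-suc 1+[2 x ] (false ∷ bs) e = cong (s1 ∷_) (cong (λ { [] → [] ; (_ ∷ xs) → xs }) e)

numeral : ℕ → List Sym
numeral n = map symbol (bits n) ++ dot ∷ []

enc-leaf : ∀ n → enc (leaf n) ≡ numeral n
enc-leaf n = cong (_++ dot ∷ []) (trans (cong bitsᵇ (fromℕ≡fromℕ' n)) (go n))
  where
  go : ∀ n → bitsᵇ (toBin′ n) ≡ map symbol (bits n)
  go zero    = refl
  go (suc n) = bitsᵇ-suc (toBin′ n) (bits n) (go n)

-- The source of the logarithm: every digit is at least 1, so `l` digits denote at least
-- `2 ^ l - 1`.
1+value≥2^length : ∀ bs → 2 ^ length bs ≤ suc (value bs)
1+value≥2^length []       = ≤-refl
1+value≥2^length (b ∷ bs) = begin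
  2 * 2 ^ length bs       ≤⟨ *-monoʳ-≤ 2 (1+value≥2^length bs) ⟩
  2 * suc (value bs)      ≡⟨ *-suc 2 (value bs) ⟩
  2 + 2 * value bs        ≤⟨ s≤s (+-monoˡ-≤ (2 * value bs) (pos b)) ⟩
  suc (weight b + 2 * value bs) ∎
  where
  open ≤-Reasoning
  pos : ∀ b → 1 ≤ weight b
  pos false = ≤-refl
  pos true  = s≤s z≤n

at-++ : ∀ xs ys i → at (xs ++ ys) (length xs + i) ≡ at ys i
at-++ []       ys i = refl
at-++ (x ∷ xs) ys i = at-++ xs ys i

-- Six interleaved tracks on the work tape

Tracks : Set
Tracks = Vec (List Bool) 6

cell : ℕ → Fin 6 → ℕ
cell p r = toℕ r + p * 6

cell-mod : ∀ p r → cell p r mod 6 ≡ r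
cell-mod p r = toℕ-injective (trans (toℕ-fromℕ< _) (trans ([m+kn]%n≡m%n (toℕ r) p 6) (m<n⇒m%n≡m (toℕ<n r))))

cell-/ : ∀ p r → cell p r / 6 ≡ p
cell-/ p r = begin
  (toℕ r + p * 6) / 6       ≡⟨ +-distrib-/-∣ʳ (toℕ r) (n∣m*n p) ⟩
  toℕ r / 6 + p * 6 / 6     ≡⟨ cong₂ _+_ (m<n⇒m/n≡0 (toℕ<n r)) (m*n/n≡m p 6) ⟩
  p ∎
  where open ≡-Reasoning

cell-surjective : ∀ x → cell (x / 6) (x mod 6) ≡ x
cell-surjective x = trans (cong (_+ x / 6 * 6) (toℕ-fromℕ< _)) (sym (m≡m%n+[m/n]*n x 6))

≡ᵇ-refl : ∀ n → (n ≡ᵇ n) ≡ true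
≡ᵇ-refl zero    = refl
≡ᵇ-refl (suc n) = ≡ᵇ-refl n

≢⇒≡ᵇ : ∀ {m n} → m ≢ n → (m ≡ᵇ n) ≡ false
≢⇒≡ᵇ {m} {n} ne = dec-false (m ℕ.≟ n) ne

-- Kept abstract so that unification can recover the tracks from the tape.
abstract
  layout : Tracks → ℕ → Fin 3
  layout g x = at (Vec.lookup g (x mod 6)) (x / 6)

  layout-cell : ∀ g p r → layout g (cell p r) ≡ at (Vec.lookup g r) p
  layout-cell g p r = cong₂ (λ s y → at (Vec.lookup g s) y) (cell-mod p r) (cell-/ p r)

  layout-blank : ∀ x → layout (Vec.replicate 6 []) x ≡ zero
  layout-blank x = cong (λ l → at l (x / 6)) (lookup-replicate (x mod 6) [])

  -- The new numeral is described cell by cell, so that appending, overwriting and removing a digit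
  -- are all instances. Row and track are recovered from a cell as quotient and remainder modulo 6,
  -- hence no other cell is touched.
  layout-write : ∀ g p r b l →
    (∀ i → at l i ≡ (if i ≡ᵇ p then b else at (Vec.lookup g r) i)) →
    write (layout g) (cell p r) b ≗ layout (g [ r ]≔ l)
  layout-write g p r b l h x =
    subst (λ y → write (layout g) (cell p r) b y ≡ layout (g [ r ]≔ l) y) (cell-surjective x) (go (x / 6) (x mod 6))
    where
    go : ∀ p′ r′ → write (layout g) (cell p r) b (cell p′ r′) ≡ layout (g [ r ]≔ l) (cell p′ r′)
    go p′ r′ with r ≟ r′
    ... | no r≢ rewrite ≢⇒≡ᵇ {cell p r} {cell p′ r′} (λ e → r≢ (trans (sym (cell-mod p r)) (trans (cong (_mod 6) e) (cell-mod p′ r′)))) =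
      trans (layout-cell g p′ r′) (sym (trans (layout-cell (g [ r ]≔ l) p′ r′) (cong (λ z → at z p′) (lookup∘update′ (r≢ ∘ sym) g l))))
    ... | yes refl with p ℕ.≟ p′
    ...   | yes refl rewrite ≡ᵇ-refl (cell p r) =
      sym (trans (layout-cell (g [ r ]≔ l) p r) (trans (cong (λ z → at z p) (lookup∘update r g l)) (trans (h p) (cong (if_then b else at (Vec.lookup g r) p) (≡ᵇ-refl p)))))
    ...   | no p≢ rewrite ≢⇒≡ᵇ {cell p r} {cell p′ r} (λ e → p≢ (trans (sym (cell-/ p r)) (trans (cong (_/ 6) e) (cell-/ p′ r)))) =
      trans (layout-cell g p′ r) (sym (trans (layout-cell (g [ r ]≔ l) p′ r) (trans (cong (λ z → at z p′) (lookup∘update r g l)) (trans (h p′) (cong (if_then b else at (Vec.lookup g r) p′) (≢⇒≡ᵇ (p≢ ∘ sym)))))))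

clamp : ∀ m → ℕ → Fin (suc m)
clamp m x = fromℕ< (s≤s (m⊓n≤n x m))

toℕ-clamp : ∀ {m x} → x ≤ m → toℕ (clamp m x) ≡ x
toℕ-clamp x≤m = trans (toℕ-fromℕ< _) (m≤n⇒m⊓n≡m x≤m)

-- Elementary programs

ret : {A : Set} → A → Prog A
ret a = act λ r c → a , mS , c , mS , nothing

look : {A : Set} → (InRead → A) → Prog A
look f = act λ r c → f r , mS , c , mS , nothing

moveInput : Move → Prog ⊤
moveInput m = act λ r c → tt , m , c , mS , nothing

moveWork : Move → Prog ⊤
moveWork m = act λ r c → tt , mS , c , m , nothing

readWork : Prog (Fin 3)
readWork = act λ r c → c , mS , c , mS , nothing

writeWork : Fin 3 → Prog ⊤
writeWork b = act λ r c → tt , mS , b , mS , nothing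

emit : List Sym → Prog ⊤
emit []       = ret tt
emit (s ∷ ss) = act (λ r c → tt , mS , c , mS , just s) >> emit ss

times : ℕ → Prog ⊤ → Prog ⊤
times zero    p = ret tt
times (suc k) p = p >> times k p

peek : Fin 6 → Prog (Fin 3)
peek r = times (toℕ r) (moveWork mR) >> (readWork >>= λ d → times (toℕ r) (moveWork mL) >> ret d)

poke : Fin 6 → Fin 3 → Prog ⊤
poke r b = times (toℕ r) (moveWork mR) >> (writeWork b >> times (toℕ r) (moveWork mL))

up down : Prog ⊤
up   = times 6 (moveWork mR)
down = times 6 (moveWork mL)

-- Track 0 marks row 0.
home : Prog ⊤
home = loop Finite-⊤ (λ _ → peek zero >>= stop) tt
  where
  stop : Fin 3 → Prog (⊤ ⊎ ⊤)
  stop zero    = down >> ret (inj₁ tt)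
  stop (suc _) = ret (inj₂ tt)

incrementLoop : Fin 6 → Prog ⊤
incrementLoop r = loop Finite-⊤ (λ _ → peek r >>= carry) tt
  where
  carry : Fin 3 → Prog (⊤ ⊎ ⊤)
  carry zero             = poke r (digit false) >> ret (inj₂ tt)
  carry (suc zero)       = poke r (digit true) >> ret (inj₂ tt)
  carry (suc (suc zero)) = poke r (digit false) >> (up >> ret (inj₁ tt))

climb : Fin 3 → Prog (⊤ ⊎ ⊤)
climb zero    = ret (inj₂ tt)
climb (suc _) = up >> ret (inj₁ tt)

climbLoop : Fin 6 → Prog ⊤
climbLoop r = loop Finite-⊤ (λ _ → peek r >>= climb) tt

-- Digits go from the top downwards, so the track remains a numeral without gaps at every moment;
-- the mark on track 0 ends the descent.
eraseLoop : Fin 6 → Prog ⊤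
eraseLoop r = loop Finite-⊤ (λ _ → peek zero >>= erase) tt
  where
  erase : Fin 3 → Prog (⊤ ⊎ ⊤)
  erase zero    = down >> (poke r zero >> ret (inj₁ tt))
  erase (suc _) = ret (inj₂ tt)

compareDigits : Fin 3 → Fin 3 → Prog (⊤ ⊎ Bool)
compareDigits zero             zero             = ret (inj₂ true)
compareDigits (suc zero)       (suc zero)       = up >> ret (inj₁ tt)
compareDigits (suc (suc zero)) (suc (suc zero)) = up >> ret (inj₁ tt)
compareDigits _                _                = ret (inj₂ false)

equalLoop : Fin 6 → Fin 6 → Prog Bool
equalLoop r s = loop Finite-⊤ (λ _ → peek r >>= λ a → peek s >>= compareDigits a) tt

affineShift : (k bound : ℕ) → Fin (suc bound) → ℕ → Prog (Fin (suc bound) ⊎ ⊤)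
affineShift k bound x d = emit (symbol (odd s) ∷ []) >> (up >> ret (inj₁ (clamp bound ⌊ s /2⌋)))
  where s = pred (k * d + toℕ x)

affineDigit : (k bound : ℕ) → Fin (suc bound) → Fin 3 → Prog (Fin (suc bound) ⊎ ⊤)
affineDigit k bound x zero             = emit (numeral (toℕ x)) >> ret (inj₂ tt)
affineDigit k bound x (suc zero)       = affineShift k bound x 1
affineDigit k bound x (suc (suc zero)) = affineShift k bound x 2

affineLoop : (k bound : ℕ) → Fin 6 → Fin (suc bound) → Prog ⊤
affineLoop k bound r = loop Finite-Fin (λ x → peek r >>= affineDigit k bound x)

classify : InRead → Fin 3
classify (inSym s0) = digit false
classify (inSym s1) = digit true
classify _          = zero

storeDigit : Fin 6 → Fin 3 → Prog (⊤ ⊎ ⊤)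
storeDigit r zero    = ret (inj₂ tt)
storeDigit r (suc d) = poke r (suc d) >> (up >> ret (inj₁ tt))

loadLoop : Fin 6 → Prog ⊤
loadLoop r = loop Finite-⊤ (λ _ → act (λ s c → classify s , mR , c , mS , nothing) >>= storeDigit r) tt

isSym : Sym → InRead → Bool
isSym dot    (inSym dot)    = true
isSym close′ (inSym close′) = true
isSym open′  (inSym open′)  = true
isSym s0     (inSym s0)     = true
isSym s1     (inSym s1)     = true
isSym _      _              = false

skipPast : Sym → Prog ⊤
skipPast a = loop Finite-⊤ (λ _ → act (λ s c → (if isSym a s then inj₂ tt else inj₁ tt) , mR , c , mS , nothing)) tt

rewindStep : InRead → Fin 3 → (⊤ ⊎ ⊤) × Action
rewindStep lend c = inj₂ tt , mR , c , mS , nothing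
rewindStep _    c = inj₁ tt , mL , c , mS , nothing

rewind : Prog ⊤
rewind = loop Finite-⊤ (λ _ → act rewindStep) tt

match : List Sym → Prog Bool
match []       = ret true
match (a ∷ as) = look (isSym a) >>= λ b → if b then moveInput mR >> match as else ret false

equalDigits : List Bool → List Bool → Bool
equalDigits []           []           = true
equalDigits (false ∷ bs) (false ∷ cs) = equalDigits bs cs
equalDigits (true ∷ bs)  (true ∷ cs)  = equalDigits bs cs
equalDigits _            _            = false

equalDigits-refl : ∀ bs → equalDigits bs bs ≡ true
equalDigits-refl []           = refl
equalDigits-refl (false ∷ bs) = equalDigits-refl bs
equalDigits-refl (true ∷ bs)  = equalDigits-refl bs

equalDigits-sound : ∀ bs cs → equalDigits bs cs ≡ true → bs ≡ cs
equalDigits-sound []           []           e = refl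
equalDigits-sound (false ∷ bs) (false ∷ cs) e = cong (false ∷_) (equalDigits-sound bs cs e)
equalDigits-sound (true ∷ bs)  (true ∷ cs)  e = cong (true ∷_) (equalDigits-sound bs cs e)

equalDigits-bits : ∀ m n → equalDigits (bits m) (bits n) ≡ (m ≡ᵇ n)
equalDigits-bits m n with m ℕ.≟ n
... | yes refl = trans (equalDigits-refl (bits m)) (sym (≡ᵇ-refl m))
... | no m≢n with equalDigits (bits m) (bits n) in e
...   | false = sym (≢⇒≡ᵇ m≢n)
...   | true  = contradiction (bits-injective (equalDigits-sound (bits m) (bits n) e)) m≢n

-- Writing at position `length pre` overwrites the first digit of `old` if there is one and appends
-- otherwise. The hypothesis covers both cases; for appending, `old` and `new` are both empty.
at-insert : ∀ pre b old new → (∀ i → at old (suc i) ≡ at new i) → ∀ i →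
  at (pre ++ b ∷ new) i ≡ (if i ≡ᵇ length pre then digit b else at (pre ++ old) i)
at-insert []        b old new h zero    = refl
at-insert []        b old new h (suc i) = sym (h i)
at-insert (c ∷ pre) b old new h zero    = refl
at-insert (c ∷ pre) b old new h (suc i) = at-insert pre b old new h i

at-remove : ∀ pre b i → at pre i ≡ (if i ≡ᵇ length pre then zero else at (pre ∷ʳ b) i)
at-remove []        b zero    = refl
at-remove []        b (suc i) = refl
at-remove (c ∷ pre) b zero    = refl
at-remove (c ∷ pre) b (suc i) = at-remove pre b i

-- A suffix given through its cells, the blanks beyond its end included, since these are what a loop
-- climbing from row `p` tests.
record Tail (l : List Bool) (p : ℕ) (bs : List Bool) : Set where
  constructor tail
  field row : ∀ i → at l (p + i) ≡ at bs i
open Tail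

Tail-head : ∀ {l p bs} → Tail l p bs → at l p ≡ at bs 0
Tail-head {l} {p} h = trans (cong (at l) (sym (+-identityʳ p))) (row h 0)

Tail-next : ∀ {l p b bs} → Tail l p (b ∷ bs) → Tail l (suc p) bs
Tail-next {l} {p} h .row i = trans (cong (at l) (sym (+-suc p i))) (row h (suc i))

length-∷ʳ : (pre : List Bool) (b : Bool) → length (pre ∷ʳ b) ≡ suc (length pre)
length-∷ʳ pre b = trans (length-++ pre) (+-comm (length pre) 1)

half-bound : ∀ x y → x ≤ 2 * y → ⌊ x /2⌋ ≤ y
half-bound x y h = ≤-trans (⌊n/2⌋-mono h) (≤-reflexive (trans (cong ⌊_/2⌋ (cong (y +_) (+-identityʳ y))) (sym (n≡⌊n+n/2⌋ y))))

-- Correctness of the elementary programs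

module TrackRuns (w : List Sym) (C : ℕ) where

  open Semantics w (suc C * 6) public

  -- Numerals have at most `C` digits, so rows 0 to `C` are read. The additional row leaves room for
  -- the offset of a track within row `C` and for `up` started there.
  S : ℕ
  S = suc C * 6

  cell≤S : ∀ {p} (r : Fin 6) → p ≤ C → cell p r ≤ S
  cell≤S {p} r p≤C = +-mono-≤ (≤-trans (toℕ≤pred[n] r) (n≤1+n 5)) (*-monoˡ-≤ 6 p≤C)

  row≤S : ∀ {p} → p ≤ C → p * 6 ≤ S
  row≤S p≤C = ≤-trans (*-monoˡ-≤ 6 p≤C) (m≤n+m (C * 6) 6)

  -- Every step of a machine writes, so leaving the tape alone means writing back the symbol just
  -- read.
  write-same : ∀ t x → write t x (t x) ≗ t
  write-same t x j with x ≡ᵇ j in e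
  ... | false = refl
  ... | true  = cong t (≡ᵇ⇒≡ x j (subst Data.Bool.T (sym e) tt))

  ⇓-still : {A : Set} {f : InRead → Fin 3 → A × Action} {m : Mem} {a : A} {mi mw : Move} {o : Maybe Sym} →
    wp m ≤ S → obs f m ≡ (a , mi , tp m (wp m) , mw , o) → moveW (wp m) mw ≤ S →
    act f ⊢ m ⇓ a , mem (moveIn (length w) (ip m) mi) (tp m) (moveW (wp m) mw) (appendOut (outs m) o)
  ⇓-still {m = m} x e y = ⇓-conv (⇓-act x e y) (write-same (tp m) (wp m))

  ⇓-value : {A : Set} {p : Prog A} {m m′ : Mem} {a b : A} → a ≡ b → p ⊢ m ⇓ a , m′ → p ⊢ m ⇓ b , m′
  ⇓-value refl R = R

  ⇓-tracks : {A : Set} {p : Prog A} {m : Mem} {a : A} {g g′ : Tracks} {i x : ℕ} {u : List Sym} →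
    g ≡ g′ → p ⊢ m ⇓ a , mem i (layout g) x u → p ⊢ m ⇓ a , mem i (layout g′) x u
  ⇓-tracks refl R = R

  ⇓-row : {A : Set} {p : Prog A} {m : Mem} {a : A} {t : ℕ → Fin 3} {i x x′ : ℕ} {u : List Sym} →
    x ≡ x′ → p ⊢ m ⇓ a , mem i t x u → p ⊢ m ⇓ a , mem i t x′ u
  ⇓-row refl R = R

  ⇓-outs : {A : Set} {p : Prog A} {m : Mem} {a : A} {t : ℕ → Fin 3} {i x : ℕ} {u u′ : List Sym} →
    u ≡ u′ → p ⊢ m ⇓ a , mem i t x u → p ⊢ m ⇓ a , mem i t x u′
  ⇓-outs refl R = R

  ⇓-ret : {A : Set} {a : A} {m : Mem} → wp m ≤ S → ret a ⊢ m ⇓ a , m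
  ⇓-ret x = ⇓-still x refl x

  ⇓-emit : ∀ ss {i t x u} → x ≤ S → emit ss ⊢ mem i t x u ⇓ tt , mem i t x (u ++ ss)
  ⇓-emit [] {i} {t} {x} {u} h = ⇓-outs (sym (++-identityʳ u)) (⇓-ret h)
  ⇓-emit (s ∷ ss) {i} {t} {x} {u} h =
    ⇓-outs (++-assoc u (s ∷ []) ss)
      (⇓-bind (⇓-still h refl h) (⇓-emit ss h))

  ⇓-right : ∀ k {i t x u} → k + x ≤ S → times k (moveWork mR) ⊢ mem i t x u ⇓ tt , mem i t (k + x) u
  ⇓-right zero h = ⇓-ret h
  ⇓-right (suc k) {i} {t} {x} {u} h =
    ⇓-row (+-suc k x)
      (⇓-bind (⇓-still (≤-trans (m≤n+m x (suc k)) h) refl (≤-trans (s≤s (m≤n+m x k)) h))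
              (⇓-right k (≤-trans (≤-reflexive (+-suc k x)) h)))

  ⇓-left : ∀ k {i t x u} → k + x ≤ S → times k (moveWork mL) ⊢ mem i t (k + x) u ⇓ tt , mem i t x u
  ⇓-left zero h = ⇓-ret h
  ⇓-left (suc k) h = ⇓-bind (⇓-still h refl (≤-trans (n≤1+n _) h)) (⇓-left k (≤-trans (n≤1+n _) h))

  ⇓-peek : ∀ {g p i u d} r → p ≤ C → at (Vec.lookup g r) p ≡ d →
           peek r ⊢ mem i (layout g) (p * 6) u ⇓ d , mem i (layout g) (p * 6) u
  ⇓-peek {g} {p} {i} {u} {d} r h e =
    ⇓-bind (⇓-right (toℕ r) c)
      (⇓-bind (⇓-still c (cong (_, mS , layout g (cell p r) , mS , nothing) (trans (layout-cell g p r) e)) c)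
        (⇓-bind (⇓-left (toℕ r) c) (⇓-ret (row≤S h))))
    where c = cell≤S r h

  ⇓-poke : ∀ {g p i u b} r l → p ≤ C → (∀ i → at l i ≡ (if i ≡ᵇ p then b else at (Vec.lookup g r) i)) →
           poke r b ⊢ mem i (layout g) (p * 6) u ⇓ tt , mem i (layout (g [ r ]≔ l)) (p * 6) u
  ⇓-poke {g} {p} {b = b} r l h e =
    ⇓-bind (⇓-right (toℕ r) c) (⇓-bind (⇓-conv (⇓-act c refl c) (layout-write g p r b l e)) (⇓-left (toℕ r) c))
    where c = cell≤S r h

  ⇓-insert : ∀ {g p i u r} b pre old new → p ≤ C → Vec.lookup g r ≡ pre ++ old → p ≡ length pre →
             (∀ i → at old (suc i) ≡ at new i) →
             poke r (digit b) ⊢ mem i (layout g) (p * 6) u ⇓ tt , mem i (layout (g [ r ]≔ (pre ++ b ∷ new))) (p * 6) u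
  ⇓-insert b pre old new h e refl k =
    ⇓-poke _ _ h (λ i → trans (at-insert pre b old new k i) (cong (λ l → if i ≡ᵇ length pre then digit b else at l i) (sym e)))

  ⇓-up : ∀ {t p i u} → p ≤ C → up ⊢ mem i t (p * 6) u ⇓ tt , mem i t (suc p * 6) u
  ⇓-up h = ⇓-right 6 (+-monoʳ-≤ 6 (*-monoˡ-≤ 6 h))

  ⇓-upRet : ∀ {t p i u} {A : Set} {a : A} → p ≤ C → (up >> ret a) ⊢ mem i t (p * 6) u ⇓ a , mem i t (suc p * 6) u
  ⇓-upRet h = ⇓-bind (⇓-up h) (⇓-ret (+-monoʳ-≤ 6 (*-monoˡ-≤ 6 h)))

  ⇓-down : ∀ {t p i u} → p ≤ C → down ⊢ mem i t (suc p * 6) u ⇓ tt , mem i t (p * 6) u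
  ⇓-down h = ⇓-left 6 (+-monoʳ-≤ 6 (*-monoˡ-≤ 6 h))

  Marked : Tracks → Set
  Marked g = Vec.lookup g zero ≡ false ∷ []

  ⇓-home : ∀ {g i u} p → Marked g → p ≤ C → home ⊢ mem i (layout g) (p * 6) u ⇓ tt , mem i (layout g) 0 u
  ⇓-home zero    e h = ⇓-exit (⇓-bind (⇓-peek zero h (cong (λ l → at l 0) e)) (⇓-ret z≤n))
  ⇓-home (suc p) e h =
    ⇓-again (⇓-bind (⇓-peek zero h (cong (λ l → at l (suc p)) e)) (⇓-bind (⇓-down h′) (⇓-ret (row≤S h′))))
            (⇓-home p e h′)
    where h′ = ≤-trans (n≤1+n p) h

  ⇓-incrementLoop : ∀ {g p i u} r bs pre → Vec.lookup g r ≡ pre ++ bs → p ≡ length pre → p + length bs ≤ C →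
    ∃ λ p′ → p′ ≤ C ×
      (incrementLoop r ⊢ mem i (layout g) (p * 6) u ⇓ tt , mem i (layout (g [ r ]≔ (pre ++ increment bs))) (p′ * 6) u)
  ⇓-incrementLoop {g} {p} r bs pre e ep h = go bs e h
    where
    p≤C = ≤-trans (m≤m+n p _) h
    head : ∀ bs → Vec.lookup g r ≡ pre ++ bs → at (Vec.lookup g r) p ≡ at bs 0
    head bs e = trans (cong₂ at e (trans ep (sym (+-identityʳ _)))) (at-++ pre bs 0)
    go : ∀ {i u} bs → Vec.lookup g r ≡ pre ++ bs → p + length bs ≤ C →
      ∃ λ p′ → p′ ≤ C ×
      (incrementLoop r ⊢ mem i (layout g) (p * 6) u ⇓ tt , mem i (layout (g [ r ]≔ (pre ++ increment bs))) (p′ * 6) u)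
    go [] e h = p , p≤C ,
      ⇓-exit (⇓-bind (⇓-peek r p≤C (head [] e))
        (⇓-bind (⇓-insert false pre [] [] p≤C e ep (λ _ → refl)) (⇓-ret (row≤S p≤C))))
    go (false ∷ bs) e h = p , p≤C ,
      ⇓-exit (⇓-bind (⇓-peek r p≤C (head (false ∷ bs) e))
        (⇓-bind (⇓-insert true pre (false ∷ bs) bs p≤C e ep (λ _ → refl)) (⇓-ret (row≤S p≤C))))
    go {i} {u} (true ∷ bs) e h
      with ⇓-incrementLoop {g [ r ]≔ (pre ++ false ∷ bs)} {suc p} {i} {u} r bs (pre ∷ʳ false)
             (trans (lookup∘update r g _) (sym (++-assoc pre (false ∷ []) bs)))
             (trans (cong suc ep) (sym (length-∷ʳ pre false)))
             (≤-trans (≤-reflexive (sym (+-suc p (length bs)))) h)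
    ... | p′ , p′≤C , R = p′ , p′≤C ,
      ⇓-tracks
        (trans ([]≔-idempotent g r) (cong (g [ r ]≔_) (++-assoc pre (false ∷ []) (increment bs))))
        (⇓-again (⇓-bind (⇓-peek r p≤C (head (true ∷ bs) e))
          (⇓-bind (⇓-insert false pre (true ∷ bs) bs p≤C e ep (λ _ → refl))
            (⇓-upRet p≤C))) R)

  ⇓-climbLoop : ∀ {g p i u} r bs → Tail (Vec.lookup g r) p bs → p + length bs ≤ C →
    climbLoop r ⊢ mem i (layout g) (p * 6) u ⇓ tt , mem i (layout g) ((p + length bs) * 6) u
  ⇓-climbLoop {g} {p} {i} {u} r [] h k =
    ⇓-row (cong (_* 6) (sym (+-identityʳ p)))
      (⇓-exit (⇓-bind (⇓-peek r p≤C (Tail-head h)) (⇓-ret (row≤S p≤C))))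
    where p≤C = ≤-trans (m≤m+n p _) k
  ⇓-climbLoop {g} {p} {i} {u} r (b ∷ bs) h k =
    ⇓-row (cong (_* 6) (sym (+-suc p _)))
      (⇓-again (⇓-bind (⇓-peek r p≤C (Tail-head h)) (up-again b))
        (⇓-climbLoop r bs (Tail-next h) (≤-trans (≤-reflexive (sym (+-suc p _))) k)))
    where
    p≤C = ≤-trans (m≤m+n p _) k
    up-again : ∀ b → climb (digit b) ⊢ mem i (layout g) (p * 6) u ⇓ inj₁ tt , mem i (layout g) (suc p * 6) u
    up-again false = ⇓-upRet p≤C
    up-again true  = ⇓-upRet p≤C

  ⇓-eraseLoop : ∀ {g i u} r k pre → Marked g → zero ≢ r → Vec.lookup g r ≡ pre → length pre ≡ k → k ≤ C →
    eraseLoop r ⊢ mem i (layout g) (k * 6) u ⇓ tt , mem i (layout (g [ r ]≔ [])) 0 u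
  ⇓-eraseLoop {g} {i} {u} r zero [] m z e l h =
    ⇓-tracks
      (trans (sym ([]≔-lookup g r)) (cong (g [ r ]≔_) e))
      (⇓-exit (⇓-bind (⇓-peek zero h (cong (λ l → at l 0) m)) (⇓-ret z≤n)))
  ⇓-eraseLoop {g} {i} {u} r (suc k) pre m z e l h with initLast pre
  ... | [] = contradiction l λ ()
  ... | pre′ ∷ʳ′ b =
    ⇓-tracks
      ([]≔-idempotent g r)
      (⇓-again
        (⇓-bind (⇓-peek zero h (cong (λ l → at l (suc k)) m))
          (⇓-bind (⇓-down k≤C)
            (⇓-bind (⇓-poke r pre′ k≤C (λ j → trans (at-remove pre′ b j)
                       (cong₂ (λ n l → if j ≡ᵇ n then zero else at l j) lk (sym e))))
              (⇓-ret (row≤S k≤C)))))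
        (⇓-eraseLoop r k pre′ (trans (lookup∘update′ z g pre′) m) z (lookup∘update r g pre′) lk k≤C))
    where
    k≤C = ≤-trans (n≤1+n k) h
    lk = suc-injective (trans (sym (length-∷ʳ pre′ b)) l)

  Compared : Tracks → ℕ → ℕ → List Sym → Fin 6 → Fin 6 → Bool → Set
  Compared g p i u r s b = ∃ λ p′ → p′ ≤ C × (equalLoop r s ⊢ mem i (layout g) (p * 6) u ⇓ b , mem i (layout g) (p′ * 6) u)

  -- Only the first numeral has to fit below row `C`, since the comparison stops at its end at the
  -- latest.
  ⇓-equalLoop : ∀ {g p i u} r s bs cs → Tail (Vec.lookup g r) p bs → Tail (Vec.lookup g s) p cs →
    p + length bs ≤ C → Compared g p i u r s (equalDigits bs cs)
  ⇓-equalLoop {g} {p} {i} {u} r s bs cs hb hc k = go bs cs hb hc k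
    where
    p≤C = ≤-trans (m≤m+n p _) k
    differ : ∀ {bs cs b} → Tail (Vec.lookup g r) p bs → Tail (Vec.lookup g s) p cs →
      compareDigits (at bs 0) (at cs 0) ≡ ret (inj₂ b) → Compared g p i u r s b
    differ hb hc e = p , p≤C , ⇓-exit (⇓-bind (⇓-peek r p≤C (Tail-head hb))
      (⇓-bind (⇓-peek s p≤C (Tail-head hc)) (subst (λ z → z ⊢ _ ⇓ _ , _) (sym e) (⇓-ret (row≤S p≤C)))))
    agree : ∀ {b bs cs} → Tail (Vec.lookup g r) p (b ∷ bs) → Tail (Vec.lookup g s) p (b ∷ cs) → p + suc (length bs) ≤ C →
      compareDigits (digit b) (digit b) ≡ (up >> ret (inj₁ tt)) → Compared g p i u r s (equalDigits bs cs)
    agree {b} {bs} {cs} hb hc k e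
      with ⇓-equalLoop {g} {suc p} {i} {u} r s bs cs (Tail-next hb) (Tail-next hc) (≤-trans (≤-reflexive (sym (+-suc p _))) k)
    ... | p′ , h , R = p′ , h , ⇓-again (⇓-bind (⇓-peek r p≤C (Tail-head hb))
      (⇓-bind (⇓-peek s p≤C (Tail-head hc)) (subst (λ z → z ⊢ _ ⇓ inj₁ tt , _) (sym e) (⇓-upRet p≤C)))) R
    go : ∀ bs cs → Tail (Vec.lookup g r) p bs → Tail (Vec.lookup g s) p cs → p + length bs ≤ C →
      Compared g p i u r s (equalDigits bs cs)
    go []           []           hb hc k = differ hb hc refl
    go []           (false ∷ cs) hb hc k = differ hb hc refl
    go []           (true ∷ cs)  hb hc k = differ hb hc refl
    go (false ∷ bs) []           hb hc k = differ hb hc refl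
    go (true ∷ bs)  []           hb hc k = differ hb hc refl
    go (false ∷ bs) (true ∷ cs)  hb hc k = differ hb hc refl
    go (true ∷ bs)  (false ∷ cs) hb hc k = differ hb hc refl
    go (false ∷ bs) (false ∷ cs) hb hc k = agree hb hc k refl
    go (true ∷ bs)  (true ∷ cs)  hb hc k = agree hb hc k refl

  ⇓-affineLoop : ∀ {g p i u} k bound r bs x → Tail (Vec.lookup g r) p bs → p + length bs ≤ C → 2 * suc k ≤ bound →
    ∃ λ p′ → p′ ≤ C × (affineLoop (suc k) bound r x ⊢ mem i (layout g) (p * 6) u ⇓ tt ,
      mem i (layout g) (p′ * 6) (u ++ (map symbol (affine (suc k) (toℕ x) bs) ++ dot ∷ [])))
  ⇓-affineLoop {g} {p} {i} {u} k bound r [] x h pk kb = p , p≤C ,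
    ⇓-exit (⇓-bind (⇓-peek r p≤C (Tail-head h)) (⇓-bind (⇓-emit (numeral (toℕ x)) (row≤S p≤C)) (⇓-ret (row≤S p≤C))))
    where p≤C = ≤-trans (m≤m+n p _) pk
  ⇓-affineLoop {g} {p} {i} {u} k bound r (b ∷ bs) x h pk kb
    with ⇓-affineLoop {g} {suc p} {i} {u ++ symbol (odd (s b)) ∷ []} k bound r bs (x′ b) (Tail-next h) (≤-trans (≤-reflexive (sym (+-suc p _))) pk) kb
    where
    s : Bool → ℕ
    s b = pred (suc k * weight b + toℕ x)
    x′ : Bool → Fin (suc bound)
    x′ b = clamp bound ⌊ s b /2⌋
  ... | p′ , p′≤C , R = p′ , p′≤C ,
    ⇓-outs
      (trans (++-assoc u _ _) (cong (λ z → u ++ symbol (odd s) ∷ (map symbol (affine (suc k) z bs) ++ dot ∷ [])) (toℕ-clamp carry≤)))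
      (⇓-again (⇓-bind (⇓-peek r p≤C (Tail-head h)) (shifted b)) R)
    where
    p≤C = ≤-trans (m≤m+n p _) pk
    s = pred (suc k * weight b + toℕ x)
    weight≤2 : ∀ b → weight b ≤ 2
    weight≤2 false = s≤s z≤n
    weight≤2 true  = ≤-refl
    carry≤ : ⌊ s /2⌋ ≤ bound
    -- With `2 * suc k` at most `bound`, a carry up to `bound` gives a sum up to `2 * bound`, and
    -- halving leads back to at most `bound`. Hence `clamp` does not truncate the new carry.
    carry≤ = half-bound s bound (begin
      s                              ≤⟨ pred[n]≤n ⟩
      suc k * weight b + toℕ x       ≤⟨ +-mono-≤ (*-monoʳ-≤ (suc k) (weight≤2 b)) (toℕ≤pred[n] x) ⟩
      suc k * 2 + bound              ≤⟨ +-monoˡ-≤ bound (≤-trans (≤-reflexive (*-comm (suc k) 2)) kb) ⟩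
      bound + bound                  ≡⟨ cong (bound +_) (sym (+-identityʳ bound)) ⟩
      2 * bound                      ∎)
      where open ≤-Reasoning
    shifted : ∀ b → affineDigit (suc k) bound x (digit b) ⊢ mem i (layout g) (p * 6) u ⇓
      inj₁ (clamp bound ⌊ pred (suc k * weight b + toℕ x) /2⌋) ,
      mem i (layout g) (suc p * 6) (u ++ symbol (odd (pred (suc k * weight b + toℕ x))) ∷ [])
    shifted false = ⇓-bind (⇓-emit _ (row≤S p≤C)) (⇓-upRet p≤C)
    shifted true  = ⇓-bind (⇓-emit _ (row≤S p≤C)) (⇓-upRet p≤C)

  -- The input head reads the first symbol of the suffix s.
  record Pos (i : ℕ) (s : List Sym) : Set where
    constructor pos
    field
      before : List Sym
      splits : w ≡ before ++ s
      place  : i ≡ suc (length before)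

  lookupℕ-++ : ∀ (pre : List Sym) a s → lookupℕ (pre ++ a ∷ s) (length pre) ≡ just a
  lookupℕ-++ []        a s = refl
  lookupℕ-++ (_ ∷ pre) a s = lookupℕ-++ pre a s

  readIn-++ : ∀ pre a s → readIn (pre ++ a ∷ s) (suc (length pre)) ≡ inSym a
  readIn-++ pre a s rewrite lookupℕ-++ pre a s = refl

  Pos-read : ∀ {i a s} → Pos i (a ∷ s) → readIn w i ≡ inSym a
  Pos-read {a = a} {s} (pos pre e refl) = trans (cong (λ z → readIn z (suc (length pre))) e) (readIn-++ pre a s)

  Pos-move : ∀ {i a s} → Pos i (a ∷ s) → moveIn (length w) i mR ≡ suc i
  Pos-move {i} {a} {s} (pos pre e refl) = cong (if_then suc i else i) (dec-true (suc i ℕ.≤? suc (length w)) (s≤s (begin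
    suc (length pre)             ≤⟨ s≤s (m≤m+n _ (length s)) ⟩
    suc (length pre + length s)  ≡⟨ sym (+-suc _ _) ⟩
    length pre + suc (length s)  ≡⟨ sym (length-++ pre) ⟩
    length (pre ++ a ∷ s)        ≡⟨ cong length (sym e) ⟩
    length w                     ∎)))
    where open ≤-Reasoning

  Pos-next : ∀ {i a s} → Pos i (a ∷ s) → Pos (suc i) s
  Pos-next {i} {a} {s} (pos pre e refl) =
    pos (pre ++ a ∷ []) (trans e (sym (++-assoc pre (a ∷ []) s))) (cong suc (sym (trans (length-++ pre) (+-comm _ 1))))

  ⇓-advance : {A : Set} {f : InRead → A} {i x : ℕ} {t : ℕ → Fin 3} {u : List Sym} {a : Sym} {s : List Sym} {v : A} →
    x ≤ S → Pos i (a ∷ s) → f (inSym a) ≡ v →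
    act (λ r c → f r , mR , c , mS , nothing) ⊢ mem i t x u ⇓ v , mem (suc i) t x u
  ⇓-advance {f = f} {i} {x} {t} {u} h P e =
    subst (λ z → act (λ r c → f r , mR , c , mS , nothing) ⊢ mem i t x u ⇓ _ , mem z t x u) (Pos-move P)
      (⇓-still h (cong (_, mR , t x , mS , nothing) (trans (cong f (Pos-read P)) e)) h)

  ⇓-skipPast : ∀ {i x t u s} a xs → x ≤ S → All (λ b → isSym a (inSym b) ≡ false) xs → isSym a (inSym a) ≡ true →
    Pos i (xs ++ a ∷ s) → ∃ λ i′ → Pos i′ s × (skipPast a ⊢ mem i t x u ⇓ tt , mem i′ t x u)
  ⇓-skipPast {i} a [] h [] e P =
    suc i , Pos-next P , ⇓-exit (⇓-advance h P (cong (if_then inj₂ tt else inj₁ tt) e))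
  ⇓-skipPast {i} a (b ∷ xs) h (n ∷ ns) e P with ⇓-skipPast a xs h ns e (Pos-next P)
  ... | i′ , P′ , R = i′ , P′ , ⇓-again (⇓-advance h P (cong (if_then inj₂ tt else inj₁ tt) n)) R

  ⇓-loadLoop : ∀ {g p i u s} r bs pre → Vec.lookup g r ≡ pre → p ≡ length pre → p + length bs ≤ C →
    Pos i (map symbol bs ++ dot ∷ s) → ∃ λ i′ → ∃ λ p′ → p′ ≤ C × Pos i′ s ×
      (loadLoop r ⊢ mem i (layout g) (p * 6) u ⇓ tt , mem i′ (layout (g [ r ]≔ (pre ++ bs))) (p′ * 6) u)
  ⇓-loadLoop {g} {p} {i} {u} r [] pre e ep k P = suc i , p , p≤C , Pos-next P ,
    ⇓-tracks
      (trans (sym ([]≔-lookup g r)) (cong (g [ r ]≔_) (trans e (sym (++-identityʳ pre)))))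
      (⇓-exit (⇓-bind (⇓-advance (row≤S p≤C) P refl) (⇓-ret (row≤S p≤C))))
    where p≤C = ≤-trans (m≤m+n p _) k
  ⇓-loadLoop {g} {p} {i} {u} {s} r (b ∷ bs) pre e ep k P
    with ⇓-loadLoop {g [ r ]≔ (pre ++ b ∷ [])} {suc p} {suc i} {u} {s} r bs (pre ∷ʳ b)
           (lookup∘update r g _) (trans (cong suc ep) (sym (length-∷ʳ pre b)))
           (≤-trans (≤-reflexive (sym (+-suc p (length bs)))) k) (Pos-next P)
  ... | i′ , p′ , p′≤C , P′ , R = i′ , p′ , p′≤C , P′ ,
    ⇓-tracks
      (trans ([]≔-idempotent g r) (cong (g [ r ]≔_) (++-assoc pre (b ∷ []) bs)))
      (⇓-again (⇓-bind (⇓-advance (row≤S p≤C) P (classified b)) (stored b)) R)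
    where
    p≤C = ≤-trans (m≤m+n p _) k
    classified : ∀ b → classify (inSym (symbol b)) ≡ digit b
    classified false = refl
    classified true  = refl
    stored : ∀ b → storeDigit r (digit b) ⊢ mem (suc i) (layout g) (p * 6) u ⇓ inj₁ tt ,
                   mem (suc i) (layout (g [ r ]≔ (pre ++ b ∷ []))) (suc p * 6) u
    stored false = ⇓-bind (⇓-insert false pre [] [] p≤C (trans e (sym (++-identityʳ pre))) ep (λ _ → refl))
                     (⇓-upRet p≤C)
    stored true  = ⇓-bind (⇓-insert true pre [] [] p≤C (trans e (sym (++-identityʳ pre))) ep (λ _ → refl))
                     (⇓-upRet p≤C)

  ⇓-rewind : ∀ {x t u} i → x ≤ S → rewind ⊢ mem i t x u ⇓ tt , mem 1 t x u
  ⇓-rewind zero    h = ⇓-exit (⇓-still h refl h)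
  ⇓-rewind {x} {t} {u} (suc i) h = ⇓-again (⇓-still h e h) (⇓-rewind i h)
    where
    e : obs rewindStep (mem (suc i) t x u) ≡ (inj₁ tt , mL , t x , mS , nothing)
    e with lookupℕ w i
    ... | just _  = refl
    ... | nothing = refl

  Pos-start : Pos 1 w
  Pos-start = pos [] refl refl

-- Registers

Registers : Set
Registers = Vec ℕ 5

tracks : Registers → Tracks
tracks ρ = (false ∷ []) ∷ Vec.map bits ρ

incr clear load : Fin 5 → Prog ⊤
incr  r = incrementLoop (suc r) >> home
clear r = climbLoop (suc r) >> eraseLoop (suc r)
load  r = loadLoop (suc r) >> home

equal : Fin 5 → Fin 5 → Prog Bool
equal r s = equalLoop (suc r) (suc s) >>= λ b → home >> ret b

-- The bound `2 * k + c` admits the initial carry `c` and is at least `2 * k`, so that no later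
-- carry exceeds it either; the carry fits into the control whatever the number in the register.
emitAffine : ℕ → ℕ → Fin 5 → Prog ⊤
emitAffine k c r = affineLoop k (2 * k + c) (suc r) (clamp (2 * k + c) c) >> home

Entry : Set
Entry = List ℕ × List ℕ

-- The words of the input format, with the rest of the input as last argument.

numW : ℕ → List Sym → List Sym
numW x s = map symbol (bits x) ++ dot ∷ s

numsW : List ℕ → List Sym → List Sym
numsW []       s = s
numsW (x ∷ xs) s = numW x (numsW xs s)

entryW : Entry → List Sym → List Sym
entryW (ns , ts) s = open′ ∷ open′ ∷ numsW ns (close′ ∷ open′ ∷ numsW ts (close′ ∷ close′ ∷ s))

entriesW : List Entry → List Sym → List Sym
entriesW []       s = s
entriesW (e ∷ es) s = entryW e (entriesW es s)

word : List Entry → List Sym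
word es = open′ ∷ numW (length es) (open′ ∷ entriesW es (close′ ∷ close′ ∷ []))

numsW-++ : ∀ xs s → numsW xs s ≡ concatMap numeral xs ++ s
numsW-++ []       s = refl
numsW-++ (x ∷ xs) s = begin
  map symbol (bits x) ++ dot ∷ numsW xs s                           ≡⟨ cong (λ z → map symbol (bits x) ++ dot ∷ z) (numsW-++ xs s) ⟩
  map symbol (bits x) ++ dot ∷ (concatMap numeral xs ++ s)          ≡⟨ sym (++-assoc (map symbol (bits x)) (dot ∷ []) _) ⟩
  numeral x ++ (concatMap numeral xs ++ s)                          ≡⟨ sym (++-assoc (numeral x) _ s) ⟩
  (numeral x ++ concatMap numeral xs) ++ s                          ∎
  where open ≡-Reasoning

symbols≢ : ∀ {P : Sym → Set} → P s0 → P s1 → ∀ bs → All P (map symbol bs)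
symbols≢ p q []           = []
symbols≢ p q (false ∷ bs) = p ∷ symbols≢ p q bs
symbols≢ p q (true ∷ bs)  = q ∷ symbols≢ p q bs

numerals-no-close : ∀ xs → All (λ b → isSym close′ (inSym b) ≡ false) (concatMap numeral xs)
numerals-no-close []       = []
numerals-no-close (x ∷ xs) = All.++⁺ (All.++⁺ (symbols≢ refl refl (bits x)) (refl ∷ [])) (numerals-no-close xs)

-- An entry contains three closing brackets: of the neighbour list, of the table and of the entry
-- itself. Numerals contain none.
skipEntry : Prog ⊤
skipEntry = skipPast close′ >> (skipPast close′ >> skipPast close′)

findLoop : Fin 5 → Fin 5 → Prog ⊤
findLoop v r = loop Finite-⊤ (λ _ → equal r v >>= λ b → if b then ret (inj₂ tt) else (skipEntry >> (incr r >> ret (inj₁ tt)))) tt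

-- Register r has to be 0 and serves as a counter.
locate : Fin 5 → Fin 5 → Prog ⊤
locate v r = rewind >> (moveInput mR >> (skipPast dot >> (moveInput mR >> (findLoop v r >> (clear r >> (moveInput mR >> moveInput mR))))))

walk : ℕ → Prog Bool
walk zero    = look (λ s → not (isSym close′ s))
walk (suc j) = look (isSym close′) >>= λ b → if b then ret false else (skipPast dot >> walk j)

exactly : ℕ → Prog Bool
exactly zero    = look (isSym close′)
exactly (suc j) = look (isSym close′) >>= λ b → if b then ret false else (skipPast dot >> exactly j)

fetch : Fin 5 → ℕ → Fin 5 → Prog Bool
fetch v j r = locate v r >> (walk j >>= λ b → if b then load r >> ret true else ret false)

checkTable : ℕ → ℕ → Prog Bool
checkTable idx b = moveInput mR >> (moveInput mR >> (walk idx >>= λ c → if c then match (numeral b) else ret false))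

check : Fin 5 → Fin 5 → ℕ → ℕ → ℕ → Prog Bool
check v r d idx b = locate v r >> (exactly d >>= λ c → if c then checkTable idx b else ret false)

has : List ℕ → ℕ → ℕ → Bool
has ts idx b = maybe (_≡ᵇ b) false (lookupℕ ts idx)

lookupℕ-split : {A : Set} (xs : List A) (k : ℕ) {x : A} → lookupℕ xs k ≡ just x →
  ∃ λ ys → ∃ λ zs → xs ≡ ys ++ x ∷ zs × length ys ≡ k
lookupℕ-split (x ∷ xs) zero    refl = [] , xs , refl , refl
lookupℕ-split (x ∷ xs) (suc k) e with lookupℕ-split xs k e
... | ys , zs , refl , refl = x ∷ ys , zs , refl , refl

-- Correctness of the register programs

module RegisterRuns (es : List Entry) (C : ℕ) (fits : ∀ {x} → x ≤ length es → length (bits x) ≤ C) where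

  n : ℕ
  n = length es

  open TrackRuns (word es) C public

  state : Registers → ℕ → List Sym → Mem
  state ρ i u = mem i (layout (tracks ρ)) 0 u

  Tail-register : ∀ ρ r → Tail (Vec.lookup (tracks ρ) (suc r)) 0 (bits (Vec.lookup ρ r))
  Tail-register ρ r = tail λ i → cong (λ l → at l i) (lookup-map r bits ρ)

  tracks-update : ∀ ρ r x → tracks ρ [ suc r ]≔ bits x ≡ tracks (ρ [ r ]≔ x)
  tracks-update ρ r x = cong ((false ∷ []) ∷_) (sym (map-[]≔ bits ρ r))

  ⇓-registers : {A : Set} {p : Prog A} {m : Mem} {a : A} {ρ ρ′ : Registers} {i : ℕ} {u : List Sym} →
    ρ ≡ ρ′ → p ⊢ m ⇓ a , state ρ i u → p ⊢ m ⇓ a , state ρ′ i u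
  ⇓-registers e = ⇓-tracks (cong tracks e)

  ⇓-incr : ∀ {ρ i u} r → Vec.lookup ρ r ≤ n → incr r ⊢ state ρ i u ⇓ tt , state (ρ [ r ]≔ suc (Vec.lookup ρ r)) i u
  ⇓-incr {ρ} {i} {u} r h with ⇓-incrementLoop {tracks ρ} {0} {i} {u} (suc r) (bits (Vec.lookup ρ r)) [] (lookup-map r bits ρ) refl (fits h)
  ... | p , p≤C , R = ⇓-tracks (tracks-update ρ r (suc (Vec.lookup ρ r)))
                        (⇓-bind R (⇓-home p refl p≤C))

  ⇓-clear : ∀ {ρ i u} r → Vec.lookup ρ r ≤ n → clear r ⊢ state ρ i u ⇓ tt , state (ρ [ r ]≔ 0) i u
  ⇓-clear {ρ} {i} {u} r h = ⇓-tracks (tracks-update ρ r 0)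
    (⇓-bind (⇓-climbLoop (suc r) (bits (Vec.lookup ρ r)) (Tail-register ρ r) (fits h))
            (⇓-eraseLoop (suc r) _ (bits (Vec.lookup ρ r)) refl (λ ()) (lookup-map r bits ρ) refl (fits h)))

  ⇓-equal : ∀ {ρ i u} r s → Vec.lookup ρ r ≤ n → equal r s ⊢ state ρ i u ⇓ (Vec.lookup ρ r ≡ᵇ Vec.lookup ρ s) , state ρ i u
  ⇓-equal {ρ} {i} {u} r s h with ⇓-equalLoop {tracks ρ} {0} {i} {u} (suc r) (suc s) _ _ (Tail-register ρ r) (Tail-register ρ s) (fits h)
  ... | p , p≤C , R = ⇓-value (equalDigits-bits (Vec.lookup ρ r) (Vec.lookup ρ s))
                        (⇓-bind R (⇓-bind (⇓-home p refl p≤C) (⇓-ret z≤n)))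

  ⇓-emitAffine : ∀ {ρ i u} k c r → Vec.lookup ρ r ≤ n →
    emitAffine (suc k) c r ⊢ state ρ i u ⇓ tt , state ρ i (u ++ numeral (suc k * Vec.lookup ρ r + c))
  ⇓-emitAffine {ρ} {i} {u} k c r h
    with ⇓-affineLoop {tracks ρ} {0} {i} {u} k (2 * suc k + c) (suc r) _ (clamp (2 * suc k + c) c) (Tail-register ρ r) (fits h) (m≤m+n _ c)
  ... | p , p≤C , R = subst (λ z → emitAffine (suc k) c r ⊢ state ρ i u ⇓ tt , state ρ i (u ++ (map symbol z ++ dot ∷ [])))
      (trans (affine-correct k _ (bits x)) (cong bits (cong₂ (λ v c → suc k * v + c) (value-bits x) (toℕ-clamp {2 * suc k + c} (m≤n+m c (2 * suc k))))))
      (⇓-bind R (⇓-home p refl p≤C))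
    where x = Vec.lookup ρ r

  ⇓-load : ∀ {ρ i u x s} r → Vec.lookup ρ r ≡ 0 → x ≤ n → Pos i (numW x s) →
    ∃ λ i′ → Pos i′ s × (load r ⊢ state ρ i u ⇓ tt , state (ρ [ r ]≔ x) i′ u)
  ⇓-load {ρ} {i} {u} {x} r e h P
    with ⇓-loadLoop {tracks ρ} {0} {i} {u} (suc r) (bits x) [] (trans (lookup-map r bits ρ) (cong bits e)) refl (fits h) P
  ... | i′ , p , p≤C , P′ , R = i′ , P′ , ⇓-tracks (tracks-update ρ r x)
                        (⇓-bind R (⇓-home p refl p≤C))

  ⇓-moveR : ∀ {ρ i u a s} → Pos i (a ∷ s) → moveInput mR ⊢ state ρ i u ⇓ tt , state ρ (suc i) u
  ⇓-moveR P = ⇓-advance z≤n P refl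

  ⇓-look : {A : Set} {ρ : Registers} {i : ℕ} {u : List Sym} {a : Sym} {s : List Sym} {v : A} (f : InRead → A) →
    Pos i (a ∷ s) → f (inSym a) ≡ v → look f ⊢ state ρ i u ⇓ v , state ρ i u
  ⇓-look f P e = ⇓-still z≤n (cong (_, _) (trans (cong f (Pos-read P)) e)) z≤n

  ⇓-skipNum : ∀ {ρ i u s} x → Pos i (numW x s) → ∃ λ i′ → Pos i′ s × (skipPast dot ⊢ state ρ i u ⇓ tt , state ρ i′ u)
  ⇓-skipNum x P = ⇓-skipPast dot _ z≤n (symbols≢ refl refl (bits x)) refl P

  ⇓-skipEntry : ∀ {ρ i u s} e → Pos i (entryW e s) → ∃ λ i′ → Pos i′ s × (skipEntry ⊢ state ρ i u ⇓ tt , state ρ i′ u)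
  ⇓-skipEntry {ρ} {i} {u} {s} (ns , ts) P
    with ⇓-skipPast close′ (open′ ∷ open′ ∷ concatMap numeral ns) z≤n (refl ∷ refl ∷ numerals-no-close ns) refl
           (subst (λ z → Pos i (open′ ∷ open′ ∷ z)) (numsW-++ ns _) P)
  ... | i₁ , P₁ , R₁ with ⇓-skipPast close′ (open′ ∷ concatMap numeral ts) z≤n (refl ∷ numerals-no-close ts) refl
           (subst (λ z → Pos i₁ (open′ ∷ z)) (numsW-++ ts _) P₁)
  ... | i₂ , P₂ , R₂ with ⇓-skipPast close′ [] z≤n [] refl P₂
  ... | i₃ , P₃ , R₃ = i₃ , P₃ , ⇓-bind R₁ (⇓-bind R₂ R₃)

  ⇓-findLoop : ∀ {ρ i u s} v r (xs : List Entry) {ys} → v ≢ r → Vec.lookup ρ v ≡ Vec.lookup ρ r + length xs →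
    Vec.lookup ρ v ≤ n → Pos i (entriesW (xs ++ ys) s) →
    ∃ λ i′ → Pos i′ (entriesW ys s) × (findLoop v r ⊢ state ρ i u ⇓ tt , state (ρ [ r ]≔ Vec.lookup ρ v) i′ u)
  ⇓-findLoop {ρ} {i} {u} v r [] ne e h P = i , P ,
    ⇓-registers
      (trans (sym ([]≔-lookup ρ r)) (cong (ρ [ r ]≔_) (sym e′)))
      (⇓-exit (⇓-bind (⇓-value
         (trans (cong (Vec.lookup ρ r ≡ᵇ_) e′) (≡ᵇ-refl (Vec.lookup ρ r))) (⇓-equal r v (≤-trans (≤-reflexive (sym e′)) h))) (⇓-ret z≤n)))
    where e′ = trans e (+-identityʳ _)
  ⇓-findLoop {ρ} {i} {u} {s} v r (x ∷ xs) {ys} ne e h P with ⇓-skipEntry {ρ} {i} {u} x P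
  ... | i₁ , P₁ , R₁
    with ⇓-findLoop {ρ [ r ]≔ suc (Vec.lookup ρ r)} {i₁} {u} {s} v r xs {ys} ne
           (trans (lookup∘update′ ne ρ _) (trans e (trans (+-suc _ _) (cong (_+ length xs) (sym (lookup∘update r ρ _))))))
           (≤-trans (≤-reflexive (lookup∘update′ ne ρ _)) h) P₁
  ... | i₂ , P₂ , R₂ = i₂ , P₂ ,
    ⇓-registers
      (trans ([]≔-idempotent ρ r) (cong (ρ [ r ]≔_) (lookup∘update′ ne ρ _)))
      (⇓-again (⇓-bind (⇓-value
          (≢⇒≡ᵇ (<⇒≢ lt)) (⇓-equal r v (≤-trans (<⇒≤ lt) h)))
        (⇓-bind R₁ (⇓-bind (⇓-incr r (≤-trans (<⇒≤ lt) h)) (⇓-ret z≤n)))) R₂)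
    where
    lt : Vec.lookup ρ r < Vec.lookup ρ v
    lt = ≤-trans (m<m+n (Vec.lookup ρ r) (s≤s z≤n)) (≤-reflexive (sym e))

  restore : ∀ {ρ : Registers} {r x} → Vec.lookup ρ r ≡ 0 → (ρ [ r ]≔ x) [ r ]≔ 0 ≡ ρ
  restore {ρ} {r} e = trans ([]≔-idempotent ρ r) (trans (cong (ρ [ r ]≔_) (sym e)) ([]≔-lookup ρ r))

  ⇓-locate : ∀ {ρ i u} v r {ns ts} → v ≢ r → Vec.lookup ρ r ≡ 0 → lookupℕ es (Vec.lookup ρ v) ≡ just (ns , ts) →
    ∃ λ i′ → ∃ λ s → Pos i′ (numsW ns (close′ ∷ open′ ∷ numsW ts (close′ ∷ close′ ∷ s))) ×
      (locate v r ⊢ state ρ i u ⇓ tt , state ρ i′ u)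
  ⇓-locate {ρ} {i} {u} v r ne z e
    with lookupℕ-split es (Vec.lookup ρ v) e
  ... | xs , ys , split , len
    with ⇓-skipNum {ρ} {2} {u} (length es) (Pos-next Pos-start)
  ... | i₁ , P₁ , R₁
    with ⇓-findLoop {ρ} {suc i₁} {u} v r xs ne (trans (sym len) (cong (_+ length xs) (sym z)))
           v≤n (subst (λ l → Pos (suc i₁) (entriesW l _)) split (Pos-next P₁))
    where
    v≤n : Vec.lookup ρ v ≤ n
    v≤n = subst (_≤ n) len (≤-trans (m≤m+n (length xs) _) (≤-reflexive (trans (sym (length-++ xs)) (cong length (sym split)))))
  ... | i₂ , P₂ , R₂ = suc (suc i₂) , _ , Pos-next (Pos-next P₂) ,
    ⇓-bind (⇓-rewind i z≤n) (⇓-bind (⇓-moveR Pos-start) (⇓-bind R₁ (⇓-bind (⇓-moveR P₁) (⇓-bind R₂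
      (⇓-bind (⇓-registers (restore z)
                 (⇓-clear r (≤-trans (≤-reflexive (lookup∘update r ρ _)) v≤n)))
        (⇓-bind (⇓-moveR P₂) (⇓-moveR (Pos-next P₂))))))))
    where
    v≤n : Vec.lookup ρ v ≤ n
    v≤n = subst (_≤ n) len (≤-trans (m≤m+n (length xs) _) (≤-reflexive (trans (sym (length-++ xs)) (cong length (sym split)))))

  ⇓-lookNum : {A : Set} {ρ : Registers} {i : ℕ} {u : List Sym} {s : List Sym} (x : ℕ) {v : A} (f : InRead → A) →
    Pos i (numW x s) → f (inSym s0) ≡ v → f (inSym s1) ≡ v → f (inSym dot) ≡ v →
    look f ⊢ state ρ i u ⇓ v , state ρ i u
  ⇓-lookNum x f P e₀ e₁ e₂ with bits x
  ... | []        = ⇓-look f P e₂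
  ... | false ∷ _ = ⇓-look f P e₀
  ... | true ∷ _  = ⇓-look f P e₁

  ⇓-walk-just : ∀ {ρ i u s x} xs j → Pos i (numsW xs (close′ ∷ s)) → lookupℕ xs j ≡ just x →
    ∃ λ i′ → ∃ λ s′ → Pos i′ (numW x s′) × (walk j ⊢ state ρ i u ⇓ true , state ρ i′ u)
  ⇓-walk-just (x ∷ xs) zero    P refl = _ , _ , P , ⇓-lookNum x _ P refl refl refl
  ⇓-walk-just (x ∷ xs) (suc j) P e with ⇓-skipNum x P
  ... | i₁ , P₁ , R₁ with ⇓-walk-just xs j P₁ e
  ... | i₂ , s , P₂ , R₂ = i₂ , s , P₂ , ⇓-bind (⇓-lookNum x (isSym close′) P refl refl refl) (⇓-bind R₁ R₂)

  ⇓-walk-nothing : ∀ {ρ i u s} xs j → Pos i (numsW xs (close′ ∷ s)) → lookupℕ xs j ≡ nothing →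
    ∃ λ i′ → walk j ⊢ state ρ i u ⇓ false , state ρ i′ u
  ⇓-walk-nothing []       zero    P e = _ , ⇓-look _ P refl
  ⇓-walk-nothing []       (suc j) P e = _ , ⇓-bind (⇓-look (isSym close′) P refl) (⇓-ret z≤n)
  ⇓-walk-nothing (x ∷ xs) (suc j) P e with ⇓-skipNum x P
  ... | i₁ , P₁ , R₁ with ⇓-walk-nothing xs j P₁ e
  ... | i₂ , R₂ = i₂ , ⇓-bind (⇓-lookNum x (isSym close′) P refl refl refl) (⇓-bind R₁ R₂)

  ⇓-exactly-yes : ∀ {ρ i u s} xs → Pos i (numsW xs (close′ ∷ s)) →
    ∃ λ i′ → Pos i′ (close′ ∷ s) × (exactly (length xs) ⊢ state ρ i u ⇓ true , state ρ i′ u)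
  ⇓-exactly-yes []       P = _ , P , ⇓-look _ P refl
  ⇓-exactly-yes (x ∷ xs) P with ⇓-skipNum x P
  ... | i₁ , P₁ , R₁ with ⇓-exactly-yes xs P₁
  ... | i₂ , P₂ , R₂ = i₂ , P₂ , ⇓-bind (⇓-lookNum x (isSym close′) P refl refl refl) (⇓-bind R₁ R₂)

  ⇓-exactly-no : ∀ {ρ i u s} xs j → Pos i (numsW xs (close′ ∷ s)) → length xs ≢ j →
    ∃ λ i′ → exactly j ⊢ state ρ i u ⇓ false , state ρ i′ u
  ⇓-exactly-no []       zero    P ne = contradiction refl ne
  ⇓-exactly-no []       (suc j) P ne = _ , ⇓-bind (⇓-look (isSym close′) P refl) (⇓-ret z≤n)
  ⇓-exactly-no (x ∷ xs) zero    P ne = _ , ⇓-lookNum x _ P refl refl refl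
  ⇓-exactly-no (x ∷ xs) (suc j) P ne with ⇓-skipNum x P
  ... | i₁ , P₁ , R₁ with ⇓-exactly-no xs j P₁ (ne ∘ cong suc)
  ... | i₂ , R₂ = i₂ , ⇓-bind (⇓-lookNum x (isSym close′) P refl refl refl) (⇓-bind R₁ R₂)

  -- The final `dot` is part of the word sought, so a numeral of which `bs` is a proper prefix does
  -- not match.
  ⇓-match : ∀ {ρ i u s} bs cs → Pos i (map symbol cs ++ dot ∷ s) →
    ∃ λ i′ → match (map symbol bs ++ dot ∷ []) ⊢ state ρ i u ⇓ equalDigits bs cs , state ρ i′ u
  ⇓-match []           []           P = _ , ⇓-bind (⇓-look _ P refl) (⇓-bind (⇓-moveR P) (⇓-ret z≤n))
  ⇓-match []           (false ∷ cs) P = _ , ⇓-bind (⇓-look _ P refl) (⇓-ret z≤n)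
  ⇓-match []           (true ∷ cs)  P = _ , ⇓-bind (⇓-look _ P refl) (⇓-ret z≤n)
  ⇓-match (false ∷ bs) []           P = _ , ⇓-bind (⇓-look _ P refl) (⇓-ret z≤n)
  ⇓-match (true ∷ bs)  []           P = _ , ⇓-bind (⇓-look _ P refl) (⇓-ret z≤n)
  ⇓-match (false ∷ bs) (true ∷ cs)  P = _ , ⇓-bind (⇓-look _ P refl) (⇓-ret z≤n)
  ⇓-match (true ∷ bs)  (false ∷ cs) P = _ , ⇓-bind (⇓-look _ P refl) (⇓-ret z≤n)
  ⇓-match (false ∷ bs) (false ∷ cs) P with ⇓-match bs cs (Pos-next P)
  ... | i , R = i , ⇓-bind (⇓-look _ P refl) (⇓-bind (⇓-moveR P) R)
  ⇓-match (true ∷ bs)  (true ∷ cs)  P with ⇓-match bs cs (Pos-next P)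
  ... | i , R = i , ⇓-bind (⇓-look _ P refl) (⇓-bind (⇓-moveR P) R)

  ⇓-fetch-just : ∀ {ρ i u} v j r {ns ts x} → v ≢ r → Vec.lookup ρ r ≡ 0 → lookupℕ es (Vec.lookup ρ v) ≡ just (ns , ts) →
    lookupℕ ns j ≡ just x → x ≤ n → ∃ λ i′ → fetch v j r ⊢ state ρ i u ⇓ true , state (ρ [ r ]≔ x) i′ u
  ⇓-fetch-just {ρ} {i} {u} v j r {ns} ne z e l h with ⇓-locate {ρ} {i} {u} v r ne z e
  ... | i₁ , s , P₁ , R₁ with ⇓-walk-just ns j P₁ l
  ... | i₂ , s₂ , P₂ , R₂ with ⇓-load r z h P₂
  ... | i₃ , P₃ , R₃ = i₃ , ⇓-bind R₁ (⇓-bind R₂ (⇓-bind R₃ (⇓-ret z≤n)))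

  ⇓-fetch-nothing : ∀ {ρ i u} v j r {ns ts} → v ≢ r → Vec.lookup ρ r ≡ 0 → lookupℕ es (Vec.lookup ρ v) ≡ just (ns , ts) →
    lookupℕ ns j ≡ nothing → ∃ λ i′ → fetch v j r ⊢ state ρ i u ⇓ false , state ρ i′ u
  ⇓-fetch-nothing {ρ} {i} {u} v j r {ns} ne z e l with ⇓-locate {ρ} {i} {u} v r ne z e
  ... | i₁ , s , P₁ , R₁ with ⇓-walk-nothing ns j P₁ l
  ... | i₂ , R₂ = i₂ , ⇓-bind R₁ (⇓-bind R₂ (⇓-ret z≤n))

  ⇓-checkTable : ∀ {ρ i u s} ts idx b → Pos i (close′ ∷ open′ ∷ numsW ts (close′ ∷ s)) →
    ∃ λ i′ → checkTable idx b ⊢ state ρ i u ⇓ has ts idx b , state ρ i′ u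
  ⇓-checkTable {ρ} {i} {u} ts idx b P with lookupℕ ts idx in e
  ... | nothing with ⇓-walk-nothing {ρ} {_} {u} ts idx (Pos-next (Pos-next P)) e
  ...   | i₁ , R₁ = i₁ , ⇓-bind (⇓-moveR P) (⇓-bind (⇓-moveR (Pos-next P)) (⇓-bind R₁ (⇓-ret z≤n)))
  ⇓-checkTable {ρ} {i} {u} ts idx b P | just x with ⇓-walk-just {ρ} {_} {u} ts idx (Pos-next (Pos-next P)) e
  ... | i₁ , s₁ , P₁ , R₁ with ⇓-match {ρ} {_} {u} (bits b) (bits x) P₁
  ... | i₂ , R₂ = i₂ , ⇓-bind (⇓-moveR P) (⇓-bind (⇓-moveR (Pos-next P)) (⇓-bind R₁
      (⇓-value (trans (equalDigits-bits b x) (≡ᵇ-comm b x)) R₂)))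
    where
    ≡ᵇ-comm : ∀ m n → (m ≡ᵇ n) ≡ (n ≡ᵇ m)
    ≡ᵇ-comm zero    zero    = refl
    ≡ᵇ-comm zero    (suc n) = refl
    ≡ᵇ-comm (suc m) zero    = refl
    ≡ᵇ-comm (suc m) (suc n) = ≡ᵇ-comm m n

  ⇓-check : ∀ {ρ i u} v r d idx b {ns ts} → v ≢ r → Vec.lookup ρ r ≡ 0 → lookupℕ es (Vec.lookup ρ v) ≡ just (ns , ts) →
    ∃ λ i′ → check v r d idx b ⊢ state ρ i u ⇓ (length ns ≡ᵇ d) ∧ has ts idx b , state ρ i′ u
  ⇓-check {ρ} {i} {u} v r d idx b {ns} {ts} ne z e with ⇓-locate {ρ} {i} {u} v r ne z e
  ... | i₁ , s , P₁ , R₁ with length ns ℕ.≟ d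
  ...   | no l≢ with ⇓-exactly-no {ρ} {i₁} {u} ns d P₁ l≢
  ...     | i₂ , R₂ = i₂ , subst (λ c → check v r d idx b ⊢ state ρ i u ⇓ c ∧ has ts idx b , state ρ i₂ u) (sym (≢⇒≡ᵇ l≢))
                             (⇓-bind R₁ (⇓-bind R₂ (⇓-ret z≤n)))
  ⇓-check {ρ} {i} {u} v r d idx b {ns} {ts} ne z e | i₁ , s , P₁ , R₁ | yes refl with ⇓-exactly-yes {ρ} {i₁} {u} ns P₁
  ... | i₂ , P₂ , R₂ with ⇓-checkTable {ρ} {i₂} {u} ts idx b P₂
  ... | i₃ , R₃ = i₃ , subst (λ c → check v r (length ns) idx b ⊢ state ρ i u ⇓ c ∧ has ts idx b , state ρ i₃ u) (sym (≡ᵇ-refl (length ns)))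
                             (⇓-bind R₁ (⇓-bind R₂ R₃))

-- Register programs with a denotation

Bounded : List Entry → Set
Bounded es = All (λ e → All (_< length es) (proj₁ e)) es

-- Registers are used as a stack. Those from 1 to `d - 1` hold node numbers fixed by the enclosing
-- loops and look-ups; those from `d` on are 0 and thus available as the counters that `locate`
-- requires.
record Valid (es : List Entry) (d : ℕ) (ρ : Registers) : Set where
  field
    nodeCount : Vec.lookup ρ zero ≡ length es
    low  : ∀ r → 1 ≤ toℕ r → toℕ r < d → Vec.lookup ρ r < length es
    high : ∀ r → 1 ≤ toℕ r → d ≤ toℕ r → Vec.lookup ρ r ≡ 0
open Valid

Valid-≤ : ∀ {es d ρ} → Valid es d ρ → ∀ r → Vec.lookup ρ r ≤ length es
Valid-≤ {d = d} V zero = ≤-reflexive (nodeCount V)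
Valid-≤ {d = d} V (suc r) with suc (toℕ r) ℕ.<? d
... | yes h = <⇒≤ (low V (suc r) (s≤s z≤n) h)
... | no  h = ≤-trans (≤-reflexive (high V (suc r) (s≤s z≤n) (≮⇒≥ h))) z≤n

Valid-push : ∀ {es ρ x} r → 1 ≤ toℕ r → Valid es (toℕ r) ρ → x < length es → Valid es (suc (toℕ r)) (ρ [ r ]≔ x)
Valid-push {ρ = ρ} zero () V h
Valid-push {ρ = ρ} (suc r) h V k .nodeCount = trans (lookup∘update′ (λ ()) ρ _) (nodeCount V)
Valid-push {ρ = ρ} {x} (suc r) h V k .low s 1≤s s<d with s ≟ suc r
... | yes refl = subst (_< _) (sym (lookup∘update s ρ x)) k
... | no  s≢r = subst (_< _) (sym (lookup∘update′ s≢r ρ x))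
                  (low V s 1≤s (≤∧≢⇒< (≤-pred s<d) (s≢r ∘ toℕ-injective)))
Valid-push {ρ = ρ} {x} (suc r) h V k .high s 1≤s d≤s =
  trans (lookup∘update′ (λ { refl → <-irrefl refl d≤s }) ρ x) (high V s 1≤s (≤-trans (n≤1+n _) d≤s))

All-lookupℕ : {A : Set} {P : A → Set} {xs : List A} {k : ℕ} {x : A} → All P xs → lookupℕ xs k ≡ just x → P x
All-lookupℕ {k = zero}  (p ∷ ps) refl = p
All-lookupℕ {k = suc k} (p ∷ ps) e    = All-lookupℕ {k = k} ps e

lookupℕ-< : {A : Set} (xs : List A) {k : ℕ} → k < length xs → ∃ λ x → lookupℕ xs k ≡ just x
lookupℕ-< (x ∷ xs) {zero}  h       = x , refl
lookupℕ-< (x ∷ xs) {suc k} (s≤s h) = lookupℕ-< xs h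

neighbour : List Entry → ℕ → ℕ → Maybe ℕ
neighbour es v j = lookupℕ es v Maybe.>>= λ e → lookupℕ (proj₁ e) j

matches : List Entry → ℕ → ℕ → ℕ → ℕ → Bool
matches es v d idx b = maybe (λ e → (length (proj₁ e) ≡ᵇ d) ∧ has (proj₂ e) idx b) false (lookupℕ es v)

Result : Set → Set
Result A = A × List Sym

-- A computation that may read the registers below d: its program, the value and
-- output it denotes, and the proof that the program leaves all registers unchanged.
record Comp (d : ℕ) (A : Set) : Set₁ where
  field
    code : Prog A
    sem  : List Entry → Registers → Result A
    runs : ∀ es → Bounded es → ∀ C (fits : ∀ {x} → x ≤ length es → length (bits x) ≤ C) →
           let open RegisterRuns es C fits in
           ∀ ρ → Valid es d ρ → ∀ i u → ∃ λ i′ →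
           code ⊢ state ρ i u ⇓ proj₁ (sem es ρ) , state ρ i′ (u ++ proj₂ (sem es ρ))
open Comp

returnC : ∀ {d} {A : Set} → A → Comp d A
returnC a .code = ret a
returnC a .sem es ρ = a , []
returnC a .runs es B C fits ρ V i u =
  i , ⇓-outs (sym (++-identityʳ u)) (⇓-ret z≤n)
  where open RegisterRuns es C fits

emitC : ∀ {d} → List Sym → Comp d ⊤
emitC ss .code = emit ss
emitC ss .sem es ρ = tt , ss
emitC ss .runs es B C fits ρ V i u = i , ⇓-emit ss z≤n
  where open RegisterRuns es C fits

numberC : ∀ {d} → ℕ → ℕ → Fin 5 → Comp d ⊤
numberC k c r .code = emitAffine (suc k) c r
numberC k c r .sem es ρ = tt , numeral (suc k * Vec.lookup ρ r + c)
numberC k c r .runs es B C fits ρ V i u = i , ⇓-emitAffine k c r (Valid-≤ V r)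
  where open RegisterRuns es C fits

equalC : ∀ {d} → Fin 5 → Fin 5 → Comp d Bool
equalC r s .code = equal r s
equalC r s .sem es ρ = (Vec.lookup ρ r ≡ᵇ Vec.lookup ρ s) , []
equalC r s .runs es B C fits ρ V i u =
  i , ⇓-outs (sym (++-identityʳ u)) (⇓-equal r s (Valid-≤ V r))
  where open RegisterRuns es C fits

andThen : {A B : Set} → Result B → (B → Result A) → Result A
andThen (b , o) f = proj₁ (f b) , o ++ proj₂ (f b)

infixl 1 _⟫=_ _⟫_

_⟫=_ : ∀ {d} {A B : Set} {{_ : Finite B}} → Comp d B → (B → Comp d A) → Comp d A
_⟫=_ {{F}} c f .code = bind F (code c) (λ b → code (f b))
(c ⟫= f) .sem es ρ = andThen (sem c es ρ) (λ b → sem (f b) es ρ)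
(c ⟫= f) .runs es B C fits ρ V i u with runs c es B C fits ρ V i u
... | i₁ , R₁ with runs (f (proj₁ (sem c es ρ))) es B C fits ρ V i₁ (u ++ proj₂ (sem c es ρ))
... | i₂ , R₂ = i₂ , ⇓-outs (++-assoc u _ _) (⇓-bind R₁ R₂)
  where open RegisterRuns es C fits

_⟫_ : ∀ {d} {A : Set} → Comp d ⊤ → Comp d A → Comp d A
c ⟫ c′ = c ⟫= λ _ → c′

-- A register holding 0 also counts as one holding a node number as soon as there is a node at all,
-- and register 1 provides one because of `2 ≤ d`.
weakenC : ∀ {d d′} {A : Set} → 2 ≤ d → d ≤ d′ → Comp d′ A → Comp d A
weakenC 2≤d h c .code = code c
weakenC 2≤d h c .sem  = sem c
weakenC {d} {d′} 2≤d h c .runs es B C fits ρ V = runs c es B C fits ρ V′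
  where
  V′ : Valid es d′ ρ
  V′ .nodeCount = nodeCount V
  V′ .low r 1≤r r<d′ with toℕ r ℕ.<? d
  ... | yes r<d = low V r 1≤r r<d
  ... | no  r≮d = subst (_< length es) (sym (high V r 1≤r (≮⇒≥ r≮d))) nonempty
    where
    nonempty : 0 < length es
    nonempty = ≤-trans (s≤s z≤n) (low V (suc zero) ≤-refl 2≤d)
  V′ .high r 1≤r d′≤r = high V r 1≤r (≤-trans h d′≤r)

lookup-valid : ∀ {es d ρ} (v : Fin 5) → Valid es d ρ → 1 ≤ toℕ v → toℕ v < d →
  ∃ λ e → lookupℕ es (Vec.lookup ρ v) ≡ just e
lookup-valid {es} v V 1≤v v<d = lookupℕ-< es (low V v 1≤v v<d)

<⇒≢ᶠ : {v r : Fin 5} → toℕ v < toℕ r → v ≢ r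
<⇒≢ᶠ h refl = <-irrefl refl h

checkC : (v r : Fin 5) → 1 ≤ toℕ v → toℕ v < toℕ r → (d idx b : ℕ) → Comp (toℕ r) Bool
checkC v r 1≤v v<r d idx b .code = check v r d idx b
checkC v r 1≤v v<r d idx b .sem es ρ = matches es (Vec.lookup ρ v) d idx b , []
checkC v r 1≤v v<r d idx b .runs es B C fits ρ V i u with lookup-valid v V 1≤v v<r
... | (ns , ts) , e with ⇓-check {ρ} {i} {u} v r d idx b (<⇒≢ᶠ v<r) (high V r (≤-trans 1≤v (<⇒≤ v<r)) ≤-refl) e
  where open RegisterRuns es C fits
... | i′ , R = i′ , subst₂ (λ a o → check v r d idx b ⊢ state ρ i u ⇓ a , state ρ i′ o)
                      (cong (maybe (λ e → (length (proj₁ e) ≡ᵇ d) ∧ has (proj₂ e) idx b) false) (sym e)) (sym (++-identityʳ u)) R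
  where open RegisterRuns es C fits

neighbourC : {A : Set} {{_ : Finite A}} (v : Fin 5) (j : ℕ) (r : Fin 5) → 1 ≤ toℕ v → toℕ v < toℕ r →
  Comp (suc (toℕ r)) A → Comp (toℕ r) A → Comp (toℕ r) A
neighbourC {{F}} v j r 1≤v v<r found absent .code =
  bind Finite-Bool (fetch v j r) λ b → if b then bind F (code found) (λ a → clear r >> ret a) else code absent
neighbourC v j r 1≤v v<r found absent .sem es ρ =
  maybe (λ x → sem found es (ρ [ r ]≔ x)) (sem absent es ρ) (neighbour es (Vec.lookup ρ v) j)
neighbourC v j r 1≤v v<r found absent .runs es B C fits ρ V i u with lookup-valid v V 1≤v v<r
... | (ns , ts) , e rewrite e with lookupℕ ns j in l
...   | nothing = let i₁ , R₁ = ⇓-fetch-nothing v j r (<⇒≢ᶠ v<r) (high V r (≤-trans 1≤v (<⇒≤ v<r)) ≤-refl) e l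
                      i₂ , R₂ = runs absent es B C fits ρ V i₁ u
                  in i₂ , ⇓-bind R₁ R₂
  where open RegisterRuns es C fits
...   | just x  = let i₁ , R₁ = ⇓-fetch-just v j r (<⇒≢ᶠ v<r) z e l (<⇒≤ x<n)
                      i₂ , R₂ = runs found es B C fits (ρ [ r ]≔ x) (Valid-push r 1≤r V x<n) i₁ u
                  in i₂ , ⇓-bind R₁ (⇓-bind R₂ (⇓-bind
                       (⇓-registers (restore z)
                         (⇓-clear r (≤-trans (≤-reflexive (lookup∘update r ρ x)) (<⇒≤ x<n)))) (⇓-ret z≤n)))
  where
  open RegisterRuns es C fits
  1≤r = ≤-trans 1≤v (<⇒≤ v<r)
  z = high V r 1≤r ≤-refl
  x<n : x < length es
  x<n = All-lookupℕ {k = j} (All-lookupℕ {k = Vec.lookup ρ v} B e) l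

iterate : {A : Set} → (A → ℕ → Result A) → ℕ → ℕ → A → Result A
iterate f k zero    a = a , []
iterate f k (suc m) a = andThen (f a k) (iterate f (suc k) m)

-- The end test compares `r` with the node count in register 0. After the loop `r` holds this count,
-- which is no node number, and is cleared so that it is free again.
forC : {A : Set} {{_ : Finite A}} (r : Fin 5) → 1 ≤ toℕ r → (A → Comp (suc (toℕ r)) A) → A → Comp (toℕ r) A
forC {A} {{F}} r 1≤r body a₀ .code =
  bind F (loop F (λ a → bind Finite-Bool (equal r zero) λ b →
    if b then ret (inj₂ a) else bind F (code (body a)) (λ a′ → incr r >> ret (inj₁ a′))) a₀) (λ a → clear r >> ret a)
forC r 1≤r body a₀ .sem es ρ = iterate (λ a k → sem (body a) es (ρ [ r ]≔ k)) 0 (length es) a₀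
forC {A} {{F}} r 1≤r body a₀ .runs es B C fits ρ V i u =
  let i₁ , R₁ = go (length es) 0 a₀ i u refl
      o = u ++ proj₂ (iterate f 0 (length es) a₀)
      R₁′ = subst (λ y → loopProg a₀ ⊢ state y i u ⇓ proj₁ (iterate f 0 (length es) a₀) , state (ρ [ r ]≔ length es) i₁ o) zeroed R₁
  in i₁ , ⇓-bind R₁′ (⇓-bind
       (⇓-registers (restore z)
         (⇓-clear r (≤-reflexive (lookup∘update r ρ _)))) (⇓-ret z≤n))
  where
  open RegisterRuns es C fits
  z = high V r 1≤r ≤-refl
  zeroed : ρ [ r ]≔ 0 ≡ ρ
  zeroed = trans (cong (ρ [ r ]≔_) (sym z)) ([]≔-lookup ρ r)
  f : A → ℕ → Result A
  f a k = sem (body a) es (ρ [ r ]≔ k)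
  loopProg : A → Prog A
  loopProg = loop F (λ a → bind Finite-Bool (equal r zero) λ b →
    if b then ret (inj₂ a) else bind F (code (body a)) (λ a′ → incr r >> ret (inj₁ a′)))
  test : ∀ k i u → k ≤ length es → equal r zero ⊢ state (ρ [ r ]≔ k) i u ⇓ (k ≡ᵇ length es) , state (ρ [ r ]≔ k) i u
  test k i u h = ⇓-value
    (cong₂ _≡ᵇ_ (lookup∘update r ρ k) (trans (lookup∘update′ (λ { refl → <-irrefl refl 1≤r }) ρ k) (nodeCount V)))
    (⇓-equal r zero (≤-trans (≤-reflexive (lookup∘update r ρ k)) h))
  go : ∀ m k a i u → k + m ≡ length es → ∃ λ i′ →
    loopProg a ⊢ state (ρ [ r ]≔ k) i u ⇓ proj₁ (iterate f k m a) , state (ρ [ r ]≔ length es) i′ (u ++ proj₂ (iterate f k m a))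
  go zero k a i u e =
    i , subst₂ (λ y o → loopProg a ⊢ state (ρ [ r ]≔ k) i u ⇓ a , state (ρ [ r ]≔ y) i o) k≡ (sym (++-identityʳ u))
          (⇓-exit (⇓-bind (⇓-value
             (trans (cong (k ≡ᵇ_) (sym k≡)) (≡ᵇ-refl k)) (test k i u (≤-reflexive k≡))) (⇓-ret z≤n)))
    where k≡ = trans (sym (+-identityʳ k)) e
  go (suc m) k a i u e =
    let i₁ , R₁ = runs (body a) es B C fits (ρ [ r ]≔ k) (Valid-push r 1≤r V k<n) i u
        i₂ , R₂ = go m (suc k) (proj₁ (f a k)) i₁ (u ++ proj₂ (f a k)) (trans (sym (+-suc k m)) e)
    in i₂ , ⇓-outs (++-assoc u _ _)
          (⇓-again (⇓-bind (⇓-value (≢⇒≡ᵇ (<⇒≢ k<n)) (test k i u (<⇒≤ k<n)))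
             (⇓-bind R₁ (⇓-bind
               (⇓-registers
                 (trans ([]≔-idempotent ρ r) (cong (λ x → ρ [ r ]≔ suc x) (lookup∘update r ρ k)))
                 (⇓-incr r (≤-trans (≤-reflexive (lookup∘update r ρ k)) (<⇒≤ k<n)))) (⇓-ret z≤n)))) R₂)
    where
    k<n : k < length es
    k<n = subst (k <_) e (m<m+n k (s≤s z≤n))

-- The logarithmic space bound

numsW-length : ∀ xs s → length s ≤ length (numsW xs s)
numsW-length []       s = ≤-refl
numsW-length (x ∷ xs) s = ≤-trans (numsW-length xs s)
  (≤-trans (n≤1+n _) (≤-trans (m≤n+m _ (length (map symbol (bits x)))) (≤-reflexive (sym (length-++ (map symbol (bits x)))))))

entriesW-length : ∀ es s → length es + length s ≤ length (entriesW es s)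
entriesW-length []               s = ≤-refl
entriesW-length ((ns , ts) ∷ es) s = s≤s (≤-trans (entriesW-length es s)
  (≤-trans (≤-trans (m≤n+m _ 2) (numsW-length ts (close′ ∷ close′ ∷ entriesW es s)))
  (≤-trans (m≤n+m _ 2) (≤-trans (numsW-length ns _) (n≤1+n _)))))

word-length : ∀ es → suc (length es) ≤ length (word es)
word-length es = s≤s (≤-trans (≤-trans (≤-trans (m≤m+n (length es) 2) (entriesW-length es (close′ ∷ close′ ∷ [])))
  (m≤n+m (length (entriesW es (close′ ∷ close′ ∷ []))) 2))
  (≤-trans (m≤n+m _ (length (map symbol (bits (length es))))) (≤-reflexive (sym (length-++ (map symbol (bits (length es))))))))

-- Each entry contributes at least one symbol to the input, so `suc x` is at most its length, while
-- `2 ^ l` is at most `suc x` for the number `l` of digits of `x`.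
numeral-fits : ∀ es {x} → x ≤ length es → length (bits x) ≤ ⌊log₂ length (word es) ⌋
numeral-fits es {x} h = begin
  length (bits x)                    ≡⟨ ⌊log₂[2^n]⌋≡n (length (bits x)) ⟨
  ⌊log₂ 2 ^ length (bits x) ⌋        ≤⟨ ⌊log₂⌋-mono-≤ (1+value≥2^length (bits x)) ⟩
  ⌊log₂ suc (value (bits x)) ⌋       ≡⟨ cong (λ z → ⌊log₂ suc z ⌋) (value-bits x) ⟩
  ⌊log₂ suc x ⌋                      ≤⟨ ⌊log₂⌋-mono-≤ (≤-trans (s≤s h) (word-length es)) ⟩
  ⌊log₂ length (word es) ⌋           ∎
  where open ≤-Reasoning

start : Comp 1 ⊤ → Prog ⊤
start c = poke zero (digit false) >> (moveInput mR >> (moveInput mR >> (load zero >> code c)))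

initial : List Entry → Registers
initial es = length es ∷ 0 ∷ 0 ∷ 0 ∷ 0 ∷ []

initial-valid : ∀ es → Valid es 1 (initial es)
initial-valid es .nodeCount = refl
initial-valid es .low r 1≤r r<1 = ⊥-elim (<-irrefl refl (≤-trans r<1 1≤r))
initial-valid es .high zero () _
initial-valid es .high (suc zero) _ _ = refl
initial-valid es .high (suc (suc zero)) _ _ = refl
initial-valid es .high (suc (suc (suc zero))) _ _ = refl
initial-valid es .high (suc (suc (suc (suc zero)))) _ _ = refl

start-logSpace : ∀ c es → Bounded es → LogSpaceRun (Machine.M (start c)) 6 (word es) (proj₂ (sem c es (initial es)))
start-logSpace c es bounded = accept (exec (proj₂ start-runs) (λ _ → zero) (λ x → sym (layout-blank x)))
  where
  C : ℕ
  C = ⌊log₂ length (word es) ⌋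
  open RegisterRuns es C (numeral-fits es)
  ρ : Registers
  ρ = initial es
  start-runs : ∃ λ i → start c ⊢ mem 0 (layout (Vec.replicate 6 [])) 0 [] ⇓ proj₁ (sem c es ρ) , state ρ i (proj₂ (sem c es ρ))
  start-runs =
    let i₁ , _ , R₁ = ⇓-load {0 ∷ 0 ∷ 0 ∷ 0 ∷ 0 ∷ []} {2} {[]} {length es} zero refl ≤-refl (Pos-next Pos-start)
        i₂ , R₂ = runs c es bounded C (numeral-fits es) ρ (initial-valid es) i₁ []
    -- Setting the mark turns the blank tape into the tracks of five registers holding 0.
    in i₂ , ⇓-bind (⇓-insert false [] [] [] z≤n refl refl (λ _ → refl))
              (⇓-bind (⇓-still z≤n refl z≤n) (⇓-bind (⇓-moveR {0 ∷ 0 ∷ 0 ∷ 0 ∷ 0 ∷ []} Pos-start) (⇓-bind R₁ R₂)))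
  accept : ∀ {i a x o} {Q : (ℕ → Fin 3) → Set} → (∃ λ t → Q t × Steps (start c) (entry (start c)) (mem 0 (λ _ → zero) 0 []) a (mem i t x o)) →
    LogSpaceRun (Machine.M (start c)) 6 (word es) o
  accept (s , _ , ss) with machine-run (start c) ss
  ... | t , fin , bd = t ,
    trans (cong (TM.halts (Machine.M (start c)) ∘ st) fin) (cong (Machine.isHalt (start c)) (Machine.decode-code (start c) (inj₂ tt))) ,
    cong out fin ,
    -- The constant 6 of the space bound is the number of tracks.
    λ t′ t′≤t → ≤-trans (bd t′ t′≤t) (≤-reflexive (*-comm (suc C) 6))

lookup-injective : {A : Set} {xs : List A} → Unique xs → ∀ i j → lookup xs i ≡ lookup xs j → i ≡ j
lookup-injective (h ∷ u) zero    zero    e = refl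
lookup-injective (h ∷ u) zero    (suc j) e = contradiction e (All.lookup h (∈-lookup j))
lookup-injective (h ∷ u) (suc i) zero    e = contradiction (sym e) (All.lookup h (∈-lookup i))
lookup-injective (h ∷ u) (suc i) (suc j) e = cong suc (lookup-injective u i j e)

-- Networks of wires and two-input gates

apply2 : GateKind → Fin 2 → Fin 2 → Fin 2
apply2 AND = min2
apply2 OR  = max2

apply2-comm : ∀ k a b → apply2 k a b ≡ apply2 k b a
apply2-comm AND zero       zero       = refl
apply2-comm AND zero       (suc zero) = refl
apply2-comm AND (suc zero) zero       = refl
apply2-comm AND (suc zero) (suc zero) = refl
apply2-comm OR  zero       zero       = refl
apply2-comm OR  zero       (suc zero) = refl
apply2-comm OR  (suc zero) zero       = refl
apply2-comm OR  (suc zero) (suc zero) = refl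

apply2-zero : ∀ k → apply2 k zero zero ≡ zero
apply2-zero AND = refl
apply2-zero OR  = refl

gateVal-2 : ∀ k (xs : Fin 2 → Fin 2) → gateVal k 1 xs ≡ apply2 k (xs zero) (xs (suc zero))
gateVal-2 AND xs = refl
gateVal-2 OR  xs = refl

wireTable : List (Fin 2)
wireTable = zero ∷ suc zero ∷ []

gateTable : GateKind → List (Fin 2)
gateTable AND = zero ∷ zero ∷ zero ∷ suc zero ∷ []
gateTable OR  = zero ∷ suc zero ∷ suc zero ∷ suc zero ∷ []

length-≤2 : {A : Set} {a b : A} {us : List A} → Unique us → All (λ u → u ≡ a ⊎ u ≡ b) us → length us ≤ 2
length-≤2 {us = []} _ _ = z≤n
length-≤2 {us = _ ∷ []} _ _ = s≤s z≤n
length-≤2 {us = _ ∷ _ ∷ []} _ _ = ≤-refl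
length-≤2 {us = _ ∷ _ ∷ _ ∷ _} ((n ∷ m ∷ _) ∷ (k ∷ _) ∷ _) (inj₁ refl ∷ inj₁ refl ∷ _) = contradiction refl n
length-≤2 {us = _ ∷ _ ∷ _ ∷ _} ((n ∷ m ∷ _) ∷ (k ∷ _) ∷ _) (inj₂ refl ∷ inj₂ refl ∷ _) = contradiction refl n
length-≤2 {us = _ ∷ _ ∷ _ ∷ _} ((n ∷ m ∷ _) ∷ (k ∷ _) ∷ _) (inj₁ refl ∷ inj₂ refl ∷ inj₁ refl ∷ _) = contradiction refl m
length-≤2 {us = _ ∷ _ ∷ _ ∷ _} ((n ∷ m ∷ _) ∷ (k ∷ _) ∷ _) (inj₁ refl ∷ inj₂ refl ∷ inj₂ refl ∷ _) = contradiction refl k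
length-≤2 {us = _ ∷ _ ∷ _ ∷ _} ((n ∷ m ∷ _) ∷ (k ∷ _) ∷ _) (inj₂ refl ∷ inj₁ refl ∷ inj₁ refl ∷ _) = contradiction refl k
length-≤2 {us = _ ∷ _ ∷ _ ∷ _} ((n ∷ m ∷ _) ∷ (k ∷ _) ∷ _) (inj₂ refl ∷ inj₁ refl ∷ inj₂ refl ∷ _) = contradiction refl m

-- A network all of whose gates have as many outputs as inputs: node v is an output of the
-- gate whose inputs are pre v and pre (partner v), a single wire when partner v = v.
module Paired {m : ℕ} (pre post partner : Fin m → Fin m) (kindOf : Fin m → GateKind)
  (pre-post : ∀ v → pre (post v) ≡ v) (post-pre : ∀ v → post (pre v) ≡ v)
  (involutive : ∀ v → partner (partner v) ≡ v) (kind-partner : ∀ v → kindOf (partner v) ≡ kindOf v)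
  (pre≢ : ∀ v → pre v ≢ v) (pre≢partner : ∀ v → pre v ≢ partner v) where

  pre-injective : ∀ {u v} → pre u ≡ pre v → u ≡ v
  pre-injective {u} {v} e = trans (sym (post-pre u)) (trans (cong post e) (post-pre v))

  -- The decision is an argument, here and in `nbrsAt` and `tableAt`, so that proofs can match on
  -- one decision and have network, neighbours and table reduce together.
  netAt : (x : Fin m → Fin 2) (v : Fin m) → Dec (partner v ≡ v) → Fin 2
  netAt x v (yes _) = x (pre v)
  netAt x v (no _)  = apply2 (kindOf v) (x (pre v)) (x (pre (partner v)))

  net : Network 2 m
  net x v = netAt x v (partner v ≟ v)

  nbrsAt : (v : Fin m) → Dec (partner v ≡ v) → List (Fin m)
  nbrsAt v (yes _) = pre v ∷ []
  nbrsAt v (no _)  = pre v ∷ pre (partner v) ∷ []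

  tableAt : (v : Fin m) → Dec (partner v ≡ v) → List (Fin 2)
  tableAt v (yes _) = wireTable
  tableAt v (no _)  = gateTable (kindOf v)

  rep : NetRep 2 m
  rep .nbrs  v = nbrsAt v (partner v ≟ v)
  rep .table v = tableAt v (partner v ≟ v)

  net-cong : ∀ {x y} → x ≗ y → net x ≗ net y
  net-cong h v with partner v ≟ v
  ... | yes _ = h _
  ... | no _  = cong₂ (apply2 (kindOf v)) (h _) (h _)

  rep-denotes : Denotes rep net
  rep-denotes = (λ v → unique v (partner v ≟ v)) , (λ v → len v (partner v ≟ v)) , (λ x v → evaluated x v (partner v ≟ v))
    where
    unique : ∀ v d → Unique (nbrsAt v d)
    unique v (yes _) = [] ∷ []
    unique v (no ne) = ((ne ∘ sym ∘ pre-injective) ∷ []) ∷ [] ∷ []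
    len : ∀ v d → length (tableAt v d) ≡ 2 Data.Nat.^ length (nbrsAt v d)
    len v (yes _) = refl
    len v (no _) with kindOf v
    ... | AND = refl
    ... | OR  = refl
    wire : ∀ a → lookupℕ wireTable (lexIndex 2 (a ∷ [])) ≡ just a
    wire zero       = refl
    wire (suc zero) = refl
    gate : ∀ k a b → lookupℕ (gateTable k) (lexIndex 2 (a ∷ b ∷ [])) ≡ just (apply2 k a b)
    gate AND zero       zero       = refl
    gate AND zero       (suc zero) = refl
    gate AND (suc zero) zero       = refl
    gate AND (suc zero) (suc zero) = refl
    gate OR  zero       zero       = refl
    gate OR  zero       (suc zero) = refl
    gate OR  (suc zero) zero       = refl
    gate OR  (suc zero) (suc zero) = refl
    evaluated : ∀ x v d → lookupℕ (tableAt v d) (lexIndex 2 (map x (nbrsAt v d))) ≡ just (netAt x v d)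
    evaluated x v (yes _) = wire _
    evaluated x v (no _)  = gate (kindOf v) _ _

  rep-bound : DegreeBound 2 rep
  rep-bound = (λ v → ins v (partner v ≟ v)) , λ v us uniq h → length-≤2 uniq (All.map (λ {u} → outs₁ v u (partner u ≟ u)) h)
    where
    ins : ∀ v d → length (nbrsAt v d) ≤ 2
    ins v (yes _) = s≤s z≤n
    ins v (no _)  = ≤-refl
    outs₁ : ∀ v u d → v ∈ nbrsAt u d → u ≡ post v ⊎ u ≡ partner (post v)
    outs₁ v u (yes _) (here refl)         = inj₁ (sym (post-pre u))
    outs₁ v u (no _)  (here refl)         = inj₁ (sym (post-pre u))
    outs₁ v u (no _)  (there (here refl)) = inj₂ (trans (sym (involutive u)) (cong partner (sym (post-pre (partner u)))))

  -- Gates are numbered by the orbits of `partner`, each represented by its smaller element.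
  leaders : List (Fin m)
  leaders = filter (λ v → toℕ v ≤? toℕ (partner v)) (allFin m)

  leader : Fin (length leaders) → Fin m
  leader = lookup leaders

  leader-≤ : ∀ j → toℕ (leader j) ≤ toℕ (partner (leader j))
  leader-≤ j = proj₂ (∈-filter⁻ (λ v → toℕ v ≤? toℕ (partner v)) {xs = allFin m} (∈-lookup j))

  leader-injective : ∀ {i j} → leader i ≡ leader j → i ≡ j
  leader-injective = lookup-injective (filter⁺ (λ v → toℕ v ≤? toℕ (partner v)) (allFin⁺ m)) _ _

  leader-surjective : ∀ v → toℕ v ≤ toℕ (partner v) → ∃ λ j → leader j ≡ v
  leader-surjective v h = Any.index v∈ , sym (lookup-index v∈)
    where v∈ = ∈-filter⁺ (λ v → toℕ v ≤? toℕ (partner v)) (∈-allFin v) h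

  arityOf : ∀ {v} → Dec (partner v ≡ v) → Fin 2
  arityOf (yes _) = zero
  arityOf (no _)  = suc zero

  arity : Fin (length leaders) → Fin 2
  arity j = arityOf (partner (leader j) ≟ leader j)

  memberAt : ∀ u (d : Dec (partner u ≡ u)) → Fin (suc (toℕ (arityOf d))) → Fin m
  memberAt u (yes _) zero       = u
  memberAt u (no _)  zero       = u
  memberAt u (no _)  (suc zero) = partner u

  Slot : Set
  Slot = Σ (Fin (length leaders)) λ j → Fin (suc (toℕ (arity j)))

  member : Slot → Fin m
  member (j , k) = memberAt (leader j) (partner (leader j) ≟ leader j) k

  memberAt-zero : ∀ u d → memberAt u d zero ≡ u
  memberAt-zero u (yes _) = refl
  memberAt-zero u (no _)  = refl

  memberAt-one : ∀ u d → partner u ≢ u → ∃ λ k → memberAt u d k ≡ partner u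
  memberAt-one u (yes e) ne = contradiction e ne
  memberAt-one u (no _)  ne = suc zero , refl

  memberAt-cases : ∀ u d k → memberAt u d k ≡ u ⊎ memberAt u d k ≡ partner u
  memberAt-cases u (yes _) zero       = inj₁ refl
  memberAt-cases u (no _)  zero       = inj₁ refl
  memberAt-cases u (no _)  (suc zero) = inj₂ refl

  memberAt-injective : ∀ u d {k k′} → memberAt u d k ≡ memberAt u d k′ → k ≡ k′
  memberAt-injective u (yes _) {zero}     {zero}     e = refl
  memberAt-injective u (no _)  {zero}     {zero}     e = refl
  memberAt-injective u (no ne) {zero}     {suc zero} e = contradiction (sym e) ne
  memberAt-injective u (no ne) {suc zero} {zero}     e = contradiction e ne
  memberAt-injective u (no _)  {suc zero} {suc zero} e = refl

  member-cases : ∀ j k → member (j , k) ≡ leader j ⊎ member (j , k) ≡ partner (leader j)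
  member-cases j k = memberAt-cases (leader j) _ k

  member-surjective : ∀ v → ∃ λ s → member s ≡ v
  member-surjective v with toℕ v ≤? toℕ (partner v)
  ... | yes h with leader-surjective v h
  ...   | j , e = (j , zero) , trans (memberAt-zero (leader j) (partner (leader j) ≟ leader j)) e
  member-surjective v | no h with leader-surjective (partner v) (subst (λ z → toℕ (partner v) ≤ toℕ z) (sym (involutive v)) (≰⇒≥ h))
  ...   | j , e with memberAt-one (leader j) (partner (leader j) ≟ leader j)
                       (λ f → h (subst (λ z → toℕ v ≤ toℕ z) (trans (sym (involutive v)) (trans (cong partner (sym e)) (trans f e))) ≤-refl))
  ...     | k , f = (j , k) , trans f (trans (cong partner e) (involutive v))

  -- Both `u` and `u′` lie in the orbit of `v` and do not exceed their partners, so each is the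
  -- minimum of that orbit.
  same-leader : ∀ {u u′ v} → toℕ u ≤ toℕ (partner u) → toℕ u′ ≤ toℕ (partner u′) →
    v ≡ u ⊎ v ≡ partner u → v ≡ u′ ⊎ v ≡ partner u′ → u ≡ u′
  same-leader h h′ (inj₁ refl) (inj₁ refl) = refl
  same-leader {u} {u′} h h′ (inj₁ refl) (inj₂ refl) =
    toℕ-injective (≤-antisym (subst (λ z → toℕ u ≤ toℕ z) (involutive u′) h) h′)
  same-leader {u} {u′} h h′ (inj₂ refl) (inj₁ refl) =
    toℕ-injective (≤-antisym h (subst (λ z → toℕ (partner u) ≤ toℕ z) (involutive u) h′))
  same-leader {u} {u′} h h′ (inj₂ refl) (inj₂ e) =
    trans (sym (involutive u)) (trans (cong partner e) (involutive u′))

  member-injective : ∀ {s s′} → member s ≡ member s′ → s ≡ s′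
  member-injective {j , k} {j′ , k′} e
    with leader-injective (same-leader (leader-≤ j) (leader-≤ j′) (member-cases j k)
           (subst (λ z → z ≡ leader j′ ⊎ z ≡ partner (leader j′)) (sym e) (member-cases j′ k′)))
  ... | refl = cong (j ,_) (memberAt-injective (leader j) _ e)

  slot : Fin m → Slot
  slot v = proj₁ (member-surjective v)

  member-slot : ∀ v → member (slot v) ≡ v
  member-slot v = proj₂ (member-surjective v)

  -- The second output of a gate reads the two inputs in the opposite order, while `gateVal` has one
  -- order for all outputs; this is where commutativity of AND and OR enters.
  netAt-member : ∀ x u d k → net x (memberAt u d k) ≡
    gateVal (kindOf u) (toℕ (arityOf d)) (λ k → x (pre (memberAt u d k)))
  netAt-member x u (yes e) zero with partner u ≟ u
  ... | yes _ = refl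
  ... | no ne = contradiction e ne
  netAt-member x u (no ne) zero with partner u ≟ u
  ... | yes e = contradiction e ne
  ... | no _  = sym (gateVal-2 (kindOf u) _)
  netAt-member x u (no ne) (suc zero) with partner (partner u) ≟ partner u
  ... | yes e = contradiction (trans (sym e) (involutive u)) ne
  ... | no _  = begin
    apply2 (kindOf (partner u)) (x (pre (partner u))) (x (pre (partner (partner u))))
      ≡⟨ cong₂ (λ k v → apply2 k (x (pre (partner u))) (x (pre v))) (kind-partner u) (involutive u) ⟩
    apply2 (kindOf u) (x (pre (partner u))) (x (pre u))
      ≡⟨ apply2-comm (kindOf u) _ _ ⟩
    apply2 (kindOf u) (x (pre u)) (x (pre (partner u)))
      ≡⟨ sym (gateVal-2 (kindOf u) _) ⟩
    gateVal (kindOf u) 1 (λ k → x (pre (memberAt u (no ne) k))) ∎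
    where open ≡-Reasoning

  isGmNetwork : GmNetwork m net
  isGmNetwork .GmNetwork.gates = length leaders
  isGmNetwork .GmNetwork.kind  = kindOf ∘ leader
  isGmNetwork .GmNetwork.inAr  = arity
  isGmNetwork .GmNetwork.outAr = arity
  isGmNetwork .GmNetwork.α     = pre ∘ member
  isGmNetwork .GmNetwork.β     = slot
  isGmNetwork .GmNetwork.α-bij =
    (λ e → member-injective (pre-injective e)) ,
    λ v → slot (post v) , λ { refl → trans (cong pre (member-slot (post v))) (pre-post v) }
  isGmNetwork .GmNetwork.β-bij =
    (λ {u} {v} e → trans (sym (member-slot u)) (trans (cong member e) (member-slot v))) ,
    λ s → member s , λ { refl → member-injective (member-slot (member s)) }
  -- If `pre v` were an output of the gate that has `v` as an output, both would lie in the orbit of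
  -- `leader j`, so `pre v` would be `v` or `partner v`.
  isGmNetwork .GmNetwork.noSelfLoop j k e = clash (member-cases j k)
      (subst (λ i → pre v ≡ leader i ⊎ pre v ≡ partner (leader i)) e
        (subst (λ z → z ≡ leader (proj₁ (slot (pre v))) ⊎ z ≡ partner (leader (proj₁ (slot (pre v)))))
          (member-slot (pre v)) (member-cases (proj₁ (slot (pre v))) (proj₂ (slot (pre v))))))
    where
    v = member (j , k)
    clash : ∀ {u v} → v ≡ u ⊎ v ≡ partner u → pre v ≡ u ⊎ pre v ≡ partner u → ⊥
    clash {v = v} (inj₁ refl) (inj₁ f) = pre≢ v f
    clash {v = v} (inj₁ refl) (inj₂ f) = pre≢partner v f
    clash {u} {v} (inj₂ refl) (inj₁ f) = pre≢partner v (trans f (sym (involutive u)))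
    clash {v = v} (inj₂ refl) (inj₂ f) = pre≢ v f
  isGmNetwork .GmNetwork.local x v =
    trans (cong (net x) (sym (member-slot v)))
      (netAt-member x (leader (proj₁ (slot v))) _ (proj₂ (slot v)))

-- The program of a block

-- Guard (d , idx , b) holds at a node of in-degree d whose table has b at position idx.
Guard : Set
Guard = ℕ × ℕ × ℕ

module Block (q Δ′ : ℕ) where

  Δ : ℕ
  Δ = suc Δ′

  -- A block stores one-hot codes: the state of its node, Δ incoming and Δ outgoing
  -- copies of states, and three scratch wires of which the last is constantly 0.
  Wire : Set
  Wire = (Fin q ⊎ (Fin Δ × Fin q)) ⊎ ((Fin Δ × Fin q) ⊎ Fin 3)

  pattern main a  = inj₁ (inj₁ a)
  pattern inW j a = inj₁ (inj₂ (j , a))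
  pattern outW r a = inj₂ (inj₁ (r , a))
  pattern acc = inj₂ (inj₂ zero)
  pattern tmp = inj₂ (inj₂ (suc zero))
  pattern nil = inj₂ (inj₂ (suc (suc zero)))

  width : ℕ
  width = (q + Δ * q) + (Δ * q + 3)

  wires : Fin width ↔ Wire
  wires = ↔-trans +↔⊎ (↔-trans +↔⊎ (↔-refl ⊎-↔ *↔×) ⊎-↔ ↔-trans +↔⊎ (*↔× ⊎-↔ ↔-refl))

  _≟ʷ_ : (w w′ : Wire) → Dec (w ≡ w′)
  _≟ʷ_ = ⊎.≡-dec (⊎.≡-dec _≟_ (×.≡-dec _≟_ _≟_)) (⊎.≡-dec (×.≡-dec _≟_ _≟_) _≟_)

  -- gate g k i j replaces both wires i and j by the output of k, provided that g holds.
  data Instr : Set where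
    gate     : Maybe Guard → GateKind → Wire → Wire → Instr
    exchange : Instr

  instrKind : Instr → GateKind
  instrKind (gate _ k _ _) = k
  instrKind exchange       = AND

  swap : Wire → Wire → Wire → Wire
  swap i j w with w ≟ʷ i
  ... | yes _ = j
  ... | no _ with w ≟ʷ j
  ...   | yes _ = i
  ...   | no _  = w

  swap-left : ∀ i j → swap i j i ≡ j
  swap-left i j with i ≟ʷ i
  ... | yes _ = refl
  ... | no ne = contradiction refl ne

  swap-right : ∀ i j → swap i j j ≡ i
  swap-right i j with j ≟ʷ i
  ... | yes e = e
  ... | no _ with j ≟ʷ j
  ...   | yes _ = refl
  ...   | no ne = contradiction refl ne

  swap-other : ∀ i j w → w ≢ i → w ≢ j → swap i j w ≡ w
  swap-other i j w ni nj with w ≟ʷ i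
  ... | yes e = contradiction e ni
  ... | no _ with w ≟ʷ j
  ...   | yes e = contradiction e nj
  ...   | no _  = refl

  swap-involutive : ∀ i j w → swap i j (swap i j w) ≡ w
  swap-involutive i j w with w ≟ʷ i
  ... | yes refl = swap-right i j
  ... | no ni with w ≟ʷ j
  ...   | yes refl = swap-left i j
  ...   | no nj    = swap-other i j w ni nj

  -- Where a guard fails, two plain wires take the place of the gate. All blocks thus have the same
  -- layers and wires and differ only in this pairing.
  partnerW : Instr → (Guard → Bool) → Wire → Wire
  partnerW (gate nothing k i j)  γ w = swap i j w
  partnerW (gate (just g) k i j) γ w = if γ g then swap i j w else w
  partnerW exchange              γ w = w

  partnerW-involutive : ∀ I γ w → partnerW I γ (partnerW I γ w) ≡ w
  partnerW-involutive (gate nothing k i j)  γ w = swap-involutive i j w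
  partnerW-involutive (gate (just g) k i j) γ w with γ g
  ... | true  = swap-involutive i j w
  ... | false = refl
  partnerW-involutive exchange              γ w = refl

  source : Wire → Wire
  source (inW j a)  = main a
  source (outW r a) = main a
  source w          = nil

  copyTo clearW : Wire → Instr
  copyTo w = gate nothing OR (source w) w
  clearW w  = gate nothing AND w nil

  portWires mainWires : List Wire
  portWires = map (λ p → inW (proj₁ p) (proj₂ p)) (cartesianProduct (allFin Δ) (allFin q)) ++
              map (λ p → outW (proj₁ p) (proj₂ p)) (cartesianProduct (allFin Δ) (allFin q))
  mainWires = map (λ a → main a) (allFin q)

  -- AND overwrites both of its wires, so the literal is first copied to `tmp`; the port survives
  -- for the tuples still to be evaluated.
  conjoin : Fin Δ → Fin q → List Instr
  conjoin j a = gate nothing OR (inW j a) tmp ∷ gate nothing AND tmp acc ∷ clearW tmp ∷ []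

  -- The copy in `tmp` keeps `acc` intact for the remaining pairs, since the guarded OR mixes
  -- `main b` into both of its wires. A node of in-degree `d` looks at its first `d` ports only,
  -- hence `take d`: tuples with the same first `d` states address the same table entry.
  contribute : Vec (Fin q) Δ → ℕ × Fin q → List Instr
  contribute τ (d , b) =
    gate nothing OR acc tmp ∷
    gate (just (d , lexIndex q (take d (Vec.toList τ)) , toℕ b)) OR tmp (main b) ∷
    clearW tmp ∷ []

  -- At the start `acc` is 0, so the first literal is loaded by OR and only the others are conjoined
  -- by AND. Port `zero` exists because Δ is a successor.
  evaluate : Vec (Fin q) Δ → List Instr
  evaluate τ = gate nothing OR (inW zero (Vec.lookup τ zero)) acc ∷
    concatMap (λ j → conjoin (suc j) (Vec.lookup τ (suc j))) (allFin Δ′) ++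
    concatMap (contribute τ) (cartesianProduct (upTo (suc Δ)) (allFin q)) ++
    clearW acc ∷ []

  tuples : ∀ k → List (Vec (Fin q) k)
  tuples zero    = [] ∷ []
  tuples (suc k) = cartesianProductWith _∷_ (allFin q) (tuples k)

  tuples-complete : ∀ {k} (τ : Vec (Fin q) k) → τ ∈ tuples k
  tuples-complete []      = here refl
  tuples-complete (a ∷ τ) = ∈-cartesianProductWith⁺ _∷_ (∈-allFin a) (tuples-complete τ)

  -- The two leading instructions clear a wire that is 0 anyway. They make the number of layers
  -- reduce to the form `suc (suc _)`, so that no layer is its own predecessor and no gate feeds
  -- itself.
  before after : List Instr
  before = clearW acc ∷ clearW acc ∷ map copyTo portWires ++ map clearW mainWires
  after  = concatMap evaluate (tuples Δ) ++ map clearW portWires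

  program : List Instr
  program = before ++ exchange ∷ after

  State : Set
  State = Wire → Fin 2

  hot : Fin q → Fin q → Fin 2
  hot a b with a ≟ b
  ... | yes _ = suc zero
  ... | no _  = zero

  hot-refl : ∀ a → hot a a ≡ suc zero
  hot-refl a with a ≟ a
  ... | yes _ = refl
  ... | no ne = contradiction refl ne

  hot-1 : ∀ {a b} → hot a b ≡ suc zero → a ≡ b
  hot-1 {a} {b} e with a ≟ b
  ... | yes p = p

  codeword : Fin q → State
  codeword a (main b) = hot a b
  codeword a _        = zero

  execAt : Instr → State → (w w′ : Wire) → Dec (w′ ≡ w) → Fin 2
  execAt I st w w′ (yes _) = st w
  execAt I st w w′ (no _)  = apply2 (instrKind I) (st w) (st w′)

  exec : (Guard → Bool) → Instr → State → State
  exec γ I st w = execAt I st w (partnerW I γ w) (partnerW I γ w ≟ʷ w)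

  execs : (Guard → Bool) → List Instr → State → State
  execs γ []       st = st
  execs γ (I ∷ Is) st = execs γ Is (exec γ I st)

  execAt-cong : ∀ I {st st′} → st ≗ st′ → ∀ w w′ d → execAt I st w w′ d ≡ execAt I st′ w w′ d
  execAt-cong I h w w′ (yes _) = h w
  execAt-cong I h w w′ (no _)  = cong₂ (apply2 (instrKind I)) (h w) (h w′)

  exec-cong : ∀ γ I {st st′} → st ≗ st′ → exec γ I st ≗ exec γ I st′
  exec-cong γ I h w = execAt-cong I h w (partnerW I γ w) (partnerW I γ w ≟ʷ w)

  -- Correctness of the program of a block

  module Execution (γ : Guard → Bool) where

    infix 3 _⟦_⟧_

    record _⟦_⟧_ (st : State) (Is : List Instr) (st′ : State) : Set where
      constructor yields
      field result : ∀ s → s ≗ st → execs γ Is s ≗ st′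
    open _⟦_⟧_ public

    execs-++ : ∀ Is Js s → execs γ (Is ++ Js) s ≡ execs γ Js (execs γ Is s)
    execs-++ []       Js s = refl
    execs-++ (I ∷ Is) Js s = execs-++ Is Js (exec γ I s)

    seq : ∀ {st st′ st″ Is Js} → st ⟦ Is ⟧ st′ → st′ ⟦ Js ⟧ st″ → st ⟦ Is ++ Js ⟧ st″
    seq {Is = Is} {Js} P Q .result s h w =
      trans (cong (λ z → z w) (execs-++ Is Js s)) (result Q _ (result P s h) w)

    then : ∀ {st st′ st″ I Is} → st ⟦ I ∷ [] ⟧ st′ → st′ ⟦ Is ⟧ st″ → st ⟦ I ∷ Is ⟧ st″
    then P Q .result s h = result Q _ (result P s h)

    nop : ∀ {st} → st ⟦ [] ⟧ st
    nop .result s h = h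

    -- The hypothesis on `partnerW` covers both a gate without guard and a gate whose guard holds.
    swapped : ∀ {k i j st st′ g} → i ≢ j →
      (∀ w → partnerW (gate g k i j) γ w ≡ swap i j w) →
      st′ i ≡ apply2 k (st i) (st j) → st′ j ≡ apply2 k (st i) (st j) →
      (∀ w → w ≢ i → w ≢ j → st′ w ≡ st w) → st ⟦ gate g k i j ∷ [] ⟧ st′
    swapped {k} {i} {j} {st} {st′} {g} i≢j p ei ej eo .result s h w =
      trans (exec-cong γ (gate g k i j) h w) (go w (w ≟ʷ i) (w ≟ʷ j) (partnerW (gate g k i j) γ w ≟ʷ w))
      where
      I = gate g k i j
      go : ∀ w → Dec (w ≡ i) → Dec (w ≡ j) → ∀ d → execAt I st w (partnerW I γ w) d ≡ st′ w
      go w (yes refl) _ (yes e) = contradiction (trans (sym e) (trans (p w) (swap-left w j))) i≢j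
      go w (yes refl) _ (no _)  = trans (cong (λ z → apply2 k (st w) (st z)) (trans (p w) (swap-left w j))) (sym ei)
      go w (no _) (yes refl) (yes e) = contradiction (trans (sym (trans (p w) (swap-right i w))) e) i≢j
      go w (no _) (yes refl) (no _)  = trans (cong (λ z → apply2 k (st w) (st z)) (trans (p w) (swap-right i w)))
                                         (trans (apply2-comm k (st w) (st i)) (sym ej))
      go w (no ni) (no nj) (yes _) = sym (eo w ni nj)
      go w (no ni) (no nj) (no ne) = contradiction (trans (p w) (swap-other i j w ni nj)) ne

    plain : ∀ {k i j st st′} → i ≢ j → st′ i ≡ apply2 k (st i) (st j) → st′ j ≡ apply2 k (st i) (st j) →
      (∀ w → w ≢ i → w ≢ j → st′ w ≡ st w) → st ⟦ gate nothing k i j ∷ [] ⟧ st′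
    plain {k} i≢j = swapped {k} {g = nothing} i≢j (λ _ → refl)

    max2-zeroʳ : ∀ a → max2 a zero ≡ a
    max2-zeroʳ zero       = refl
    max2-zeroʳ (suc zero) = refl

    min2-zeroʳ : ∀ a → min2 a zero ≡ zero
    min2-zeroʳ zero       = refl
    min2-zeroʳ (suc zero) = refl

    override : State → Wire → Fin 2 → State
    override st w b v with v ≟ʷ w
    ... | yes _ = b
    ... | no _  = st v

    override-here : ∀ st w b → override st w b w ≡ b
    override-here st w b with w ≟ʷ w
    ... | yes _ = refl
    ... | no ne = contradiction refl ne

    override-other : ∀ st w b v → v ≢ w → override st w b v ≡ st v
    override-other st w b v ne with v ≟ʷ w
    ... | yes e = contradiction e ne
    ... | no _  = refl

    -- Invariant: a wire that is not waiting in `ws` already has its final value. Repetitions in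
    -- `ws` do no harm, which includes the two leading instructions of `before`.
    clears : ∀ ws {st st′} → nil ∉ ws → st nil ≡ zero → st′ nil ≡ zero →
      (∀ w → st w ≡ st′ w ⊎ w ∈ ws) → (∀ w → w ∈ ws → st′ w ≡ zero) → st ⟦ map clearW ws ⟧ st′
    clears [] n z z′ p f .result s h w with p w
    ... | inj₁ e = trans (h w) e
    clears (w ∷ ws) {st} {st′} n z z′ p f =
      then (plain {AND} {st′ = mid} (λ e → n (here (sym e))) (trans (override-here st w zero) (sym gone)) (trans mid-nil (sym gone))
             (λ v ne _ → override-other st w zero v ne))
        (clears ws (n ∘ there) mid-nil z′ rest (λ v → f v ∘ there))
      where
      mid : State
      mid = override st w zero
      gone : min2 (st w) (st nil) ≡ zero
      gone = trans (cong (min2 (st w)) z) (min2-zeroʳ (st w))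
      mid-nil : mid nil ≡ zero
      mid-nil = trans (override-other st w zero nil (λ e → n (here e))) z
      rest : ∀ v → mid v ≡ st′ v ⊎ v ∈ ws
      rest v with v ≟ʷ w
      ... | yes refl = inj₁ (sym (f v (here refl)))
      ... | no ne with p v
      ...   | inj₁ e          = inj₁ e
      ...   | inj₂ (here e)   = contradiction e ne
      ...   | inj₂ (there v∈) = inj₂ v∈

    -- A target is either still 0, so that OR copies, or already agrees with its source, so that OR
    -- changes nothing. No source is a target, hence sources have their final values all along.
    copies : ∀ ws {st st′} → (∀ w w′ → w ∈ ws → w′ ∈ ws → source w ≢ w′) →
      (∀ w → st w ≡ st′ w ⊎ (w ∈ ws × st w ≡ zero)) → (∀ w → w ∈ ws → st′ w ≡ st′ (source w)) →
      st ⟦ map copyTo ws ⟧ st′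
    copies [] n p f .result s h w with p w
    ... | inj₁ e = trans (h w) e
    copies (w ∷ ws) {st} {st′} n p f =
      then (plain {OR} {st′ = override st w (st′ w)} fresh
             (trans (override-other st w (st′ w) (source w) fresh) (trans src (trans (sym same) (sym newValue))))
             (trans (override-here st w (st′ w)) (sym newValue)) (λ v _ → override-other st w (st′ w) v))
        (copies ws (λ v v′ v∈ v′∈ → n v v′ (there v∈) (there v′∈)) rest (λ v → f v ∘ there))
      where
      fresh : source w ≢ w
      fresh = n w w (here refl) (here refl)
      same : st′ w ≡ st′ (source w)
      same = f w (here refl)
      src : st (source w) ≡ st′ (source w)
      src with p (source w)
      ... | inj₁ e        = e
      ... | inj₂ (s∈ , _) = contradiction refl (n w (source w) (here refl) s∈)
      max2-idem : ∀ a → max2 a a ≡ a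
      max2-idem zero       = refl
      max2-idem (suc zero) = refl
      newValue : max2 (st (source w)) (st w) ≡ st′ w
      newValue with p w
      ... | inj₂ (_ , e) = trans (cong (max2 (st (source w))) e) (trans (max2-zeroʳ _) (trans src (sym same)))
      ... | inj₁ e       = trans (cong₂ max2 (trans src (sym same)) e) (max2-idem (st′ w))
      rest : ∀ v → override st w (st′ w) v ≡ st′ v ⊎ (v ∈ ws × override st w (st′ w) v ≡ zero)
      rest v with v ≟ʷ w
      ... | yes refl = inj₁ refl
      ... | no ne with p v
      ...   | inj₁ e              = inj₁ e
      ...   | inj₂ (here e , _)   = contradiction e ne
      ...   | inj₂ (there v∈ , z) = inj₂ (v∈ , z)

    port≢ : ∀ {w} → w ∈ portWires → (∃ λ j → ∃ λ a → w ≡ inW j a) ⊎ (∃ λ r → ∃ λ a → w ≡ outW r a)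
    port≢ w∈ with ∈-++⁻ (map (λ p → inW (proj₁ p) (proj₂ p)) (cartesianProduct (allFin Δ) (allFin q))) w∈
    ... | inj₁ h with ∈-map⁻ (λ p → inW (proj₁ p) (proj₂ p)) h
    ...   | (j , a) , _ , e = inj₁ (j , a , e)
    port≢ w∈ | inj₂ h with ∈-map⁻ (λ p → outW (proj₁ p) (proj₂ p)) h
    ...   | (r , a) , _ , e = inj₂ (r , a , e)

    inW∈ : ∀ j a → inW j a ∈ portWires
    inW∈ j a = ∈-++⁺ˡ (∈-map⁺ (λ p → inW (proj₁ p) (proj₂ p)) (∈-cartesianProduct⁺ (∈-allFin j) (∈-allFin a)))

    outW∈ : ∀ r a → outW r a ∈ portWires
    outW∈ r a = ∈-++⁺ʳ (map (λ p → inW (proj₁ p) (proj₂ p)) (cartesianProduct (allFin Δ) (allFin q)))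
                  (∈-map⁺ (λ p → outW (proj₁ p) (proj₂ p)) (∈-cartesianProduct⁺ (∈-allFin r) (∈-allFin a)))

    -- The state of a block just before the exchange.
    shared : Fin q → State
    shared a (inW j b)  = hot a b
    shared a (outW r b) = hot a b
    shared a _          = zero

    full : Fin q → State
    full a (main b) = hot a b
    full a w        = shared a w

    before-run : ∀ a → codeword a ⟦ before ⟧ shared a
    before-run a =
      seq (clears (acc ∷ acc ∷ []) (λ { (there (here ())) ; (there (there ())) }) refl refl (λ _ → inj₁ refl)
             (λ { _ (here refl) → refl ; _ (there (here refl)) → refl }))
        (seq (copies portWires sources initially copied)
          (clears mainWires nil∉ refl refl cleared zeros))
      where
      sources : ∀ w w′ → w ∈ portWires → w′ ∈ portWires → source w ≢ w′
      sources w w′ w∈ w′∈ e with port≢ w∈ | port≢ w′∈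
      sources w w′ w∈ w′∈ () | inj₁ (_ , _ , refl) | inj₁ (_ , _ , refl)
      sources w w′ w∈ w′∈ () | inj₁ (_ , _ , refl) | inj₂ (_ , _ , refl)
      sources w w′ w∈ w′∈ () | inj₂ (_ , _ , refl) | inj₁ (_ , _ , refl)
      sources w w′ w∈ w′∈ () | inj₂ (_ , _ , refl) | inj₂ (_ , _ , refl)
      initially : ∀ w → codeword a w ≡ full a w ⊎ (w ∈ portWires × codeword a w ≡ zero)
      initially (main b)   = inj₁ refl
      initially (inW j b)  = inj₂ (inW∈ j b , refl)
      initially (outW r b) = inj₂ (outW∈ r b , refl)
      initially (inj₂ (inj₂ _)) = inj₁ refl
      copied : ∀ w → w ∈ portWires → full a w ≡ full a (source w)
      copied w w∈ with port≢ w∈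
      ... | inj₁ (_ , _ , refl) = refl
      ... | inj₂ (_ , _ , refl) = refl
      nil∉ : nil ∉ mainWires
      nil∉ h with ∈-map⁻ _ h
      ... | _ , _ , ()
      cleared : ∀ w → full a w ≡ shared a w ⊎ w ∈ mainWires
      cleared (main b)   = inj₂ (∈-map⁺ _ (∈-allFin b))
      cleared (inW j b)  = inj₁ refl
      cleared (outW r b) = inj₁ refl
      cleared (inj₂ (inj₂ _)) = inj₁ refl
      zeros : ∀ w → w ∈ mainWires → shared a w ≡ zero
      zeros w w∈ with ∈-map⁻ _ w∈
      ... | _ , _ , refl = refl

    -- Here `y j` is the state present at incoming port `j` after the exchange. The contents `O` of
    -- the outgoing ports are arbitrary: the evaluation does not read them and the end of the
    -- program clears them.
    module After (y : Fin Δ → Fin q) (O : Fin Δ → Fin q → Fin 2) (target : Fin q) where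

      ȳ : Vec (Fin q) Δ
      ȳ = Vec.tabulate y

      mk : (Fin q → Fin 2) → Fin 2 → Fin 2 → State
      mk M a t (main b)   = M b
      mk M a t (inW j b)  = hot (y j) b
      mk M a t (outW r b) = O r b
      mk M a t acc        = a
      mk M a t tmp        = t
      mk M a t nil        = zero

      contra : {P Q : Set} → (P → ⊥) → P → Q
      contra n p = contradiction p n

      mk-same : ∀ {M a a′ t t′} w → (w ≡ acc → a′ ≡ a) → (w ≡ tmp → t′ ≡ t) → mk M a′ t′ w ≡ mk M a t w
      mk-same (main _)   f g = refl
      mk-same (inW _ _)  f g = refl
      mk-same (outW _ _) f g = refl
      mk-same acc        f g = f refl
      mk-same tmp        f g = g refl
      mk-same nil        f g = refl

      load-acc : ∀ {M} j b → mk M zero zero ⟦ gate nothing OR (inW j b) acc ∷ [] ⟧ mk M (hot (y j) b) zero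
      load-acc j b = plain {OR} (λ ()) (sym (max2-zeroʳ _)) (sym (max2-zeroʳ _)) (λ w _ n → mk-same w (contra n) (λ _ → refl))

      load-tmp : ∀ {M a} j b → mk M a zero ⟦ gate nothing OR (inW j b) tmp ∷ [] ⟧ mk M a (hot (y j) b)
      load-tmp j b = plain {OR} (λ ()) (sym (max2-zeroʳ _)) (sym (max2-zeroʳ _)) (λ w _ n → mk-same w (λ _ → refl) (contra n))

      copy-acc : ∀ {M a} → mk M a zero ⟦ gate nothing OR acc tmp ∷ [] ⟧ mk M a a
      copy-acc = plain {OR} (λ ()) (sym (max2-zeroʳ _)) (sym (max2-zeroʳ _)) (λ w n m → mk-same w (contra n) (contra m))

      and-acc : ∀ {M a t} → mk M a t ⟦ gate nothing AND tmp acc ∷ [] ⟧ mk M (min2 t a) (min2 t a)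
      and-acc = plain {AND} (λ ()) refl refl (λ w n m → mk-same w (contra m) (contra n))

      clear-tmp : ∀ {M a t} → mk M a t ⟦ clearW tmp ∷ [] ⟧ mk M a zero
      clear-tmp = plain {AND} (λ ()) (sym (min2-zeroʳ _)) (sym (min2-zeroʳ _)) (λ w n _ → mk-same w (λ _ → refl) (contra n))

      clear-acc : ∀ {M a t} → mk M a t ⟦ clearW acc ∷ [] ⟧ mk M zero t
      clear-acc = plain {AND} (λ ()) (sym (min2-zeroʳ _)) (sym (min2-zeroʳ _)) (λ w n _ → mk-same w (contra n) (λ _ → refl))

      bump : (Fin q → Fin 2) → Fin q → Fin 2 → Fin q → Fin 2
      bump M b t c with c ≟ b
      ... | yes _ = max2 t (M b)
      ... | no _  = M c

      bump-here : ∀ M b t → bump M b t b ≡ max2 t (M b)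
      bump-here M b t with b ≟ b
      ... | yes _ = refl
      ... | no ne = contradiction refl ne

      bump-other : ∀ M b t c → c ≢ b → bump M b t c ≡ M c
      bump-other M b t c ne with c ≟ b
      ... | yes e = contradiction e ne
      ... | no _  = refl

      or-main : ∀ {M a t} g b → γ g ≡ true →
        mk M a t ⟦ gate (just g) OR tmp (main b) ∷ [] ⟧ mk (bump M b t) a (max2 t (M b))
      or-main {M} {t = t} g b e = swapped {OR} {g = just g} (λ ()) (λ w → cong (if_then swap tmp (main b) w else w) e)
        refl (bump-here M b t)
        λ { (main c) _ n → bump-other M b t c (λ { refl → n refl }) ; (inW _ _) _ _ → refl ; (outW _ _) _ _ → refl
          ; acc _ _ → refl ; tmp n _ → contradiction refl n ; nil _ _ → refl }

      idle : ∀ {st} g b → γ g ≡ false → st ⟦ gate (just g) OR tmp (main b) ∷ [] ⟧ st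
      idle g b e .result s h w = trans (go (partnerW (gate (just g) OR tmp (main b)) γ w ≟ʷ w)) (h w)
        where
        go : ∀ d → execAt (gate (just g) OR tmp (main b)) s w (partnerW (gate (just g) OR tmp (main b)) γ w) d ≡ s w
        go (yes _) = refl
        go (no ne) = contradiction (cong (if_then swap tmp (main b) w else w) e) ne

      On : Fin 2 → Set
      On a = a ≡ suc zero

      min2-On : ∀ {a b} → On (min2 a b) → On a × On b
      min2-On {suc zero} e = refl , e

      max2-On : ∀ {a b} → On (max2 a b) → On a ⊎ On b
      max2-On {zero}     e = inj₂ e
      max2-On {suc zero} e = inj₁ refl

      max2-On-right : ∀ {a b} → On b → On (max2 a b)
      max2-On-right {zero}     e = e
      max2-On-right {suc zero} e = refl

      -- The resulting `acc` is described only by when it is 1, as a conjunction in both directions,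
      -- which is all that the evaluation of a tuple needs.
      conjoins : ∀ {M} (τ : Vec (Fin q) Δ) js a → ∃ λ a′ →
        (mk M a zero ⟦ concatMap (λ j → conjoin (suc j) (Vec.lookup τ (suc j))) js ⟧ mk M a′ zero) ×
        (On a′ → On a × All (λ j → On (hot (y (suc j)) (Vec.lookup τ (suc j)))) js) ×
        (On a → All (λ j → On (hot (y (suc j)) (Vec.lookup τ (suc j)))) js → On a′)
      conjoins τ []       a = a , nop , (λ e → e , []) , λ e _ → e
      conjoins τ (j ∷ js) a with conjoins τ js (min2 (hot (y (suc j)) (Vec.lookup τ (suc j))) a)
      ... | a′ , R , to , from = a′ ,
        then (load-tmp (suc j) _) (then and-acc (then clear-tmp R)) ,
        (λ e → let e′ , es = to e ; h , e″ = min2-On e′ in e″ , h ∷ es) ,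
        λ { e (h ∷ hs) → from (trans (cong₂ min2 h e) refl) hs }

      guard : Vec (Fin q) Δ → ℕ × Fin q → Guard
      guard τ (d , b) = d , lexIndex q (take d (Vec.toList τ)) , toℕ b

      Sound : (Fin q → Fin 2) → Set
      Sound M = ∀ b → On (M b) → b ≡ target

      -- By `mono` the one right contribution survives all later terms, and by `sound` no other main
      -- wire is ever switched on. Together they determine the final code without any description of
      -- the states in between.
      record Grown (M M′ : Fin q → Fin 2) : Set where
        field
          mono  : ∀ b → On (M b) → On (M′ b)
          sound : Sound M → Sound M′
      open Grown

      contribution : ∀ {M a} τ p → (γ (guard τ p) ≡ true → On a → proj₂ p ≡ target) → ∃ λ M′ →
        (mk M a zero ⟦ contribute τ p ⟧ mk M′ a zero) × Grown M M′ ×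
        (γ (guard τ p) ≡ true → On a → On (M′ (proj₂ p)))
      contribution {M} {a} τ (d , b) ok with γ (guard τ (d , b)) in e
      ... | false = M , then copy-acc (then (idle (guard τ (d , b)) b e) (then clear-tmp nop)) ,
                    record { mono = λ _ h → h ; sound = λ h → h } , λ ()
      ... | true = bump M b a , then copy-acc (then (or-main (guard τ (d , b)) b e) (then clear-tmp nop)) ,
                   record { mono = mono′ ; sound = sound′ } , λ _ h → trans (bump-here M b a) (cong (λ z → max2 z (M b)) h)
        where
        mono′ : ∀ c → On (M c) → On (bump M b a c)
        mono′ c h with c ≟ b
        ... | yes refl = max2-On-right {a} h
        ... | no _     = h
        sound′ : Sound M → Sound (bump M b a)
        sound′ s c h with c ≟ b
        ... | no _     = s c h
        ... | yes refl with max2-On {a} h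
        ...   | inj₁ on = ok refl on
        ...   | inj₂ on = s c on

      contributions : ∀ {M a} τ ps → (∀ p → γ (guard τ p) ≡ true → On a → proj₂ p ≡ target) → ∃ λ M′ →
        (mk M a zero ⟦ concatMap (contribute τ) ps ⟧ mk M′ a zero) × Grown M M′ ×
        (∀ p → p ∈ ps → γ (guard τ p) ≡ true → On a → On (M′ (proj₂ p)))
      contributions {M} τ []       ok = M , nop , record { mono = λ _ h → h ; sound = λ h → h } , λ _ ()
      contributions τ (p ∷ ps) ok with contribution τ p (ok p)
      ... | M₁ , R₁ , G₁ , on₁ with contributions τ ps ok
      ...   | M₂ , R₂ , G₂ , on₂ = M₂ , seq R₁ R₂ ,
        record { mono = λ b → mono G₂ b ∘ mono G₁ b ; sound = sound G₂ ∘ sound G₁ } ,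
        λ { _ (here refl) g h → mono G₂ _ (on₁ g h) ; p (there p∈) g h → on₂ p p∈ g h }

      module _ (γ-sound : ∀ d b → γ (guard ȳ (d , b)) ≡ true → b ≡ target)
               {deg : ℕ} (deg≤ : deg ≤ Δ) (γ-complete : γ (guard ȳ (deg , target)) ≡ true) where

        -- If `τ` differs from `ȳ`, some literal is 0 and `acc` ends at 0, so nothing is contributed
        -- whatever the guards are. Hence the guards have to be right for `ȳ` alone.
        evaluation : ∀ {M} τ → ∃ λ M′ →
          (mk M zero zero ⟦ evaluate τ ⟧ mk M′ zero zero) × Grown M M′ × (τ ≡ ȳ → On (M′ target))
        evaluation {M} τ with conjoins {M} τ (allFin Δ′) (hot (y zero) (Vec.lookup τ zero))
        ... | a , R₁ , to , from with contributions {M} {a} τ (cartesianProduct (upTo (suc Δ)) (allFin q)) sound-τ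
          where
          lookup-ext : ∀ {k} (u v : Vec (Fin q) k) → (∀ i → Vec.lookup u i ≡ Vec.lookup v i) → u ≡ v
          lookup-ext []      []      h = refl
          lookup-ext (_ ∷ u) (_ ∷ v) h = cong₂ _∷_ (h zero) (lookup-ext u v (h ∘ suc))
          τ≡ȳ : On a → τ ≡ ȳ
          τ≡ȳ e = lookup-ext τ ȳ λ { zero    → sym (hot-1 (proj₁ (to e)))
                                   ; (suc j) → trans (sym (hot-1 (All.lookup (proj₂ (to e)) (∈-allFin j)))) (sym (lookup∘tabulate y (suc j))) }
          sound-τ : ∀ p → γ (guard τ p) ≡ true → On a → proj₂ p ≡ target
          sound-τ (d , b) g e = γ-sound d b (subst (λ z → γ (guard z (d , b)) ≡ true) (τ≡ȳ e) g)
        ...   | M′ , R₂ , G , on = M′ , then (load-acc zero _) (seq R₁ (seq R₂ clear-acc)) , G ,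
          λ { refl → on (deg , target) (∈-cartesianProduct⁺ (∈-upTo⁺ (s≤s deg≤)) (∈-allFin target)) γ-complete
                (from (hot-refl (y zero)) (All.tabulate λ {j} _ → trans (cong (hot (y (suc j))) (lookup∘tabulate y (suc j))) (hot-refl (y (suc j))))) }

        evaluations : ∀ {M} τs → ∃ λ M′ →
          (mk M zero zero ⟦ concatMap evaluate τs ⟧ mk M′ zero zero) × Grown M M′ × (ȳ ∈ τs → On (M′ target))
        evaluations {M} [] = M , nop , record { mono = λ _ h → h ; sound = λ h → h } , λ ()
        evaluations (τ ∷ τs) with evaluation τ
        ... | M₁ , R₁ , G₁ , on₁ with evaluations τs
        ...   | M₂ , R₂ , G₂ , on₂ = M₂ , seq R₁ R₂ ,
          record { mono = λ b → mono G₂ b ∘ mono G₁ b ; sound = sound G₂ ∘ sound G₁ } ,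
          λ { (here refl) → mono G₂ _ (on₁ refl) ; (there h) → on₂ h }

        after-run : mk (λ _ → zero) zero zero ⟦ after ⟧ codeword target
        after-run with evaluations {λ _ → zero} (tuples Δ)
        ... | M , R , G , on = seq R (clears portWires nil∉ refl refl cleared zeros)
          where
          nil∉ : nil ∉ portWires
          nil∉ h with port≢ h
          ... | inj₁ (_ , _ , ())
          ... | inj₂ (_ , _ , ())
          M-hot : ∀ b → M b ≡ hot target b
          M-hot b with target ≟ b
          ... | yes refl = on (tuples-complete ȳ)
          ... | no ne with M b in e
          ...   | zero     = refl
          ...   | suc zero = contradiction (sym (sound G (λ _ ()) b e)) ne
          cleared : ∀ w → mk M zero zero w ≡ codeword target w ⊎ w ∈ portWires
          cleared (main b)   = inj₁ (M-hot b)
          cleared (inW j b)  = inj₂ (inW∈ j b)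
          cleared (outW r b) = inj₂ (outW∈ r b)
          cleared acc        = inj₁ refl
          cleared tmp        = inj₁ refl
          cleared nil        = inj₁ refl
          zeros : ∀ w → w ∈ portWires → codeword target w ≡ zero
          zeros w w∈ with port≢ w∈
          ... | inj₁ (_ , _ , refl) = refl
          ... | inj₂ (_ , _ , refl) = refl

-- The simulating network

lookupℕ-tabulate : {A : Set} {n : ℕ} (f : Fin n → A) (v : Fin n) → lookupℕ (tabulate f) (toℕ v) ≡ just (f v)
lookupℕ-tabulate f zero    = refl
lookupℕ-tabulate f (suc v) = lookupℕ-tabulate (f ∘ suc) v

lookupℕ-map : {A B : Set} (f : A → B) (xs : List A) (k : ℕ) → lookupℕ (map f xs) k ≡ Maybe.map f (lookupℕ xs k)
lookupℕ-map f []       k       = refl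
lookupℕ-map f (x ∷ xs) zero    = refl
lookupℕ-map f (x ∷ xs) (suc k) = lookupℕ-map f xs k

lookupℕ⇒∈ : {A : Set} (xs : List A) (k : ℕ) {x : A} → lookupℕ xs k ≡ just x → x ∈ xs
lookupℕ⇒∈ (x ∷ xs) zero    refl = here refl
lookupℕ⇒∈ (x ∷ xs) (suc k) e    = there (lookupℕ⇒∈ xs k e)

∈⇒lookupℕ : {A : Set} {xs : List A} {x : A} → x ∈ xs → ∃ λ k → k < length xs × lookupℕ xs k ≡ just x
∈⇒lookupℕ (here refl) = 0 , s≤s z≤n , refl
∈⇒lookupℕ (there x∈) with ∈⇒lookupℕ x∈
... | k , k< , e = suc k , s≤s k< , e

lookupℕ-unique : {A : Set} {xs : List A} → Unique xs → ∀ j k {x} → lookupℕ xs j ≡ just x → lookupℕ xs k ≡ just x → j ≡ k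
lookupℕ-unique {xs = x ∷ xs} (n ∷ u) zero    zero    e f = refl
lookupℕ-unique {xs = x ∷ xs} (n ∷ u) zero    (suc k) refl f = contradiction refl (All.lookup n (lookupℕ⇒∈ xs k f))
lookupℕ-unique {xs = x ∷ xs} (n ∷ u) (suc j) zero    e refl = contradiction refl (All.lookup n (lookupℕ⇒∈ xs j e))
lookupℕ-unique {xs = x ∷ xs} (n ∷ u) (suc j) (suc k) e f = cong suc (lookupℕ-unique u j k e f)

Unique-map : {A B : Set} (f : A → B) {xs : List A} → (∀ {x y} → x ∈ xs → y ∈ xs → f x ≡ f y → x ≡ y) →
  Unique xs → Unique (map f xs)
Unique-map f inj [] = []
Unique-map f inj (n ∷ u) =
  All.map⁺ (All.tabulate λ {y} y∈ e → All.lookup n y∈ (inj (here refl) (there y∈) e)) ∷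
  Unique-map f (λ x∈ y∈ → inj (there x∈) (there y∈)) u

firstIndex : {A : Set} → (A → Bool) → List A → ℕ
firstIndex p []       = 0
firstIndex p (x ∷ xs) = if p x then 0 else suc (firstIndex p xs)

firstIndex-lookup : {A : Set} (p : A → Bool) {x : A} (xs : List A) (k : ℕ) → p x ≡ true → (∀ y → p y ≡ true → y ≡ x) →
  Unique xs → lookupℕ xs k ≡ just x → firstIndex p xs ≡ k
firstIndex-lookup p (y ∷ xs) zero px only u refl rewrite px = refl
firstIndex-lookup p (y ∷ xs) (suc k) px only (n ∷ u) e with p y in py
... | true  = contradiction (only y py) (All.lookup n (lookupℕ⇒∈ xs k e))
... | false = cong suc (firstIndex-lookup p xs k px only u e)

prev : ∀ {k} → Fin (suc k) → Fin (suc k)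
prev {k} zero = fromℕ k
prev (suc t)  = inject₁ t

next : ∀ {k} → Fin (suc k) → Fin (suc k)
next {k} t with k ℕ.≟ toℕ t
... | yes _ = zero
... | no ne = suc (lower₁ t ne)

prev-next : ∀ {k} (t : Fin (suc k)) → prev (next t) ≡ t
prev-next {k} t with k ℕ.≟ toℕ t
... | yes e = toℕ-injective (trans (toℕ-fromℕ k) e)
... | no ne = inject₁-lower₁ t ne

next-prev : ∀ {k} (t : Fin (suc k)) → next (prev t) ≡ t
next-prev {k} zero with k ℕ.≟ toℕ (fromℕ k)
... | yes _ = refl
... | no ne = contradiction (sym (toℕ-fromℕ k)) ne
next-prev {k} (suc t) with k ℕ.≟ toℕ (inject₁ t)
... | yes e = contradiction (trans e (toℕ-inject₁ t)) (λ e → <⇒≢ (toℕ<n t) (sym e))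
... | no ne = cong suc (lower₁-inject₁′ t ne)

-- Two layers are needed, since on a cycle of length 1 the only layer precedes itself.
prev≢ : ∀ {k} (t : Fin (suc (suc k))) → prev t ≢ t
prev≢ zero    ()
prev≢ (suc t) e = <⇒≢ (≤-reflexive refl) (trans (sym (toℕ-inject₁ t)) (cong toℕ e))

entryOf : ∀ {q n} → NetRep q n → Fin n → Entry
entryOf R v = map toℕ (nbrs R v) , map toℕ (table R v)

entries : ∀ {q n} → NetRep q n → List Entry
entries R = tabulate (entryOf R)

module Construction (q Δ′ : ℕ) where

  open Block q Δ′

  prog₁ : List Instr
  prog₁ = (map copyTo portWires ++ map clearW mainWires) ++ exchange ∷ after

  L : ℕ
  L = suc (length prog₁)

  T : ℕ
  T = suc L

  instr : Fin T → Instr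
  instr = lookup program

  size : ℕ
  size = T * width

  patN : Fin q → Fin T × Wire → Fin 2
  patN a (zero  , w) = codeword a w
  patN a (suc _ , w) = zero

  module Net {n : ℕ} (R : NetRep q n) (bounded : DegreeBound Δ R) (unique : ∀ v → Unique (nbrs R v)) where

    -- Defined on the list of entries that the machine reads, so that the result of `checkC` is this
    -- guard by computation.
    γ : Fin n → Guard → Bool
    γ v (d , idx , b) = matches (entries R) (toℕ v) d idx b

    Hit : Fin n → Fin n × Fin Δ → Set
    Hit u (v , j) = lookupℕ (nbrs R v) (toℕ j) ≡ just u

    hit? : ∀ u p → Dec (Hit u p)
    hit? u (v , j) = Maybe.≡-dec _≟_ (lookupℕ (nbrs R v) (toℕ j)) (just u)

    -- The edges leaving u, as pairs of an endpoint and a position in its list of neighbours.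
    edges : Fin n → List (Fin n × Fin Δ)
    edges u = filter (hit? u) (cartesianProduct (allFin n) (allFin Δ))

    edges-unique : ∀ u → Unique (edges u)
    edges-unique u = filter⁺ (hit? u) (cartesianProduct⁺ (allFin⁺ n) (allFin⁺ Δ))

    edges-hit : ∀ {u p} → p ∈ edges u → Hit u p
    edges-hit {u} p∈ = proj₂ (∈-filter⁻ (hit? u) {xs = cartesianProduct (allFin n) (allFin Δ)} p∈)

    hit-edges : ∀ {u v j} → Hit u (v , j) → (v , j) ∈ edges u
    hit-edges {u} {v} {j} h = ∈-filter⁺ (hit? u) (∈-cartesianProduct⁺ (∈-allFin v) (∈-allFin j)) h

    -- A neighbour list has no repetitions, so distinct edges leaving `u` have distinct endpoints,
    -- and these endpoints are what the degree bound counts.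
    edges-length : ∀ u → length (edges u) ≤ Δ
    edges-length u = subst (_≤ Δ) (length-map proj₁ (edges u))
      (proj₂ bounded u (map proj₁ (edges u)) (Unique-map proj₁ same (edges-unique u))
        (All.map⁺ (All.tabulate λ { {v , j} p∈ → lookupℕ⇒∈ (nbrs R v) (toℕ j) (edges-hit p∈) })))
      where
      same : ∀ {x y} → x ∈ edges u → y ∈ edges u → proj₁ x ≡ proj₁ y → x ≡ y
      same {v , j} {.v , k} x∈ y∈ refl =
        cong (v ,_) (toℕ-injective (lookupℕ-unique (unique v) (toℕ j) (toℕ k) (edges-hit x∈) (edges-hit y∈)))

    -- Shaped like the test of the machine: endpoints are compared as numbers in registers,
    -- positions in the control.
    isEdge : Fin n → Fin Δ → Fin n × Fin Δ → Bool
    isEdge v j (v′ , j′) = (toℕ v′ ≡ᵇ toℕ v) ∧ does (j′ ≟ j)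

    isEdge-refl : ∀ v j → isEdge v j (v , j) ≡ true
    isEdge-refl v j rewrite ≡ᵇ-refl (toℕ v) with j ≟ j
    ... | yes _ = refl
    ... | no ne = contradiction refl ne

    isEdge-sound : ∀ v j p → isEdge v j p ≡ true → p ≡ (v , j)
    isEdge-sound v j (v′ , j′) e with toℕ v′ ≡ᵇ toℕ v in ev | j′ ≟ j
    isEdge-sound v j (v′ , j′) e | true | yes refl =
      cong (_, j) (toℕ-injective (≡ᵇ⇒≡ (toℕ v′) (toℕ v) (subst Bool.T (sym ev) _)))

    -- For an edge that leaves `u` the index is below Δ by `edges-length`, so `clamp` does not
    -- change it.
    rank : Fin n → Fin n → Fin Δ → Fin Δ
    rank u v j = clamp Δ′ (firstIndex (isEdge v j) (edges u))

    rank-lookup : ∀ {u v j} k → lookupℕ (edges u) k ≡ just (v , j) → toℕ (rank u v j) ≡ k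
    rank-lookup {u} {v} {j} k e = trans (cong (toℕ ∘ clamp Δ′) first) (toℕ-clamp (≤-pred (≤-trans (lookupℕ⇒< (edges u) k e) (edges-length u))))
      where
      first : firstIndex (isEdge v j) (edges u) ≡ k
      first = firstIndex-lookup (isEdge v j) (edges u) k (isEdge-refl v j) (isEdge-sound v j) (edges-unique u) e
      lookupℕ⇒< : {A : Set} (xs : List A) (k : ℕ) {x : A} → lookupℕ xs k ≡ just x → k < length xs
      lookupℕ⇒< (x ∷ xs) zero    e = s≤s z≤n
      lookupℕ⇒< (x ∷ xs) (suc k) e = s≤s (lookupℕ⇒< xs k e)

    lookup-rank : ∀ {u v j} → Hit u (v , j) → lookupℕ (edges u) (toℕ (rank u v j)) ≡ just (v , j)
    lookup-rank {u} h with ∈⇒lookupℕ (hit-edges h)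
    ... | k , _ , e = trans (cong (lookupℕ (edges u)) (rank-lookup k e)) e

    -- Swaps incoming port j of v with outgoing port r of u if the edge (v , j) has rank r at u.
    σ : Fin n × Wire → Fin n × Wire
    σ (v , inW j a)  = maybe (λ u → u , outW (rank u v j) a) (v , inW j a) (lookupℕ (nbrs R v) (toℕ j))
    σ (u , outW r a) = maybe (λ { (v , j) → v , inW j a }) (u , outW r a) (lookupℕ (edges u) (toℕ r))
    σ (v , w)        = v , w

    σ-involutive : ∀ p → σ (σ p) ≡ p
    σ-involutive (v , main a) = refl
    σ-involutive (v , inj₂ (inj₂ _)) = refl
    σ-involutive (v , inW j a) with lookupℕ (nbrs R v) (toℕ j) in e
    ... | nothing rewrite e = refl
    ... | just u  rewrite lookup-rank {u} {v} {j} e = refl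
    σ-involutive (u , outW r a) with lookupℕ (edges u) (toℕ r) in e
    ... | nothing rewrite e = refl
    ... | just (v , j) rewrite edges-hit {u} {v , j} (lookupℕ⇒∈ (edges u) (toℕ r) e) =
      cong (λ z → u , outW z a) (toℕ-injective (rank-lookup (toℕ r) e))

    route : Instr → Fin n × Wire → Fin n × Wire
    route exchange p = σ p
    route (gate _ _ _ _) p = p

    route-involutive : ∀ I p → route I (route I p) ≡ p
    route-involutive exchange p = σ-involutive p
    route-involutive (gate _ _ _ _) p = refl

    Node : Set
    Node = Fin n × Fin T × Wire

    abstract
      nodes : Fin (n * size) ↔ Node
      nodes = ↔-trans *↔× (↔-refl ×-↔ ↔-trans *↔× (↔-refl ×-↔ wires))

      index : Node → Fin (n * size)
      index = Inverse.from nodes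

      node′ : Fin (n * size) → Node
      node′ = Inverse.to nodes

      node-index : ∀ p → node′ (index p) ≡ p
      node-index = Inverse.strictlyInverseˡ nodes

      index-node : ∀ u → index (node′ u) ≡ u
      index-node = Inverse.strictlyInverseʳ nodes

      index-combine : ∀ v t i → index (v , t , Inverse.to wires i) ≡ combine v (combine t i)
      index-combine v t i = cong (λ z → combine v (combine t z)) (Inverse.strictlyInverseʳ wires i)

      -- Mixed radix with the node as leading digit: slope `size` in `toℕ v` and an offset fixed by
      -- the cell, which is the form that `emitAffine` prints.
      toℕ-index : ∀ v t w → toℕ (index (v , t , w)) ≡ size * toℕ v + (width * toℕ t + toℕ (Inverse.from wires w))
      toℕ-index v t w = trans (toℕ-combine v _) (cong (size * toℕ v +_) (toℕ-combine t (Inverse.from wires w)))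

    place : Fin T → Fin n × Wire → Node
    place t (v , w) = v , t , w

    -- Instruction `s` sits between layer `s` and the next one in cyclic order, so the gate with its
    -- outputs in layer `t` is given by `instr (prev t)`.
    preN postN partnerN : Node → Node
    preN (v , t , w)     = place (prev t) (route (instr (prev t)) (v , w))
    postN (v , t , w)    = place (next t) (route (instr t) (v , w))
    partnerN (v , t , w) = v , t , partnerW (instr (prev t)) (γ v) w

    pre-postN : ∀ p → preN (postN p) ≡ p
    pre-postN (v , t , w) rewrite prev-next t = cong (place t) (route-involutive (instr t) (v , w))

    post-preN : ∀ p → postN (preN p) ≡ p
    post-preN (v , t , w) = trans (cong (place (next (prev t))) (route-involutive (instr (prev t)) (v , w)))
                              (cong (λ s → v , s , w) (next-prev t))

    kindN : Node → GateKind
    kindN (_ , t , _) = instrKind (instr (prev t))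

    conj : (Node → Node) → Fin (n * size) → Fin (n * size)
    conj f u = index (f (node′ u))

    conj-inverse : ∀ f g → (∀ p → f (g p) ≡ p) → ∀ u → conj f (conj g u) ≡ u
    conj-inverse f g h u = trans (cong (index ∘ f) (node-index (g (node′ u)))) (trans (cong index (h (node′ u))) (index-node u))

    conj-injective : ∀ f g u → conj f u ≡ conj g u → f (node′ u) ≡ g (node′ u)
    conj-injective f g u e = trans (sym (node-index _)) (trans (cong node′ e) (node-index _))

    partnerN-involutive : ∀ p → partnerN (partnerN p) ≡ p
    partnerN-involutive (v , t , w) = cong (λ z → v , t , z) (partnerW-involutive (instr (prev t)) (γ v) w)

    kindN-partner : ∀ u → kindN (node′ (conj partnerN u)) ≡ kindN (node′ u)
    kindN-partner u = cong kindN (node-index (partnerN (node′ u)))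

    layerOf : Node → Fin T
    layerOf (_ , t , _) = t

    preN≢ : ∀ u → conj preN u ≢ u
    preN≢ u e = prev≢ (layerOf (node′ u)) (cong layerOf (conj-injective preN (λ p → p) u (trans e (sym (index-node u)))))

    preN≢partner : ∀ u → conj preN u ≢ conj partnerN u
    preN≢partner u e = prev≢ (layerOf (node′ u)) (cong layerOf (conj-injective preN partnerN u e))

    open Paired (conj preN) (conj postN) (conj partnerN) (kindN ∘ node′)
      (conj-inverse preN postN pre-postN) (conj-inverse postN preN post-preN)
      (conj-inverse partnerN partnerN partnerN-involutive) kindN-partner preN≢ preN≢partner public

    emb : BlockEmb q n (n * size)
    emb .blk u   = proj₁ (node′ u)
    emb .pat a u = patN a (proj₂ (node′ u))

    emb-valid : IsBlockEmb emb
    -- A `nil` wire shows that the block is nonempty, since there are no main wires when `q` is 0.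
    emb-valid = (λ i → index (i , zero , nil) , cong proj₁ (node-index (i , zero , nil))) , injective
      where
      injective : ∀ i a b → (∀ u → blk emb u ≡ i → pat emb a u ≡ pat emb b u) → a ≡ b
      injective i a b h = sym (hot-1 (trans (sym at-b) (trans (sym (h u (cong proj₁ (node-index _)))) at-a)))
        where
        u = index (i , zero , main a)
        at-a : pat emb a u ≡ suc zero
        at-a = trans (cong (patN a ∘ proj₂) (node-index (i , zero , main a))) (hot-refl a)
        at-b : pat emb b u ≡ hot b a
        at-b = cong (patN b ∘ proj₂) (node-index (i , zero , main a))

    -- One turn through the layers

    layerN : ℕ → (Fin n → State) → Node → Fin 2
    layerN s X (v , t , w) = if toℕ t ≡ᵇ s then X v w else zero

    layer : ℕ → (Fin n → State) → Fin (n * size) → Fin 2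
    layer s X u = layerN s X (node′ u)

    routed : Instr → (Fin n → State) → Fin n → State
    routed I X v w = uncurry X (route I (v , w))

    stepX : Instr → (Fin n → State) → Fin n → State
    stepX I X v = exec (γ v) I (routed I X v)

    conj-index : ∀ f p → conj f (index p) ≡ index (f p)
    conj-index f p = cong (index ∘ f) (node-index p)

    fixed⁺ : ∀ v t w → partnerW (instr (prev t)) (γ v) w ≡ w → conj partnerN (index (v , t , w)) ≡ index (v , t , w)
    fixed⁺ v t w e = trans (conj-index partnerN (v , t , w)) (cong (λ z → index (v , t , z)) e)

    fixed⁻ : ∀ v t w → conj partnerN (index (v , t , w)) ≡ index (v , t , w) → partnerW (instr (prev t)) (γ v) w ≡ w
    fixed⁻ v t w e = cong (proj₂ ∘ proj₂) (trans (sym (node-index (partnerN (v , t , w))))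
      (trans (cong node′ (trans (sym (conj-index partnerN (v , t , w))) e)) (node-index (v , t , w))))

    -- Two decisions meet: the network compares node numbers, the block program compares wires.
    -- `fixed⁺` and `fixed⁻` rule out that they disagree.
    net-exec : ∀ y v t w → net y (index (v , t , w)) ≡
      exec (γ v) (instr (prev t)) (λ w → y (index (preN (v , t , w)))) w
    net-exec y v t w = go (conj partnerN u ≟ u) (partnerW I (γ v) w ≟ʷ w)
      where
      u = index (v , t , w)
      I = instr (prev t)
      go : ∀ d d′ → netAt y u d ≡ execAt I (λ w → y (index (preN (v , t , w)))) w (partnerW I (γ v) w) d′
      go (yes _) (yes _) = cong y (conj-index preN (v , t , w))
      go (no ne) (yes e) = contradiction (fixed⁺ v t w e) ne
      go (yes e) (no ne) = contradiction (fixed⁻ v t w e) ne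
      go (no _) (no _) = cong₃ (λ k a b → apply2 k (y a) (y b)) (cong kindN (node-index (v , t , w))) (conj-index preN (v , t , w))
        (trans (cong (conj preN) (conj-index partnerN (v , t , w))) (conj-index preN (partnerN (v , t , w))))
        where
        cong₃ : ∀ {A B C D : Set} (f : A → B → C → D) {a a′ b b′ c c′} → a ≡ a′ → b ≡ b′ → c ≡ c′ → f a b c ≡ f a′ b′ c′
        cong₃ f refl refl refl = refl

    exec-zero : ∀ γ I st → (∀ w → st w ≡ zero) → ∀ w → exec γ I st w ≡ zero
    exec-zero γ I st h w with partnerW I γ w ≟ʷ w
    ... | yes _ = h w
    ... | no _  = trans (cong₂ (apply2 (instrKind I)) (h w) (h _)) (apply2-zero (instrKind I))

    lookup-lookupℕ : {A : Set} (xs : List A) (i : Fin (length xs)) → lookupℕ xs (toℕ i) ≡ just (lookup xs i)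
    lookup-lookupℕ (x ∷ xs) zero    = refl
    lookup-lookupℕ (x ∷ xs) (suc i) = lookup-lookupℕ xs i

    net-layer : ∀ s I X → lookupℕ program s ≡ just I → ∀ v t w →
      net (layer s X) (index (v , t , w)) ≡ (if toℕ (prev t) ≡ᵇ s then stepX I X v w else zero)
    net-layer s I X e v t w = trans (net-exec (layer s X) v t w) (go (toℕ (prev t) ℕ.≟ s))
      where
      read : ∀ w → layer s X (index (preN (v , t , w))) ≡
        (if toℕ (prev t) ≡ᵇ s then routed (instr (prev t)) X v w else zero)
      read w = cong (layerN s X) (node-index (preN (v , t , w)))
      go : Dec (toℕ (prev t) ≡ s) → exec (γ v) (instr (prev t)) (λ w → layer s X (index (preN (v , t , w)))) w ≡
        (if toℕ (prev t) ≡ᵇ s then stepX I X v w else zero)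
      go (yes refl) with trans (sym (lookup-lookupℕ program (prev t))) e
      ... | refl = trans (exec-cong (γ v) I (λ w → trans (read w) (cong (if_then routed I X v w else zero) (≡ᵇ-refl s))) w)
                         (sym (cong (if_then stepX I X v w else zero) (≡ᵇ-refl s)))
      go (no ne) = trans (exec-zero (γ v) (instr (prev t)) _ (λ w → trans (read w) (cong (if_then routed (instr (prev t)) X v w else zero) (≢⇒≡ᵇ ne))) w)
                         (sym (cong (if_then stepX I X v w else zero) (≢⇒≡ᵇ ne)))

    layer-ext : ∀ y s X → (∀ v t w → y (index (v , t , w)) ≡ (if toℕ t ≡ᵇ s then X v w else zero)) → y ≗ layer s X
    layer-ext y s X h u = trans (cong y (sym (index-node u))) (h _ _ _)

    net-next : ∀ s I X → lookupℕ program s ≡ just I → s < L → net (layer s X) ≗ layer (suc s) (stepX I X)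
    net-next s I X e s<L = layer-ext _ (suc s) (stepX I X) λ v t w →
      trans (net-layer s I X e v t w) (cong (if_then stepX I X v w else zero) (shift t))
      where
      shift : ∀ t → (toℕ (prev {L} t) ≡ᵇ s) ≡ (toℕ t ≡ᵇ suc s)
      -- Layer 0 is fed by layer `L`, which `s < L` keeps apart from the active layer.
      shift zero    = ≢⇒≡ᵇ (λ e → <⇒≢ s<L (trans (sym e) (toℕ-fromℕ L)))
      shift (suc t) = cong (_≡ᵇ s) (toℕ-inject₁ t)

    net-last : ∀ I X → lookupℕ program L ≡ just I → net (layer L X) ≗ layer 0 (stepX I X)
    net-last I X e = layer-ext _ 0 (stepX I X) λ v t w →
      trans (net-layer L I X e v t w) (cong (if_then stepX I X v w else zero) (shift t))
      where
      shift : ∀ t → (toℕ (prev {L} t) ≡ᵇ L) ≡ (toℕ t ≡ᵇ 0)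
      shift zero    = trans (cong (_≡ᵇ L) (toℕ-fromℕ L)) (≡ᵇ-refl L)
      shift (suc t) = trans (cong (_≡ᵇ L) (toℕ-inject₁ t)) (≢⇒≡ᵇ (<⇒≢ (toℕ<n t)))

    stepsX : List Instr → (Fin n → State) → Fin n → State
    stepsX []       X = X
    stepsX (I ∷ Is) X = stepsX Is (stepX I X)

    iter-cong : ∀ k {x y} → x ≗ y → iter k net x ≗ iter k net y
    iter-cong zero    h = h
    iter-cong (suc k) h = net-cong (iter-cong k h)

    program-lookup : ∀ I Is done → program ≡ done ++ I ∷ Is → lookupℕ program (length done) ≡ just I
    program-lookup I Is done e = trans (cong (λ z → lookupℕ z (length done)) e) (go done)
      where
      go : ∀ done → lookupℕ (done ++ I ∷ Is) (length done) ≡ just I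
      go []         = refl
      go (_ ∷ done) = go done

    -- Induction on the instructions still to come; the number of those done is the index of the
    -- active layer. The last instruction wraps around to layer 0, where the embedding expects the
    -- code.
    iter-layers : ∀ I Is done X → program ≡ done ++ I ∷ Is →
      iter (suc (length Is)) net (layer (length done) X) ≗ layer 0 (stepsX (I ∷ Is) X)
    iter-layers I [] done X e =
      subst (λ s → net (layer s X) ≗ layer 0 (stepX I X)) (sym len)
        (net-last I X (subst (λ s → lookupℕ program s ≡ just I) len (program-lookup I [] done e)))
      where
      len : length done ≡ L
      len = suc-injective (sym (trans (cong length e) (trans (length-++ done) (trans (+-suc _ 0) (cong suc (+-identityʳ _))))))
    iter-layers I (J ∷ Js) done X e u =
      trans (cong (λ z → z u) (iter-suc (suc (length Js)) net (layer (length done) X)))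
      (trans (iter-cong (suc (length Js)) (λ u → trans (net-next (length done) I X (program-lookup I (J ∷ Js) done e) shorter u) (cong (λ s → layer s (stepX I X) u) (sym len))) u)
        (iter-layers J Js (done ++ I ∷ []) (stepX I X) (trans e (sym (++-assoc done (I ∷ []) (J ∷ Js)))) u))
      where
      len : length (done ++ I ∷ []) ≡ suc (length done)
      len = trans (length-++ done) (trans (+-suc _ 0) (cong suc (+-identityʳ _)))
      shorter : length done < L
      shorter = ≤-pred (subst (suc (length done) <_) (sym (trans (cong length e) (trans (length-++ done) (+-suc (length done) (suc (length Js))))))
                 (s≤s (m<m+n (length done) (s≤s z≤n))))

    data IsGate : Instr → Set where
      isGate : ∀ {g k i j} → IsGate (gate g k i j)

    -- Gates stay within a block, so between exchanges every block can be executed on its own.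
    stepsX-gates : ∀ Is Js X → All IsGate Is → stepsX (Is ++ Js) X ≡ stepsX Js (λ v → execs (γ v) Is (X v))
    stepsX-gates []       Js X []            = refl
    stepsX-gates (I ∷ Is) Js X (isGate ∷ gs) = stepsX-gates Is Js _ gs

    before-gates : All IsGate before
    before-gates = isGate ∷ isGate ∷ All.++⁺ (All.map⁺ (All.universal (λ _ → isGate) portWires)) (All.map⁺ (All.universal (λ _ → isGate) mainWires))

    after-gates : All IsGate after
    after-gates = All.++⁺
      (All.concat⁺ (All.map⁺ (All.universal (λ τ → isGate ∷ All.++⁺
          (All.concat⁺ (All.map⁺ (All.universal (λ _ → isGate ∷ isGate ∷ isGate ∷ []) (allFin Δ′))))
          (All.++⁺ (All.concat⁺ (All.map⁺ (All.universal (λ _ → isGate ∷ isGate ∷ isGate ∷ []) (cartesianProduct (upTo (suc Δ)) (allFin q)))))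
            (isGate ∷ []))) (tuples Δ))))
      (All.map⁺ (All.universal (λ _ → isGate) portWires))

    embed-layer : ∀ x → embed emb x ≗ layer 0 (λ v → codeword (x v))
    embed-layer x u with node′ u
    ... | v , zero  , w = refl
    ... | v , suc t , w = refl

    exchanged : ∀ X v → stepX exchange X v ≗ routed exchange X v
    exchanged X v w with w ≟ʷ w
    ... | yes _ = refl
    ... | no ne = contradiction refl ne

    lookupℕ-entries : ∀ v → lookupℕ (entries R) (toℕ v) ≡ just (entryOf R v)
    lookupℕ-entries v = lookupℕ-tabulate (entryOf R) v

    γ-eval : ∀ v d idx b → γ v (d , idx , b) ≡ (length (nbrs R v) ≡ᵇ d) ∧ maybe (λ c → toℕ c ≡ᵇ b) false (lookupℕ (table R v) idx)
    γ-eval v d idx b = trans (cong (maybe (λ e → (length (proj₁ e) ≡ᵇ d) ∧ has (proj₂ e) idx b) false) (lookupℕ-entries v))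
      (cong₂ _∧_ (cong (_≡ᵇ d) (length-map toℕ (nbrs R v)))
        (trans (cong (maybe (_≡ᵇ b) false) (lookupℕ-map toℕ (table R v) idx)) (maybe-map (lookupℕ (table R v) idx))))
      where
      maybe-map : ∀ m → maybe (_≡ᵇ b) false (Maybe.map toℕ m) ≡ maybe (λ c → toℕ c ≡ᵇ b) false m
      maybe-map nothing  = refl
      maybe-map (just _) = refl

    -- Correctness of one simulated step

    module _ (H : Network q n) (values : ∀ x v → lookupℕ (table R v) (lexIndex q (map x (nbrs R v))) ≡ just (H x v)) where

      module Step (x : Fin n → Fin q) (v : Fin n) where

        open Execution (γ v)

        X₁ : Fin n → State
        X₁ v = execs (γ v) before (codeword (x v))

        X₁-shared : ∀ v → X₁ v ≗ Execution.shared (γ v) (x v)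
        X₁-shared v = Execution.result (Execution.before-run (γ v) (x v)) _ (λ _ → refl)

        -- An incoming port without an edge is fixed by the exchange and keeps the copy of the
        -- node's own state, hence the default `x v`.
        y : Fin Δ → Fin q
        y j = maybe x (x v) (lookupℕ (nbrs R v) (toℕ j))

        open After y (λ r b → routed exchange X₁ v (outW r b)) (H x v)

        received : stepX exchange X₁ v ≗ mk (λ _ → zero) zero zero
        received w = trans (exchanged X₁ v w) (go w)
          where
          go : ∀ w → routed exchange X₁ v w ≡ mk (λ _ → zero) zero zero w
          go (main b)   = X₁-shared v (main b)
          go (outW r b) = refl
          go acc        = X₁-shared v acc
          go tmp        = X₁-shared v tmp
          go nil        = X₁-shared v nil
          go (inW j b) with lookupℕ (nbrs R v) (toℕ j)
          ... | nothing = X₁-shared v (inW j b)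
          ... | just u  = X₁-shared u (outW (rank u v j) b)

        take-tabulate : ∀ {k} (l : List (Fin n)) (z : Fin k → Fin q) → length l ≤ k →
          (∀ j → z j ≡ maybe x (x v) (lookupℕ l (toℕ j))) → take (length l) (Vec.toList (Vec.tabulate z)) ≡ map x l
        take-tabulate []      z h e = refl
        take-tabulate {suc k} (u ∷ l) z (s≤s h) e = cong₂ _∷_ (e zero) (take-tabulate l (z ∘ suc) h (e ∘ suc))

        inputs : take (length (nbrs R v)) (Vec.toList ȳ) ≡ map x (nbrs R v)
        inputs = take-tabulate (nbrs R v) y (proj₁ bounded v) (λ _ → refl)

        table-value : lookupℕ (table R v) (lexIndex q (take (length (nbrs R v)) (Vec.toList ȳ))) ≡ just (H x v)
        table-value = trans (cong (lookupℕ (table R v) ∘ lexIndex q) inputs) (values x v)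

        -- A guard for another in-degree fails its first test. For the right one, the index formed
        -- from the received states is that of the true inputs, where the table has the single value
        -- `H x v`.
        γ-sound : ∀ d b → γ v (guard ȳ (d , b)) ≡ true → b ≡ H x v
        γ-sound d b e with length (nbrs R v) ℕ.≟ d
        ... | yes refl = toℕ-injective (sym (≡ᵇ⇒≡ (toℕ (H x v)) (toℕ b) (subst Bool.T (sym eq) _)))
          where
          eq : (toℕ (H x v) ≡ᵇ toℕ b) ≡ true
          eq = trans (sym (cong₂ _∧_ (≡ᵇ-refl (length (nbrs R v))) (cong (maybe (λ c → toℕ c ≡ᵇ toℕ b) false) table-value)))
                 (trans (sym (γ-eval v d _ (toℕ b))) e)
        ... | no ne = contradiction (trans (sym (≢⇒≡ᵇ ne)) (∧-conicalˡ _ _ (trans (sym (γ-eval v d _ (toℕ b))) e))) λ ()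

        γ-complete : γ v (guard ȳ (length (nbrs R v) , H x v)) ≡ true
        γ-complete = trans (γ-eval v _ _ (toℕ (H x v)))
          (cong₂ _∧_ (≡ᵇ-refl (length (nbrs R v)))
            (trans (cong (maybe (λ c → toℕ c ≡ᵇ toℕ (H x v)) false) table-value) (≡ᵇ-refl (toℕ (H x v)))))

        block-result : execs (γ v) after (stepX exchange X₁ v) ≗ codeword (H x v)
        block-result = result (after-run γ-sound (proj₁ bounded v) γ-complete) _ received

      layer-cong : ∀ s {X Y} → (∀ v → X v ≗ Y v) → layer s X ≗ layer s Y
      layer-cong s h u = cong (if toℕ (proj₁ (proj₂ (node′ u))) ≡ᵇ s then_else zero) (h _ _)

      program-result : ∀ x v → stepsX program (λ v → codeword (x v)) v ≗ codeword (H x v)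
      program-result x v w = trans (cong (λ X → X v w) (trans (stepsX-gates before (exchange ∷ after) _ before-gates)
          (trans (cong (λ Is → stepsX Is (stepX exchange (Step.X₁ x v))) (sym (++-identityʳ after))) (stepsX-gates after [] _ after-gates))))
        (Step.block-result x v w)

      simulates : Simulates net H emb T
      simulates x u = begin
        embed emb (H x) u                                      ≡⟨ embed-layer (H x) u ⟩
        layer 0 (λ v → codeword (H x v)) u                     ≡⟨ layer-cong 0 (program-result x) u ⟨
        layer 0 (stepsX program (λ v → codeword (x v))) u      ≡⟨ iter-layers _ _ [] _ refl u ⟨
        iter T net (layer 0 (λ v → codeword (x v))) u          ≡⟨ iter-cong T (embed-layer x) u ⟨
        iter T net (embed emb x) u                             ∎
        where open ≡-Reasoning

-- The compiler

-- A fold that accumulates output. Both the loops of the machine and the list comprehensions behind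
-- the network are brought into this form and compared there.
foldR : {A B : Set} → (A → B → Result A) → List B → A → Result A
foldR f []       a = a , []
foldR f (x ∷ xs) a = andThen (f a x) (foldR f xs)

andThen-assoc : {A B C : Set} (r : Result A) (f : A → Result B) (g : B → Result C) →
  andThen (andThen r f) g ≡ andThen r (λ a → andThen (f a) g)
andThen-assoc (a , o) f g = cong (_ ,_) (++-assoc o _ _)

andThen-cong : {A B : Set} {r r′ : Result A} {f g : A → Result B} → r ≡ r′ → (∀ a → f a ≡ g a) → andThen r f ≡ andThen r′ g
andThen-cong {r = a , o} refl h = cong₂ (λ x y → proj₁ x , o ++ proj₂ y) (h a) (h a)

foldR-cong : {A B : Set} {f g : A → B → Result A} → (∀ a x → f a x ≡ g a x) → ∀ xs a → foldR f xs a ≡ foldR g xs a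
foldR-cong h []       a = refl
foldR-cong h (x ∷ xs) a = andThen-cong (h a x) (foldR-cong h xs)

foldR-++ : {A B : Set} (f : A → B → Result A) (xs ys : List B) (a : A) →
  foldR f (xs ++ ys) a ≡ andThen (foldR f xs a) (foldR f ys)
foldR-++ f []       ys a = refl
foldR-++ f (x ∷ xs) ys a = trans (andThen-cong {r = f a x} refl (foldR-++ f xs ys)) (sym (andThen-assoc (f a x) (foldR f xs) (foldR f ys)))

foldR-map : {A B C : Set} (f : A → C → Result A) (g : B → C) (xs : List B) (a : A) →
  foldR f (map g xs) a ≡ foldR (λ a x → f a (g x)) xs a
foldR-map f g []       a = refl
foldR-map f g (x ∷ xs) a = andThen-cong {r = f a (g x)} refl (foldR-map f g xs)

foldR-filter : {A B : Set} {P : B → Set} (f : A → B → Result A) (P? : ∀ x → Dec (P x)) (xs : List B) (a : A) →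
  foldR f (filter P? xs) a ≡ foldR (λ a x → if does (P? x) then f a x else (a , [])) xs a
foldR-filter f P? []       a = refl
foldR-filter f P? (x ∷ xs) a with does (P? x)
... | true  = andThen-cong {r = f a x} refl (foldR-filter f P? xs)
... | false = foldR-filter f P? xs a

foldR-cartesian : {A B C : Set} (f : A → B × C → Result A) (xs : List B) (ys : List C) (a : A) →
  foldR f (cartesianProduct xs ys) a ≡ foldR (λ a x → foldR (λ a y → f a (x , y)) ys a) xs a
foldR-cartesian f []       ys a = refl
foldR-cartesian f (x ∷ xs) ys a =
  trans (foldR-++ f (map (x ,_) ys) _ a) (andThen-cong (foldR-map f (x ,_) ys a) (foldR-cartesian f xs ys))

foldR-⊤ : {B : Set} (f : ⊤ → B → Result ⊤) (xs : List B) → foldR f xs tt ≡ (tt , concatMap (λ x → proj₂ (f tt x)) xs)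
foldR-⊤ f []       = refl
foldR-⊤ f (x ∷ xs) = cong (λ r → tt , proj₂ (f tt x) ++ proj₂ r) (foldR-⊤ f xs)

iterate-foldR : {A : Set} (f : A → ℕ → Result A) (k m : ℕ) (a : A) →
  iterate f k m a ≡ foldR f (tabulate {n = m} (λ v → k + toℕ v)) a
iterate-foldR f k zero    a = refl
iterate-foldR f k (suc m) a = andThen-cong (cong (f a) (sym (+-identityʳ k)))
  (λ a → trans (iterate-foldR f (suc k) m a) (cong (λ xs → foldR f xs a) (tabulate-cong (λ v → sym (+-suc k (toℕ v))))))

iterate-allFin : {A : Set} (f : A → ℕ → Result A) (m : ℕ) (a : A) →
  iterate f 0 m a ≡ foldR (λ a v → f a (toℕ v)) (allFin m) a
iterate-allFin f m a = trans (iterate-foldR f 0 m a)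
  (trans (cong (λ xs → foldR f xs a) (sym (map-tabulate (λ v → v) toℕ))) (foldR-map f toℕ (allFin m) a))

chainC : ∀ {d} {A B : Set} {{_ : Finite A}} → List B → (B → A → Comp d A) → A → Comp d A
chainC []       g a = returnC a
chainC (x ∷ xs) g a = g x a ⟫= chainC xs g

sem-chainC : ∀ {d} {A B : Set} {{_ : Finite A}} (xs : List B) (g : B → A → Comp d A) (a : A) es ρ →
  sem (chainC xs g a) es ρ ≡ foldR (λ a x → sem (g x a) es ρ) xs a
sem-chainC []       g a es ρ = refl
sem-chainC (x ∷ xs) g a es ρ = andThen-cong {r = sem (g x a) es ρ} refl (λ a → sem-chainC xs g a es ρ)

-- A counter saturating at every increment agrees with the true count clamped once, so the control
-- can count edges without a bound on their number.
clamp-suc : ∀ m k → clamp m (suc (toℕ (clamp m k))) ≡ clamp m (suc k)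
clamp-suc m k = toℕ-injective (trans (toℕ-fromℕ< _) (trans (cong (λ z → suc z ⊓ m) (toℕ-fromℕ< _)) (trans (eq m k) (sym (toℕ-fromℕ< _)))))
  where
  eq : ∀ m k → suc (k ⊓ m) ⊓ m ≡ suc k ⊓ m
  eq zero    k = refl
  eq (suc m) k = cong suc (trans (cong (_⊓ m) refl) (go m k))
    where
    go : ∀ m k → k ⊓ suc m ⊓ m ≡ k ⊓ m
    go m k = trans (⊓-assoc k (suc m) m) (cong (k ⊓_) (m≥n⇒m⊓n≡n (n≤1+n m)))

encs-tabulate : ∀ {m} (g : Fin m → Tree) → encs (tabulate g) ≡ concatMap (enc ∘ g) (allFin m)
encs-tabulate {zero}  g = refl
encs-tabulate {suc m} g = cong (enc (g zero) ++_)
  (trans (encs-tabulate (g ∘ suc)) (trans (sym (concatMap-map (enc ∘ g) suc (allFin m))) (cong (concatMap (enc ∘ g)) (map-tabulate (λ i → i) suc))))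

concat-tabulate : {A : Set} {m : ℕ} (f : Fin m → List A) → concatMap f (allFin m) ≡ concat (tabulate f)
concat-tabulate f = cong concat (map-tabulate (λ i → i) f)

tabulate-+ : {A : Set} (k l : ℕ) (f : Fin (k + l) → A) → tabulate f ≡ tabulate (λ i → f (i ↑ˡ l)) ++ tabulate (λ j → f (k ↑ʳ j))
tabulate-+ zero    l f = refl
tabulate-+ (suc k) l f = cong (f zero ∷_) (tabulate-+ k l (f ∘ suc))

concat-combine : {A : Set} (m k : ℕ) (f : Fin (m * k) → List A) →
  concat (tabulate f) ≡ concat (tabulate {n = m} λ i → concat (tabulate {n = k} λ j → f (combine i j)))
concat-combine zero    k f = refl
concat-combine (suc m) k f = trans (cong concat (tabulate-+ k (m * k) f))
  (trans (sym (concat-++ (tabulate (λ i → f (i ↑ˡ (m * k)))) _)) (cong (concat (tabulate (λ i → f (i ↑ˡ (m * k)))) ++_) (concat-combine m k (λ j → f (k ↑ʳ j)))))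

node-++ : ∀ ts s → enc (node ts) ++ s ≡ open′ ∷ (encs ts ++ close′ ∷ s)
node-++ ts s = cong (open′ ∷_) (++-assoc (encs ts) (close′ ∷ []) s)

encs-2 : ∀ x y s → encs (x ∷ y ∷ []) ++ s ≡ enc x ++ (enc y ++ s)
encs-2 x y s = trans (++-assoc (enc x) (enc y ++ []) s) (cong (enc x ++_) (++-assoc (enc y) [] s))

encs-3 : ∀ x y z s → encs (x ∷ y ∷ z ∷ []) ++ s ≡ enc x ++ (enc y ++ (enc z ++ s))
encs-3 x y z s = trans (++-assoc (enc x) _ s) (cong (enc x ++_) (encs-2 y z s))

encs-numbers : ∀ {m} (xs : List (Fin m)) s → encs (map leafF xs) ++ s ≡ numsW (map toℕ xs) s
encs-numbers []       s = refl
encs-numbers (x ∷ xs) s = begin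
  (enc (leafF x) ++ encs (map leafF xs)) ++ s       ≡⟨ ++-assoc (enc (leafF x)) _ s ⟩
  enc (leafF x) ++ (encs (map leafF xs) ++ s)       ≡⟨ cong₂ _++_ (enc-leaf (toℕ x)) (encs-numbers xs s) ⟩
  numeral (toℕ x) ++ numsW (map toℕ xs) s           ≡⟨ ++-assoc (map symbol (bits (toℕ x))) (dot ∷ []) _ ⟩
  numW (toℕ x) (numsW (map toℕ xs) s)               ∎
  where open ≡-Reasoning

entryTree : ∀ {q n} → NetRep q n → Fin n → Tree
entryTree R v = node (node (map leafF (nbrs R v)) ∷ node (map leafF (table R v)) ∷ [])

enc-entry : ∀ {q n} (R : NetRep q n) v s → enc (entryTree R v) ++ s ≡ entryW (entryOf R v) s
enc-entry R v s = begin
  enc (entryTree R v) ++ s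
    ≡⟨ node-++ (node ns ∷ node ts ∷ []) s ⟩
  open′ ∷ (encs (node ns ∷ node ts ∷ []) ++ close′ ∷ s)
    ≡⟨ cong (open′ ∷_) (encs-2 (node ns) (node ts) (close′ ∷ s)) ⟩
  open′ ∷ (enc (node ns) ++ (enc (node ts) ++ close′ ∷ s))
    ≡⟨ cong (λ z → open′ ∷ (enc (node ns) ++ z)) (trans (node-++ ts (close′ ∷ s)) (cong (open′ ∷_) (encs-numbers (table R v) (close′ ∷ close′ ∷ s)))) ⟩
  open′ ∷ (enc (node ns) ++ tables)
    ≡⟨ cong (open′ ∷_) (trans (node-++ ns tables) (cong (open′ ∷_) (encs-numbers (nbrs R v) (close′ ∷ tables)))) ⟩
  entryW (entryOf R v) s ∎
  where
  open ≡-Reasoning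
  ns = map leafF (nbrs R v)
  ts = map leafF (table R v)
  tables = open′ ∷ numsW (map toℕ (table R v)) (close′ ∷ close′ ∷ s)

enc-entries : ∀ {m} (f : Fin m → Tree) (g : Fin m → Entry) → (∀ v s → enc (f v) ++ s ≡ entryW (g v) s) →
  ∀ s → encs (tabulate f) ++ s ≡ entriesW (tabulate g) s
enc-entries {zero}  f g h s = refl
enc-entries {suc m} f g h s = trans (++-assoc (enc (f zero)) _ s)
  (trans (h zero _) (cong (entryW (g zero)) (enc-entries (f ∘ suc) (g ∘ suc) (h ∘ suc) s)))

enc-word : ∀ {q n} (R : NetRep q n) → enc (encNetRep R) ≡ word (entries R)
enc-word {n = n} R = cong (open′ ∷_) (begin
  encs (leaf n ∷ node trees ∷ []) ++ close′ ∷ []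
    ≡⟨ encs-2 (leaf n) (node trees) (close′ ∷ []) ⟩
  enc (leaf n) ++ (enc (node trees) ++ close′ ∷ [])
    ≡⟨ cong₂ _++_ (enc-leaf n) (node-++ trees (close′ ∷ [])) ⟩
  numeral n ++ open′ ∷ (encs trees ++ close′ ∷ close′ ∷ [])
    ≡⟨ ++-assoc (map symbol (bits n)) (dot ∷ []) (open′ ∷ (encs trees ++ close′ ∷ close′ ∷ [])) ⟩
  numW n (open′ ∷ (encs trees ++ close′ ∷ close′ ∷ []))
    ≡⟨ cong₂ (λ m z → numW m (open′ ∷ z)) (sym (length-tabulate (entryOf R))) (enc-entries (entryTree R) (entryOf R) (enc-entry R) (close′ ∷ close′ ∷ [])) ⟩
  numW (length (entries R)) (open′ ∷ entriesW (entries R) (close′ ∷ close′ ∷ [])) ∎)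
  where
  open ≡-Reasoning
  trees = tabulate (entryTree R)

-- The five registers: number of nodes, current node, a neighbour of it, the node visited in a
-- search for edges, and a neighbour of that one.
pattern N = zero
pattern V = suc zero
pattern U = suc (suc zero)
pattern W = suc (suc (suc zero))
pattern X = suc (suc (suc (suc zero)))

-- The compiling program

module Compiler (q Δ′ : ℕ) where

  open Block q Δ′
  open Construction q Δ′

  size-suc : suc (pred size) ≡ size
  size-suc = suc-pred size {{ℕ.>-nonZero (≤-trans (s≤s z≤n) (≤-trans (m≤n+m 3 (Δ * q)) (≤-trans (m≤n+m (Δ * q + 3) (q + Δ * q)) (m≤m+n width (L * width)))))}}

  address : Fin T → Wire → ℕ
  address t w = width * toℕ t + toℕ (Inverse.from wires w)

  nodeC : ∀ {d} → Fin T → Wire → Fin 5 → Comp d ⊤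
  nodeC t w r = numberC (pred size) (address t w) r

  -- Runs body for all edges leaving the node in register u, with their endpoint in register W.
  scanC : {A : Set} {{_ : Finite A}} → Fin 5 → (Fin Δ → A → Comp 5 A) → A → Comp 3 A
  scanC u body = forC W (s≤s z≤n) (λ a → chainC (allFin Δ) (λ j a →
    neighbourC W (toℕ j) X (s≤s z≤n) ≤-refl (equalC X u ⟫= λ b → if b then body j a else returnC a) (returnC a)) a)

  -- The state is the saturating number of edges passed, together with a flag that freezes it once
  -- the edge sought has been met.
  count : Fin Δ → Fin Δ → Fin Δ × Bool → Bool → Fin Δ × Bool
  count j j′ (r , true)  b = r , true
  count j j′ (r , false) b = if b ∧ does (j′ ≟ j) then (r , true) else (clamp Δ′ (suc (toℕ r)) , false)

  rankC : Fin Δ → Comp 3 (Fin Δ)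
  rankC j = scanC U (λ j′ st → equalC W V ⟫= λ b → returnC (count j j′ st b)) (clamp Δ′ 0 , false) ⟫= λ st → returnC (proj₁ st)

  -- The state suc k means that k more edges have to be skipped.
  nthC : Fin T → Fin q → Fin Δ → Fin (suc Δ) → Comp 5 (Fin (suc Δ))
  nthC t a j zero          = returnC zero
  nthC t a j (suc zero)    = nodeC t (inW j a) W ⟫ returnC zero
  nthC t a j (suc (suc k)) = returnC (suc (inject₁ k))

  -- A nonzero final state means that too few edges leave the node for this port. Then `σ` fixes the
  -- port, so its own number is printed.
  outC : Fin T → Wire → Fin (suc Δ) → Comp 2 ⊤
  outC t w zero    = returnC tt
  outC t w (suc _) = nodeC t w V

  portC : Fin T → Wire → Comp 2 ⊤
  portC t (inW j a)  = neighbourC V (toℕ j) U (s≤s z≤n) ≤-refl (rankC j ⟫= λ r → nodeC t (outW r a) U) (nodeC t (inW j a) V)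
  -- `scanC` has depth 3 because of `rankC`, where register `U` holds a neighbour. Here `U` is still
  -- 0, and `weakenC` closes the gap.
  portC t (outW r a) = weakenC (s≤s (s≤s z≤n)) (s≤s (s≤s z≤n)) (scanC V (nthC t a) (suc r)) ⟫= outC t (outW r a)
  portC t w          = nodeC t w V

  -- What follows the neighbour numbers of a node. The empty list is the one that `encs` leaves at
  -- the end of its argument, so that the word agrees with `enc-pair` literally.
  closing : List (Fin 2) → List Sym
  closing tab = close′ ∷ (enc (node (map leafF tab)) ++ []) ++ close′ ∷ []

  gateC : (t : Fin T) (k : GateKind) (w w′ : Wire) → Dec (w′ ≡ w) → Comp 2 ⊤
  gateC t k w w′ (yes _) = nodeC t w V ⟫ emitC (closing wireTable)
  gateC t k w w′ (no _)  = nodeC t w V ⟫ (nodeC t w′ V ⟫ emitC (closing (gateTable k)))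

  instrC : Fin T → Instr → Wire → Comp 2 ⊤
  instrC t exchange              w = portC t w ⟫ emitC (closing wireTable)
  instrC t (gate nothing k i j)  w = gateC t k w (swap i j w) (swap i j w ≟ʷ w)
  instrC t (gate (just (d , idx , b)) k i j) w =
    checkC V U (s≤s z≤n) ≤-refl d idx b ⟫= λ c → gateC t k w (if c then swap i j w else w) ((if c then swap i j w else w) ≟ʷ w)

  cellC : Fin T × Wire → Comp 2 ⊤
  cellC (t , w) = emitC (open′ ∷ open′ ∷ []) ⟫ instrC (prev t) (instr (prev t)) w

  -- In the order of their numbers within a block. The list depends only on q and Δ, so iterating
  -- over it is unrolled into the control, and only loops over nodes of the input use registers.
  cells : List (Fin T × Wire)
  cells = concatMap (λ t → map (λ i → t , Inverse.to wires i) (allFin width)) (allFin T)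

  patterns : Fin q → List Sym
  patterns a = concatMap (λ c → enc (leafF (patN a c))) cells

  cellsC blocksC : Comp 2 ⊤
  cellsC  = chainC cells (λ c _ → cellC c) tt
  blocksC = chainC cells (λ _ _ → numberC 0 0 V) tt

  -- A pattern is the same in every block, so the loop over the nodes just repeats one constant
  -- word.
  patternC : Fin q → Comp 1 ⊤
  patternC a = emitC (open′ ∷ []) ⟫ (forC V (s≤s z≤n) (λ _ → emitC (patterns a)) tt ⟫ emitC (close′ ∷ []))

  mainC : Comp 1 ⊤
  mainC =
    emitC (open′ ∷ open′ ∷ []) ⟫ (numberC (pred size) 0 N ⟫ (emitC (open′ ∷ []) ⟫ (
    forC V (s≤s z≤n) (λ _ → cellsC) tt ⟫ (
    emitC (close′ ∷ close′ ∷ []) ⟫ (emitC (enc (leaf T)) ⟫ (emitC (open′ ∷ open′ ∷ []) ⟫ (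
    forC V (s≤s z≤n) (λ _ → blocksC) tt ⟫ (
    emitC (close′ ∷ open′ ∷ []) ⟫ (
    chainC (allFin q) (λ a _ → patternC a) tt ⟫
    emitC (close′ ∷ close′ ∷ close′ ∷ []))))))))))

  -- Agreement of the printed word with the encoding

  module Output {n : ℕ} (R : NetRep q n) (bounded : DegreeBound Δ R) (unique : ∀ v → Unique (nbrs R v)) where

    open Net R bounded unique

    es : List Entry
    es = entries R

    length-es : length es ≡ n
    length-es = length-tabulate (entryOf R)

    ρ₀ : Registers
    ρ₀ = initial es

    ρᵛ : Fin n → Registers
    ρᵛ v = ρ₀ [ V ]≔ toℕ v

    neighbour-eval : ∀ v j → neighbour es (toℕ v) j ≡ Maybe.map toℕ (lookupℕ (nbrs R v) j)
    neighbour-eval v j = trans (cong (Maybe._>>= λ e → lookupℕ (proj₁ e) j) (lookupℕ-entries v)) (lookupℕ-map toℕ (nbrs R v) j)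

    sem-for : {A : Set} {{_ : Finite A}} (r : Fin 5) (1≤r : 1 ≤ toℕ r) (body : A → Comp (suc (toℕ r)) A) (a : A) (ρ : Registers) →
      sem (forC r 1≤r body a) es ρ ≡ foldR (λ a v → sem (body a) es (ρ [ r ]≔ toℕ v)) (allFin n) a
    sem-for r 1≤r body a ρ = trans (cong (λ m → iterate (λ a k → sem (body a) es (ρ [ r ]≔ k)) 0 m a) length-es) (iterate-allFin _ n a)

    -- The machine has no room for a list of edges and meets them in nested loops over nodes and
    -- positions. These loops follow the order of `cartesianProduct`, and comparing register `X`
    -- with `u` decides the same as `hit?`, so `foldR-filter` turns the scan into a fold over
    -- `edges u′`.
    sem-scan : {A : Set} {{_ : Finite A}} (u : Fin 5) (body : Fin Δ → A → Comp 5 A) (a : A) {c₀ c₁ c₂ c₃ c₄ : ℕ} (u′ : Fin n) →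
      (∀ k x → Vec.lookup (c₀ ∷ c₁ ∷ c₂ ∷ k ∷ x ∷ []) u ≡ toℕ u′) →
      sem (scanC u body a) es (c₀ ∷ c₁ ∷ c₂ ∷ c₃ ∷ c₄ ∷ []) ≡
      foldR (λ a p → sem (body (proj₂ p) a) es (c₀ ∷ c₁ ∷ c₂ ∷ toℕ (proj₁ p) ∷ toℕ u′ ∷ [])) (edges u′) a
    sem-scan {A} u body a {c₀} {c₁} {c₂} {c₃} {c₄} u′ h = begin
      sem (scanC u body a) es ρ
        ≡⟨ sem-for W (s≤s z≤n) (chainC (allFin Δ) stepC) a ρ ⟩
      foldR (λ a v → sem (chainC (allFin Δ) stepC a) es (ρ [ W ]≔ toℕ v)) (allFin n) a
        ≡⟨ foldR-cong (λ a v → trans (sem-chainC (allFin Δ) stepC a es (ρ [ W ]≔ toℕ v)) (foldR-cong (λ a j → cellEq v j a) (allFin Δ) a)) (allFin n) a ⟩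
      foldR (λ a v → foldR (λ a j → g a (v , j)) (allFin Δ) a) (allFin n) a
        ≡⟨ foldR-cartesian g (allFin n) (allFin Δ) a ⟨
      foldR g (cartesianProduct (allFin n) (allFin Δ)) a
        ≡⟨ foldR-filter f (hit? u′) (cartesianProduct (allFin n) (allFin Δ)) a ⟨
      foldR f (edges u′) a ∎
      where
      open ≡-Reasoning
      ρ : Registers
      ρ = c₀ ∷ c₁ ∷ c₂ ∷ c₃ ∷ c₄ ∷ []
      stepC : Fin Δ → A → Comp 4 A
      stepC j a = neighbourC W (toℕ j) X (s≤s z≤n) ≤-refl (equalC X u ⟫= λ b → if b then body j a else returnC a) (returnC a)
      f g : A → Fin n × Fin Δ → Result A
      f a p = sem (body (proj₂ p) a) es (c₀ ∷ c₁ ∷ c₂ ∷ toℕ (proj₁ p) ∷ toℕ u′ ∷ [])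
      g a p = if does (hit? u′ p) then f a p else (a , [])
      cellEq : ∀ v j a → sem (stepC j a) es (ρ [ W ]≔ toℕ v) ≡ g a (v , j)
      cellEq v j a = trans (cong (maybe _ (a , [])) (neighbour-eval v (toℕ j))) (go (lookupℕ (nbrs R v) (toℕ j)))
        where
        then-body : ℕ → Result A
        then-body x = sem (equalC {5} X u ⟫= λ b → if b then body j a else returnC a) es (c₀ ∷ c₁ ∷ c₂ ∷ toℕ v ∷ x ∷ [])
        go : ∀ m → maybe then-body (a , []) (Maybe.map toℕ m) ≡ (if does (Maybe.≡-dec _≟_ m (just u′)) then f a (v , j) else (a , []))
        go nothing = refl
        go (just x) rewrite h (toℕ v) (toℕ x) with x ≟ u′
        ... | yes refl rewrite ≡ᵇ-refl (toℕ x) = refl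
        ... | no ne rewrite ≢⇒≡ᵇ {toℕ x} {toℕ u′} (ne ∘ toℕ-injective) = refl

    count-found : ∀ (v : Fin n) j (xs : List (Fin n × Fin Δ)) r → foldR (λ st p → count j (proj₂ p) st (toℕ (proj₁ p) ≡ᵇ toℕ v) , []) xs (r , true) ≡ ((r , true) , [])
    count-found v j []       r = refl
    count-found v j (p ∷ xs) r = cong (λ z → proj₁ z , proj₂ z) (count-found v j xs r)

    -- The flag is left open: whether or not the edge occurs, the counter ends at the clamped sum of
    -- `k` and `firstIndex`, which is the length of the list for an edge that does not occur.
    count-rank : ∀ (v : Fin n) j (xs : List (Fin n × Fin Δ)) k → ∃ λ b → foldR (λ st p → count j (proj₂ p) st (toℕ (proj₁ p) ≡ᵇ toℕ v) , []) xs (clamp Δ′ k , false)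
      ≡ ((clamp Δ′ (k + firstIndex (isEdge v j) xs) , b) , [])
    count-rank v j [] k = false , cong (λ z → (clamp Δ′ z , false) , []) (sym (+-identityʳ k))
    count-rank v j (p ∷ xs) k with isEdge v j p
    ... | true  = true , trans (count-found v j xs (clamp Δ′ k)) (cong (λ z → (clamp Δ′ z , true) , []) (sym (+-identityʳ k)))
    ... | false with count-rank v j xs (suc k)
    ...   | b , e = b , trans (cong (λ z → foldR _ xs (z , false)) (clamp-suc Δ′ k)) (trans e (cong (λ z → (clamp Δ′ z , b) , []) (sym (+-suc k _))))

    sem-rank : ∀ u v j {c₀ c₃ c₄} → sem (rankC j) es (c₀ ∷ toℕ v ∷ toℕ u ∷ c₃ ∷ c₄ ∷ []) ≡ (rank u v j , [])
    sem-rank u v j {c₀} {c₃} {c₄} with count-rank v j (edges u) 0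
    ... | b , e = cong (λ r → proj₁ (proj₁ r) , proj₂ r ++ []) (trans (sem-scan U _ _ {c₀} {toℕ v} {toℕ u} {c₃} {c₄} u (λ _ _ → refl)) e)

    sem-node : ∀ {d} t w r (ρ : Registers) v → Vec.lookup ρ r ≡ toℕ v → sem (nodeC {d} t w r) es ρ ≡ (tt , numeral (toℕ (index (v , t , w))))
    sem-node t w r ρ v e = cong (λ z → tt , numeral z)
      (trans (cong₂ (λ k x → k * x + address t w) size-suc e) (sym (toℕ-index v t w)))

    nthStep : Fin T → Fin q → Fin n → Fin (suc Δ) → Fin n × Fin Δ → Result (Fin (suc Δ))
    nthStep t a v k p = sem (nthC t a (proj₂ p) k) es (length es ∷ toℕ v ∷ 0 ∷ toℕ (proj₁ p) ∷ toℕ v ∷ [])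

    nth-done : ∀ t a v xs → foldR (nthStep t a v) xs zero ≡ (zero , [])
    nth-done t a v []       = refl
    nth-done t a v (p ∷ xs) = nth-done t a v xs

    nth-just : ∀ t a v xs r {v′ j} → lookupℕ xs (toℕ r) ≡ just (v′ , j) →
      foldR (nthStep t a v) xs (suc r) ≡ (zero , numeral (toℕ (index (v′ , t , inW j a))))
    nth-just t a v ((v′ , j) ∷ xs) zero refl = begin
      andThen (nthStep t a v (suc zero) (v′ , j)) (foldR (nthStep t a v) xs)
        ≡⟨ cong (λ s → andThen (zero , proj₂ s ++ []) (foldR (nthStep t a v) xs)) (sem-node {5} t (inW j a) W (length es ∷ toℕ v ∷ 0 ∷ toℕ v′ ∷ toℕ v ∷ []) v′ refl) ⟩
      andThen (zero , m ++ []) (foldR (nthStep t a v) xs)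
        ≡⟨ cong (λ s → proj₁ s , (m ++ []) ++ proj₂ s) (nth-done t a v xs) ⟩
      (zero , (m ++ []) ++ [])
        ≡⟨ cong (zero ,_) (trans (++-identityʳ (m ++ [])) (++-identityʳ m)) ⟩
      (zero , m) ∎
      where
      open ≡-Reasoning
      m = numeral (toℕ (index (v′ , t , inW j a)))
    nth-just t a v (p ∷ xs) (suc r) e =
      nth-just t a v xs (inject₁ r) (trans (cong (lookupℕ xs) (toℕ-inject₁ r)) e)

    nth-nothing : ∀ t a v xs r → lookupℕ xs (toℕ r) ≡ nothing →
      ∃ λ k → foldR (nthStep t a v) xs (suc r) ≡ (suc k , [])
    nth-nothing t a v []       r       e = r , refl
    nth-nothing t a v (p ∷ xs) (suc r) e =
      nth-nothing t a v xs (inject₁ r) (trans (cong (lookupℕ xs) (toℕ-inject₁ r)) e)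

    -- The exchange is computed from both ends. An incoming port looks up its neighbour and counts
    -- the rank of the edge there; an outgoing port `r` searches for the edge at position `r` among
    -- those leaving its node.
    sem-port : ∀ t w v → sem (portC t w) es (ρᵛ v) ≡ (tt , numeral (toℕ (index (place t (σ (v , w))))))
    sem-port t (main a) v = sem-node {2} t (main a) V (ρᵛ v) v refl
    sem-port t (inj₂ (inj₂ i)) v = sem-node {2} t (inj₂ (inj₂ i)) V (ρᵛ v) v refl
    sem-port t (inW j a) v = trans (cong (maybe _ _) (neighbour-eval v (toℕ j))) (go (lookupℕ (nbrs R v) (toℕ j)))
      where
      ρ : ℕ → Registers
      ρ x = length es ∷ toℕ v ∷ x ∷ 0 ∷ 0 ∷ []
      go : ∀ m → maybe (λ x → sem (rankC j ⟫= λ r → nodeC t (outW r a) U) es (ρ x)) (sem (nodeC {2} t (inW j a) V) es (ρ 0)) (Maybe.map toℕ m)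
        ≡ (tt , numeral (toℕ (index (place t (maybe (λ u → u , outW (rank u v j) a) (v , inW j a) m)))))
      go nothing  = sem-node {2} t (inW j a) V (ρ 0) v refl
      go (just u) = trans (cong (λ r → andThen r (λ r → sem (nodeC {3} t (outW r a) U) es (ρ (toℕ u)))) (sem-rank u v j {length es} {0} {0}))
                      (sem-node {3} t (outW (rank u v j) a) U (ρ (toℕ u)) u refl)
    sem-port t (outW r a) v = trans (cong (λ s → andThen s after-scan) (sem-scan V (nthC t a) (suc r) {length es} {toℕ v} {0} {0} {0} v (λ _ _ → refl)))
        (go (lookupℕ (edges v) (toℕ r)) refl)
      where
      ρ : Registers
      ρ = length es ∷ toℕ v ∷ 0 ∷ 0 ∷ 0 ∷ []
      after-scan : Fin (suc Δ) → Result ⊤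
      after-scan k = sem (outC t (outW r a) k) es ρ
      go : ∀ m → lookupℕ (edges v) (toℕ r) ≡ m → andThen (foldR (nthStep t a v) (edges v) (suc r)) after-scan
        ≡ (tt , numeral (toℕ (index (place t (maybe (λ { (v , j) → v , inW j a }) (v , outW r a) m)))))
      go (just (v′ , j)) e = trans (cong (λ s → andThen s after-scan) (nth-just t a v (edges v) r e)) (cong (tt ,_) (++-identityʳ _))
      go nothing e with nth-nothing t a v (edges v) r e
      ... | k , e′ = trans (cong (λ s → andThen s after-scan) e′) (sem-node {2} t (outW r a) V ρ v refl)

    cellNbrs : Fin T → Instr → (v : Fin n) (w : Wire) {w′ : Wire} → Dec (w′ ≡ w) → List (Fin (n * size))
    cellNbrs t I v w (yes _)          = index (place t (route I (v , w))) ∷ []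
    cellNbrs t I v w {w′} (no _) = index (place t (route I (v , w))) ∷ index (place t (route I (v , w′))) ∷ []

    cellTable : Instr → {w w′ : Wire} → Dec (w′ ≡ w) → List (Fin 2)
    cellTable I (yes _) = wireTable
    cellTable I (no _)  = gateTable (instrKind I)

    -- The representation decides on node numbers whether two wires share a gate, the compiler on
    -- wires; as in `net-exec`, the mixed cases are contradictory.
    rep-cell : ∀ v t w → let I = instr (prev t) ; d = partnerW I (γ v) w ≟ʷ w in
      nbrs rep (index (v , t , w)) ≡ cellNbrs (prev t) I v w d × table rep (index (v , t , w)) ≡ cellTable I d
    rep-cell v t w = go (conj partnerN u ≟ u) (partnerW I (γ v) w ≟ʷ w)
      where
      u = index (v , t , w)
      I = instr (prev t)
      go : ∀ d (d′ : Dec (partnerW I (γ v) w ≡ w)) → nbrsAt u d ≡ cellNbrs (prev t) I v w d′ × tableAt u d ≡ cellTable I d′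
      go (yes e) (yes _) = cong (λ p → index (preN p) ∷ []) (node-index (v , t , w)) , refl
      go (no ne) (yes e) = contradiction (fixed⁺ v t w e) ne
      go (yes e) (no ne) = contradiction (fixed⁻ v t w e) ne
      go (no _) (no _) =
        cong₂ (λ p p′ → p ∷ p′ ∷ []) (conj-index preN (v , t , w))
          (trans (cong (conj preN) (conj-index partnerN (v , t , w))) (conj-index preN (partnerN (v , t , w)))) ,
        cong (gateTable ∘ kindN) (node-index (v , t , w))

    numeral-leaf : {m : ℕ} (i : Fin m) (s : List Sym) → numeral (toℕ i) ++ s ≡ enc (leafF i) ++ s
    numeral-leaf i s = cong (_++ s) (sym (enc-leaf (toℕ i)))

    sem-gate : ∀ t k w w′ (d : Dec (w′ ≡ w)) {g i j} v →
      sem (gateC t k w w′ d) es (ρᵛ v) ≡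
      (tt , encs (map leafF (cellNbrs t (gate g k i j) v w d)) ++ closing (cellTable (gate g k i j) d))
    sem-gate t k w w′ (yes _) v = trans (cong (λ r → tt , proj₂ r ++ closing wireTable) (sem-node {2} t w V ρ v refl))
      (cong (tt ,_) (trans (numeral-leaf p (closing wireTable)) (cong (_++ closing wireTable) (sym (++-identityʳ (enc (leafF p)))))))
      where
      ρ : Registers
      ρ = length es ∷ toℕ v ∷ 0 ∷ 0 ∷ 0 ∷ []
      p = index (v , t , w)
    sem-gate t k w w′ (no _) v = trans
      (cong₂ (λ r r′ → tt , proj₂ r ++ (proj₂ r′ ++ closing (gateTable k))) (sem-node {2} t w V ρ v refl) (sem-node {2} t w′ V ρ v refl))
      (cong (tt ,_) (begin
        numeral (toℕ p) ++ (numeral (toℕ p′) ++ cl)                 ≡⟨ numeral-leaf p _ ⟩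
        enc (leafF p) ++ (numeral (toℕ p′) ++ cl)                   ≡⟨ cong (enc (leafF p) ++_) (numeral-leaf p′ cl) ⟩
        enc (leafF p) ++ (enc (leafF p′) ++ cl)                     ≡⟨ sym (++-assoc (enc (leafF p)) (enc (leafF p′)) cl) ⟩
        (enc (leafF p) ++ enc (leafF p′)) ++ cl                     ≡⟨ cong (λ z → (enc (leafF p) ++ z) ++ cl) (sym (++-identityʳ (enc (leafF p′)))) ⟩
        (enc (leafF p) ++ (enc (leafF p′) ++ [])) ++ cl             ∎))
      where
      open ≡-Reasoning
      ρ : Registers
      ρ = length es ∷ toℕ v ∷ 0 ∷ 0 ∷ 0 ∷ []
      p = index (v , t , w)
      p′ = index (v , t , w′)
      cl = closing (gateTable k)

    sem-instr : ∀ t I w v → let d = partnerW I (γ v) w ≟ʷ w in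
      sem (instrC t I w) es (ρᵛ v) ≡
      (tt , encs (map leafF (cellNbrs t I v w d)) ++ closing (cellTable I d))
    sem-instr t (gate nothing k i j) w v = sem-gate t k w (swap i j w) (swap i j w ≟ʷ w) {nothing} {i} {j} v
    sem-instr t (gate (just (d , idx , b)) k i j) w v = sem-gate t k w w′ (w′ ≟ʷ w) {just (d , idx , b)} {i} {j} v
      where w′ = if γ v (d , idx , b) then swap i j w else w
    sem-instr t exchange w v with w ≟ʷ w
    ... | no ne = contradiction refl ne
    ... | yes _ = trans (cong (λ r → tt , proj₂ r ++ closing wireTable) (sem-port t w v))
      (cong (tt ,_) (trans (numeral-leaf p (closing wireTable)) (cong (_++ closing wireTable) (sym (++-identityʳ (enc (leafF p)))))))
      where p = index (place t (σ (v , w)))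

    enc-pair : ∀ ls ts → enc (node (node ls ∷ node ts ∷ [])) ≡ open′ ∷ open′ ∷ encs ls ++ (close′ ∷ (enc (node ts) ++ []) ++ close′ ∷ [])
    enc-pair ls ts = cong (λ z → open′ ∷ open′ ∷ z)
      (trans (++-assoc (encs ls ++ close′ ∷ []) (enc (node ts) ++ []) _) (++-assoc (encs ls) (close′ ∷ []) _))

    nodeTree : Fin (n * size) → Tree
    nodeTree u = node (node (map leafF (nbrs rep u)) ∷ node (map leafF (table rep u)) ∷ [])

    sem-cell : ∀ t w v → sem (cellC (t , w)) es (ρᵛ v) ≡ (tt , enc (nodeTree (index (v , t , w))))
    sem-cell t w v = trans (cong (λ r → tt , open′ ∷ open′ ∷ proj₂ r) (sem-instr (prev t) (instr (prev t)) w v))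
      (cong (tt ,_) (sym (trans (cong₂ (λ ls ts → enc (node (node (map leafF ls) ∷ node (map leafF ts) ∷ [])))
          (proj₁ (rep-cell v t w)) (proj₂ (rep-cell v t w))) (enc-pair (map leafF (cellNbrs (prev t) I v w d)) (map leafF (cellTable I d))))))
      where
      I = instr (prev t)
      d = partnerW I (γ v) w ≟ʷ w

    -- Node numbers are lexicographic in node, layer and wire, so a loop over nodes around the fixed
    -- list of cells visits them in increasing order, as the encoding demands.
    concat-nodes : (h : Fin (n * size) → List Sym) →
      concatMap h (allFin (n * size)) ≡ concatMap (λ v → concatMap (λ c → h (index (v , c))) cells) (allFin n)
    concat-nodes h = begin
      concatMap h (allFin (n * size))            ≡⟨ concat-tabulate h ⟩
      concat (tabulate h)                        ≡⟨ concat-combine n size h ⟩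
      concat (tabulate rows)                     ≡⟨ cong concat (tabulate-cong inner) ⟩
      concat (tabulate (λ v → concatMap (atCell v) cells)) ≡⟨ concat-tabulate (λ v → concatMap (atCell v) cells) ⟨
      concatMap (λ v → concatMap (atCell v) cells) (allFin n) ∎
      where
      open ≡-Reasoning
      atCell : Fin n → Fin T × Wire → List Sym
      atCell v c = h (index (v , c))
      rowCells : Fin T → List (Fin T × Wire)
      rowCells t = map (λ i → t , Inverse.to wires i) (allFin width)
      rows : Fin n → List Sym
      rows v = concat (tabulate {n = size} λ x → h (combine v x))
      concatMap-concatMap : {A B C : Set} (f : B → List C) (g : A → List B) (xs : List A) →
        concatMap f (concatMap g xs) ≡ concatMap (λ x → concatMap f (g x)) xs
      concatMap-concatMap f g []       = refl
      concatMap-concatMap f g (x ∷ xs) = trans (cong concat (map-++ f (g x) _))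
        (trans (sym (concat-++ (map f (g x)) _)) (cong (concatMap f (g x) ++_) (concatMap-concatMap f g xs)))
      row₁ : ∀ v t → concat (tabulate {n = width} λ i → h (combine v (combine t i))) ≡ concatMap (atCell v) (rowCells t)
      row₁ v t = begin
        concat (tabulate {n = width} λ i → h (combine v (combine t i)))
          ≡⟨ cong concat (tabulate-cong (λ i → cong h (index-combine v t i))) ⟨
        concat (tabulate {n = width} λ i → atCell v (t , Inverse.to wires i))
          ≡⟨ concat-tabulate (λ i → atCell v (t , Inverse.to wires i)) ⟨
        concatMap (λ i → atCell v (t , Inverse.to wires i)) (allFin width)
          ≡⟨ concatMap-map (atCell v) (λ i → t , Inverse.to wires i) (allFin width) ⟨
        concatMap (atCell v) (rowCells t) ∎
      inner : ∀ v → rows v ≡ concatMap (atCell v) cells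
      inner v = begin
        rows v
          ≡⟨ concat-combine T width (λ x → h (combine v x)) ⟩
        concat (tabulate {n = T} λ t → concat (tabulate {n = width} λ i → h (combine v (combine t i))))
          ≡⟨ cong concat (tabulate-cong (row₁ v)) ⟩
        concat (tabulate (λ t → concatMap (atCell v) (rowCells t)))
          ≡⟨ concat-tabulate (λ t → concatMap (atCell v) (rowCells t)) ⟨
        concatMap (λ t → concatMap (atCell v) (rowCells t)) (allFin T)
          ≡⟨ concatMap-concatMap (atCell v) rowCells (allFin T) ⟨
        concatMap (atCell v) cells ∎

    sem-forNodes : (body : Comp 2 ⊤) (h : Fin n → List Sym) → (∀ v → sem body es (ρᵛ v) ≡ (tt , h v)) →
      sem (forC V (s≤s z≤n) (λ _ → body) tt) es ρ₀ ≡ (tt , concatMap h (allFin n))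
    sem-forNodes body h e = trans (sem-for V (s≤s z≤n) (λ _ → body) tt ρ₀)
      (trans (foldR-⊤ _ (allFin n)) (cong (tt ,_) (concatMap-cong (λ v → cong proj₂ (e v)) (allFin n))))

    sem-chain-⊤ : ∀ {d} {B : Set} (xs : List B) (g : B → Comp d ⊤) (h : B → List Sym) ρ → (∀ x → sem (g x) es ρ ≡ (tt , h x)) →
      sem (chainC xs (λ x _ → g x) tt) es ρ ≡ (tt , concatMap h xs)
    sem-chain-⊤ xs g h ρ e = trans (sem-chainC xs (λ x _ → g x) tt es ρ)
      (trans (foldR-⊤ _ xs) (cong (tt ,_) (concatMap-cong (λ x → cong proj₂ (e x)) xs)))

    sem-nodes : sem (forC V (s≤s z≤n) (λ _ → cellsC) tt) es ρ₀ ≡ (tt , encs (tabulate nodeTree))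
    sem-nodes = trans
      (sem-forNodes cellsC (λ v → concatMap (λ c → enc (nodeTree (index (v , c)))) cells)
        (λ v → sem-chain-⊤ cells cellC _ (ρᵛ v) (λ { (t , w) → sem-cell t w v })))
      (cong (tt ,_) (sym (trans (encs-tabulate nodeTree) (concat-nodes (enc ∘ nodeTree)))))

    sem-blocks : sem (forC V (s≤s z≤n) (λ _ → blocksC) tt) es ρ₀ ≡ (tt , encs (tabulate (λ u → leafF (blk emb u))))
    sem-blocks = trans
      (sem-forNodes blocksC (λ v → concatMap (λ c → enc (leafF (blk emb (index (v , c))))) cells)
        (λ v → sem-chain-⊤ cells (λ _ → numberC 0 0 V) _ (ρᵛ v) (λ c → cong (tt ,_)
          (trans (cong numeral (trans (+-identityʳ _) (*-identityˡ (toℕ v)))) (trans (sym (enc-leaf (toℕ v))) (cong (enc ∘ leafF ∘ proj₁) (sym (node-index (v , c)))))))))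
      (cong (tt ,_) (sym (trans (encs-tabulate (λ u → leafF (blk emb u))) (concat-nodes (λ u → enc (leafF (blk emb u)))))))

    patternTree : Fin q → Tree
    patternTree a = node (tabulate (λ u → leafF (pat emb a u)))

    sem-pattern : ∀ a → sem (patternC a) es ρ₀ ≡ (tt , enc (patternTree a))
    sem-pattern a = cong (λ r → tt , open′ ∷ (proj₂ r ++ close′ ∷ []))
      (trans (sem-forNodes (emitC (patterns a)) (λ _ → patterns a) (λ _ → refl))
        (cong (tt ,_) (sym (trans (encs-tabulate (λ u → leafF (pat emb a u))) (trans (concat-nodes (λ u → enc (leafF (pat emb a u))))
          (concatMap-cong (λ v → concatMap-cong (λ c → cong (enc ∘ leafF ∘ patN a ∘ proj₂) (node-index (v , c))) cells) (allFin n)))))))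

    sem-patterns : sem (chainC (allFin q) (λ a _ → patternC a) tt) es ρ₀ ≡ (tt , encs (tabulate patternTree))
    sem-patterns = trans (sem-chain-⊤ (allFin q) patternC (enc ∘ patternTree) ρ₀ sem-pattern) (cong (tt ,_) (sym (encs-tabulate patternTree)))

    result-word : List Sym
    result-word = enc (node (encNetRep rep ∷ leaf T ∷ encEmb emb ∷ []))

    sem-main : proj₂ (sem mainC es ρ₀) ≡ result-word
    sem-main = begin
      proj₂ (sem mainC es ρ₀)
        ≡⟨ cong₂ (λ a b → open′ ∷ open′ ∷ (numeral (suc (pred size) * length es + 0) ++ (open′ ∷ (proj₂ a ++ (close′ ∷ close′ ∷ (enc (leaf T) ++ (open′ ∷ open′ ∷ proj₂ b)))))))
             sem-nodes (cong₂ (λ a b → tt , (proj₂ a ++ (close′ ∷ open′ ∷ (proj₂ b ++ close′ ∷ close′ ∷ close′ ∷ [])))) sem-blocks sem-patterns) ⟩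
      open′ ∷ open′ ∷ (numeral (suc (pred size) * length es + 0) ++ rest)
        ≡⟨ cong (λ z → open′ ∷ open′ ∷ (z ++ rest)) (trans (cong numeral number) (sym (enc-leaf (n * size)))) ⟩
      open′ ∷ open′ ∷ (enc (leaf (n * size)) ++ rest)
        ≡⟨ cong (open′ ∷_) network-part ⟨
      open′ ∷ (enc (encNetRep rep) ++ (enc (leaf T) ++ (enc (encEmb emb) ++ close′ ∷ [])))
        ≡⟨ cong (open′ ∷_) (encs-3 (encNetRep rep) (leaf T) (encEmb emb) (close′ ∷ [])) ⟨
      result-word ∎
      where
      open ≡-Reasoning
      blocks pats : List Tree
      blocks = tabulate (λ u → leafF (blk emb u))
      pats   = tabulate patternTree
      embedding rest tail′ : List Sym
      embedding = open′ ∷ open′ ∷ (encs blocks ++ (close′ ∷ open′ ∷ (encs pats ++ close′ ∷ close′ ∷ close′ ∷ [])))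
      rest = open′ ∷ (encs (tabulate nodeTree) ++ (close′ ∷ close′ ∷ (enc (leaf T) ++ embedding)))
      tail′ = enc (leaf T) ++ (enc (encEmb emb) ++ close′ ∷ [])
      number : suc (pred size) * length es + 0 ≡ n * size
      number = trans (+-identityʳ _) (trans (cong₂ _*_ size-suc length-es) (*-comm size n))
      embedding-part : enc (encEmb emb) ++ close′ ∷ [] ≡ embedding
      embedding-part = trans (node-++ (node blocks ∷ node pats ∷ []) (close′ ∷ []))
        (cong (open′ ∷_) (trans (encs-2 (node blocks) (node pats) (close′ ∷ close′ ∷ []))
        (trans (node-++ blocks (enc (node pats) ++ close′ ∷ close′ ∷ []))
          (cong (λ z → open′ ∷ (encs blocks ++ close′ ∷ z)) (node-++ pats (close′ ∷ close′ ∷ []))))))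
      network-part : enc (encNetRep rep) ++ tail′ ≡ open′ ∷ (enc (leaf (n * size)) ++ rest)
      network-part = trans (node-++ (leaf (n * size) ∷ node (tabulate nodeTree) ∷ []) tail′)
        (cong (open′ ∷_) (trans (encs-2 (leaf (n * size)) (node (tabulate nodeTree)) (close′ ∷ tail′))
        (cong (enc (leaf (n * size)) ++_) (trans (node-++ (tabulate nodeTree) (close′ ∷ tail′))
          (cong (λ z → open′ ∷ (encs (tabulate nodeTree) ++ close′ ∷ close′ ∷ (enc (leaf T) ++ z))) embedding-part)))))

entries-bounded : ∀ {q n} (R : NetRep q n) → Bounded (entries R)
entries-bounded {n = n} R = All.tabulate⁺ λ v → All.map⁺ (All.universal (λ u → subst (toℕ u <_) (sym (length-tabulate (entryOf R))) (toℕ<n u)) (nbrs R v))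

mainTheorem7 : StronglyUniversalΓGm
mainTheorem7 q (suc Δ′) _ = T , (λ n → n * size) , size , linear , Machine.M (start mainC) , 6 , construct
  where
  open Compiler q Δ′
  open Construction q Δ′
  linear : ∀ n → n * size ≤ size * suc n
  linear n = ≤-trans (≤-reflexive (*-comm n size)) (*-monoʳ-≤ size (n≤1+n n))
  construct : ∀ w n H → RepB q (suc Δ′) w n H →
    Σ (NetRep 2 (n * size)) λ R → Σ (Network 2 (n * size)) λ F → Σ (BlockEmb q n (n * size)) λ E →
      RepΓ (enc (encNetRep R)) (n * size) F × IsBlockEmb E × Simulates F H E T ×
      LogSpaceRun (Machine.M (start mainC)) 6 w (enc (node (encNetRep R ∷ leaf T ∷ encEmb E ∷ [])))
  construct w n H (R , bounded , (unique , _ , values) , refl) =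
    rep , net , emb , ((rep , rep-bound , rep-denotes , refl) , isGmNetwork) , emb-valid , simulates H values ,
    subst₂ (LogSpaceRun (Machine.M (start mainC)) 6) (sym (enc-word R)) (Output.sem-main R bounded unique)
      (start-logSpace mainC (entries R) (entries-bounded R))
    where open Net R bounded unique
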